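{- Let $B$ be a graph with $n$ vertices and $m$ edges, where $m \ge n$. Let $\sigma = s(L(B))$, suppose that $2$ is not an eigenvalue of the signless Laplacian $Q(B)$, and suppose that $v$ is a vertex of $B$ with $\varphi_B(v) > 0$. For $k \ge 1$ let $B_k$ be the graph consisting of $k$ disjoint copies of $B$ together with, for each $1 \le i \le k-1$, one additional edge joining the vertex $v$ of copy $i$ to the vertex $v$ of copy $i+1$. Then $$s(L(B_k)) = k\sigma - (k-1) \qquad \text{for all } k \ge 1.$$
   Context: All graphs are finite and simple. For a graph $H$ with adjacency matrix $A(H)$, the signature $s(H)$ is the number of positive eigenvalues of $A(H)$ minus the number of negative eigenvalues of $A(H)$, counted with multiplicity. The line graph $L(G)$ has the edges of $G$ as vertices, two being adjacent when they are distinct and share an endpoint. The signless Laplacian of $G$ is $Q(G) = A(G) + D(G)$, where $D(G)$ is the diagonal matrix of vertex degrees. For a graph $G$ such that $2$ is not an eigenvalue of $Q(G)$, and a vertex $x$ of $G$, $\varphi_G(x)$ denotes the $(x,x)$ entry of $(Q(G) - 2I)^{ -1}$. -}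

module Defs where

open import Algebra.Bundles using (CommutativeRing)
open import Data.Bool.Base using (if_then_else_)
open import Data.Fin.Base using (Fin; toℕ; remQuot) renaming (_<_ to _<ᶠ_)
open import Data.Fin.Properties using () renaming (_≟_ to _≟ᶠ_; _<?_ to _<?ᶠ_)
open import Data.Integer.Base using (ℤ; +_) renaming (_-_ to _-ℤ_)
open import Data.List.Base
  using (List; length; filter; foldr; lookup; allFin; cartesianProduct)
open import Data.Nat.Base using (ℕ; suc) renaming (_*_ to _*ℕ_)
open import Data.Nat.Properties using () renaming (_≟_ to _≟ℕ_)
open import Data.Product.Base using (Σ-syntax; ∃-syntax; _×_; _,_; proj₁; proj₂)
open import Data.Sum.Base using (_⊎_; inj₁; inj₂; swap)
open import Data.Vec.Functional using (Vector)
open import Level using (Level; _⊔_; 0ℓ) renaming (suc to lsuc)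
open import Relation.Binary.Core using (Rel)
open import Relation.Binary.Definitions using (Decidable; Symmetric; Irreflexive)
open import Relation.Binary.PropositionalEquality.Core using (_≡_; _≢_; refl; sym)
open import Relation.Binary.Structures using (IsStrictTotalOrder)
open import Relation.Nullary.Decidable.Core
  using (⌊_⌋; ¬?; _×-dec_; _⊎-dec_)
open import Relation.Nullary.Negation.Core using (¬_)

------------------------------------------------------------------------
-- Real closed fields

-- Ordered fields whose polynomials have the intermediate value property.
-- Classically ℝ is one; the real algebraic numbers are a constructive one.
-- A polynomial is its list of coefficients, constant term first.

record RealClosedField (c ℓ₁ ℓ₂ : Level) : Set (lsuc (c ⊔ ℓ₁ ⊔ ℓ₂)) where
  field
    commutativeRing : CommutativeRing c ℓ₁

  open CommutativeRing commutativeRing public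

  evalPoly : List Carrier → Carrier → Carrier
  evalPoly p x = foldr (λ a r → a + x * r) 0# p

  infix 4 _<_

  field
    _<_                : Rel Carrier ℓ₂
    isStrictTotalOrder : IsStrictTotalOrder _≈_ _<_
    0<1                : 0# < 1#
    +-monoˡ-<          : ∀ z {x y} → x < y → x + z < y + z
    *-pos              : ∀ {x y} → 0# < x → 0# < y → 0# < x * y
    inverse            : ∀ x → ¬ (x ≈ 0#) → ∃[ y ] x * y ≈ 1#
    intermediateValue  : ∀ p {a b} → a < b → evalPoly p a < 0# → 0# < evalPoly p b →
                         ∃[ x ] (a < x × x < b × evalPoly p x ≈ 0#)

  open IsStrictTotalOrder isStrictTotalOrder public using (compare; _≟_; _<?_)

------------------------------------------------------------------------
-- Finite simple graphs

record Graph (n : ℕ) : Set₁ where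
  infix 4 _~_ _~?_
  field
    _~_      : Rel (Fin n) 0ℓ
    _~?_     : Decidable _~_
    ~-sym    : Symmetric _~_
    ~-irrefl : Irreflexive _≡_ _~_

module _ {n : ℕ} (G : Graph n) where
  open Graph G

  degree : Fin n → ℕ
  degree x = length (filter (x ~?_) (allFin n))

  -- Each edge {x , y} is listed once, as the pair with x < y.
  edges : List (Fin n × Fin n)
  edges = filter (λ (x , y) → (x <?ᶠ y) ×-dec (x ~? y))
                 (cartesianProduct (allFin n) (allFin n))

  edgeCount : ℕ
  edgeCount = length edges

module _ {n : ℕ} where

  _isEndOf_ : Fin n → Fin n × Fin n → Set
  x isEndOf (a , b) = x ≡ a ⊎ x ≡ b

  ShareEnd : Rel (Fin n × Fin n) 0ℓ
  ShareEnd e f = proj₁ e isEndOf f ⊎ proj₂ e isEndOf f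

  shareEnd? : Decidable ShareEnd
  shareEnd? (a , b) (c , d) =
    ((a ≟ᶠ c) ⊎-dec (a ≟ᶠ d)) ⊎-dec ((b ≟ᶠ c) ⊎-dec (b ≟ᶠ d))

  shareEnd-sym : Symmetric ShareEnd
  shareEnd-sym (inj₁ (inj₁ p)) = inj₁ (inj₁ (sym p))
  shareEnd-sym (inj₁ (inj₂ p)) = inj₂ (inj₁ (sym p))
  shareEnd-sym (inj₂ (inj₁ p)) = inj₁ (inj₂ (sym p))
  shareEnd-sym (inj₂ (inj₂ p)) = inj₂ (inj₂ (sym p))

-- The vertices are the positions in the list of edges.
lineGraph : ∀ {n} (G : Graph n) → Graph (edgeCount G)
lineGraph G = record
  { _~_      = λ i j → i ≢ j × ShareEnd (lookup (edges G) i) (lookup (edges G) j)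
  ; _~?_     = λ i j → ¬? (i ≟ᶠ j) ×-dec shareEnd? (lookup (edges G) i) (lookup (edges G) j)
  ; ~-sym    = λ (i≢j , s) → (λ j≡i → i≢j (sym j≡i)) , shareEnd-sym s
  ; ~-irrefl = λ i≡j (i≢j , _) → i≢j i≡j
  }

module _ {n : ℕ} (B : Graph n) (v : Fin n) where
  open Graph B using (_~_; _~?_; ~-sym; ~-irrefl)

  Consecutive : ∀ {k} → Rel (Fin k) 0ℓ
  Consecutive i j = toℕ j ≡ suc (toℕ i) ⊎ toℕ i ≡ suc (toℕ j)

  -- (i , x) is the vertex x of the i-th copy of B.
  ChainAdj : ∀ {k} → Rel (Fin k × Fin n) 0ℓ
  ChainAdj (i , x) (j , y) =
    (i ≡ j × x ~ y) ⊎ (Consecutive i j × x ≡ v × y ≡ v)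

  chainAdj? : ∀ {k} → Decidable (ChainAdj {k})
  chainAdj? (i , x) (j , y) =
    ((i ≟ᶠ j) ×-dec (x ~? y)) ⊎-dec
    (((toℕ j ≟ℕ suc (toℕ i)) ⊎-dec (toℕ i ≟ℕ suc (toℕ j)))
      ×-dec ((x ≟ᶠ v) ×-dec (y ≟ᶠ v)))

  chainAdj-sym : ∀ {k} → Symmetric (ChainAdj {k})
  chainAdj-sym (inj₁ (i≡j , a))     = inj₁ (sym i≡j , ~-sym a)
  chainAdj-sym (inj₂ (q , x≡v , y≡v)) = inj₂ (swap q , y≡v , x≡v)

  private
    m≢1+m : ∀ {m} → m ≢ suc m
    m≢1+m ()

  chainAdj-irrefl : ∀ {k} → Irreflexive _≡_ (ChainAdj {k})
  chainAdj-irrefl refl (inj₁ (_ , a))      = ~-irrefl refl a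
  chainAdj-irrefl refl (inj₂ (inj₁ p , _)) = m≢1+m p
  chainAdj-irrefl refl (inj₂ (inj₂ p , _)) = m≢1+m p

  chain : ∀ k → Graph (k *ℕ n)
  chain k = record
    { _~_      = λ a b → ChainAdj (remQuot {k} n a) (remQuot {k} n b)
    ; _~?_     = λ a b → chainAdj? (remQuot {k} n a) (remQuot {k} n b)
    ; ~-sym    = chainAdj-sym
    ; ~-irrefl = λ { refl → chainAdj-irrefl refl }
    }

------------------------------------------------------------------------
-- Linear algebra and graph spectra

module Spectral {c ℓ₁ ℓ₂} (R : RealClosedField c ℓ₁ ℓ₂) where
  open RealClosedField R hiding (_<_; 0#)
  open RealClosedField R public using (_<_; 0#)
  open import Algebra.Properties.Semiring.Sum semiring using (sum)
  open import Algebra.Definitions.RawMonoid +-rawMonoid using () renaming (_×_ to _·_)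

  Matrix : ℕ → Set c
  Matrix n = Fin n → Fin n → Carrier

  infix 4 _≈ᵛ_

  _≈ᵛ_ : ∀ {n} → Rel (Vector Carrier n) ℓ₁
  u ≈ᵛ w = ∀ i → u i ≈ w i

  0ᵛ : ∀ {n} → Vector Carrier n
  0ᵛ _ = 0#

  _*ᵛ_ : ∀ {n} → Matrix n → Vector Carrier n → Vector Carrier n
  (M *ᵛ w) i = sum (λ j → M i j * w j)

  _*ᴹ_ : ∀ {n} → Matrix n → Matrix n → Matrix n
  (M *ᴹ N) i j = sum (λ l → M i l * N l j)

  scalar : ∀ {n} → Carrier → Matrix n
  scalar x i j = if ⌊ i ≟ᶠ j ⌋ then x else 0#

  _-ᴹ_ : ∀ {n} → Matrix n → Matrix n → Matrix n
  (M -ᴹ N) i j = M i j - N i j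

  IsInverse : ∀ {n} → Matrix n → Matrix n → Set ℓ₁
  IsInverse M N = (∀ i j → (M *ᴹ N) i j ≈ scalar 1# i j)
                × (∀ i j → (N *ᴹ M) i j ≈ scalar 1# i j)

  Eigenspace : ∀ {n} → Matrix n → Carrier → Vector Carrier n → Set ℓ₁
  Eigenspace M x w = (M *ᵛ w) ≈ᵛ (λ i → x * w i)

  IsEigenvalue : ∀ {n} → Matrix n → Carrier → Set (c ⊔ ℓ₁)
  IsEigenvalue M x = ∃[ w ] (¬ (w ≈ᵛ 0ᵛ) × Eigenspace M x w)

  linComb : ∀ {n d} → (Fin d → Carrier) → (Fin d → Vector Carrier n) → Vector Carrier n
  linComb a b i = sum (λ j → a j * b j i)

  LinearlyIndependent : ∀ {n d} → (Fin d → Vector Carrier n) → Set (c ⊔ ℓ₁)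
  LinearlyIndependent b = ∀ a → linComb a b ≈ᵛ 0ᵛ → ∀ j → a j ≈ 0#

  HasDimension : ∀ {n} → (Vector Carrier n → Set ℓ₁) → ℕ → Set (c ⊔ ℓ₁)
  HasDimension {n} S d = Σ[ b ∈ (Fin d → Vector Carrier n) ]
    ( (∀ j → S (b j))
    × LinearlyIndependent b
    × (∀ w → S w → ∃[ a ] w ≈ᵛ linComb a b))

  -- xs lists the eigenvalues of M, each as often as its multiplicity.
  -- The multiplicity is the dimension of the eigenspace, which for symmetric
  -- matrices equals the algebraic one; non-eigenvalues have multiplicity 0.
  IsSpectrum : ∀ {n} → Matrix n → List Carrier → Set (c ⊔ ℓ₁)
  IsSpectrum M xs = ∀ x → HasDimension (Eigenspace M x) (length (filter (x ≟_) xs))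

  adjacency : ∀ {n} → Graph n → Matrix n
  adjacency G i j = if ⌊ i ~? j ⌋ then 1# else 0#
    where open Graph G

  signlessLaplacian : ∀ {n} → Graph n → Matrix n
  signlessLaplacian G i j =
    adjacency G i j + (if ⌊ i ≟ᶠ j ⌋ then degree G i · 1# else 0#)

  2# : Carrier
  2# = 1# + 1#

  infix 4 _hasSignature_

  -- The relation s(G) = s.
  _hasSignature_ : ∀ {n} → Graph n → ℤ → Set (c ⊔ ℓ₁)
  G hasSignature s = ∃[ xs ]
    ( IsSpectrum (adjacency G) xs
    × s ≡ + length (filter (0# <?_) xs) -ℤ + length (filter (_<? 0#) xs))

  -- The relation φ_G(x) = p.
  φ[_,_]≈_ : ∀ {n} → Graph n → Fin n → Carrier → Set (c ⊔ ℓ₁)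
  φ[ G , x ]≈ p = ∃[ P ]
    (IsInverse (signlessLaplacian G -ᴹ scalar 2#) P × P x x ≈ p)

{-# OPTIONS --safe #-}
module Submission where

-- Let N be the incidence matrix of G. The forms ℓ(w) = |N w|² − 2|w|² of A(L(G)) and κ(x) = |Nᵀ x|² − 2|x|² of
-- Q(G) − 2I are, up to sign and scale, the two Schur complements of |w|² + 2⟨Nᵀ x , w⟩ + 2|x|². Hence
-- |y|² − ℓ(w) and |z|² − κ(x) have the same inertia, that is s(L(G)) = s(Q(G) − 2I) + n − m.
--
-- Each of the k − 1 joining edges adds a square (x_v + x′_v)² to k copies of κ. Let ρ be column v of
-- (Q(B) − 2I)⁻¹, and let P be the incidence matrix of the path on the k copies. Completing squares with ρ shows that
-- |y|² − κ_chain(x) is equivalent to |z|² + φ|P z|² − Σᵢ κ(xᵢ), where y and z have k − 1 coordinates. As φ > 0 the first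
-- two terms are positive definite, so Q(B_k) − 2I has k times the inertia of Q(B) − 2I, and only
-- m(B_k) = k m + (k − 1) accounts for the correction −(k − 1).
--
-- Inertia and spectrum are related by the spectral theorem, which over a real closed field follows by induction on the
-- dimension: a diagonal form bordered by one row has an eigenvalue above its largest diagonal entry, a root of the
-- secular polynomial given by the intermediate value property.

open import Defs
open import Algebra.Bundles using (RawRing)
open import Algebra.Solver.Ring.AlmostCommutativeRing using (fromCommutativeRing; _-Raw-AlmostCommutative⟶_)
open import Data.Bool.Base using (true; false; if_then_else_)
open import Data.Fin.Base
  using (Fin; zero; suc; toℕ; punchIn; inject₁; splitAt; join; combine; remQuot; _↑ˡ_; _↑ʳ_) renaming (_<_ to _<ᶠ_)
open import Data.Fin.Properties
  using (any?; punchInᵢ≢i; splitAt-join; join-splitAt; remQuot-combine; combine-remQuot; combine-injective;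
         combine-monoˡ-<; toℕ-combine; toℕ-injective; toℕ-inject₁; <-cmp)
  renaming (_≟_ to _≟ᶠ_; _<?_ to _<?ᶠ_; suc-injective to sucᶠ-injective)
open import Data.Integer.Base as ℤ using (ℤ; +_; -[1+_])
import Data.Integer.Properties as ℤ
import Data.Integer.Solver as ℤSolver
open import Data.List.Base as List
  using (List; []; _∷_; _++_; length; filter; lookup; tabulate; allFin; cartesianProduct; cartesianProductWith)
open import Data.List.Properties using (length-++; length-map; length-tabulate)
open import Data.List.Membership.Propositional using (_∈_)
open import Data.List.Membership.Propositional.Properties
  using (∈-lookup; ∈-filter⁺; ∈-filter⁻; ∈-allFin; ∈-cartesianProduct⁺; ∈-cartesianProductWith⁺; ∈-cartesianProductWith⁻;
         ∈-++⁺ˡ; ∈-++⁺ʳ; ∈-++⁻; ∈-map⁺; ∈-map⁻)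
open import Data.List.Membership.Propositional.Properties.WithK using (unique∧set⇒bag)
open import Data.List.Relation.Binary.BagAndSetEquality using (∼bag⇒↭)
open import Data.List.Relation.Binary.Permutation.Propositional using (_↭_; prep; swap)
open import Data.List.Relation.Binary.Permutation.Propositional.Properties using (filter-↭; ↭-length; shift)
open import Data.List.Relation.Unary.All as All using (All; []; _∷_)
open import Data.List.Relation.Unary.All.Properties using (all-filter)
open import Data.List.Relation.Unary.AllPairs using (_∷_)
open import Data.List.Relation.Unary.Any as Any using ()
open import Data.List.Relation.Unary.Any.Properties using (lookup-index)
open import Data.List.Relation.Unary.Unique.Propositional using (Unique)
import Data.List.Relation.Unary.Unique.Propositional.Properties as Unique
open import Data.Maybe.Base using (Maybe; just; nothing)
open import Data.Nat.Base as ℕ using (ℕ; zero; suc; s≤s)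
import Data.Nat.Properties as ℕ
import Data.Nat.Solver as ℕSolver
open import Data.Product.Base using (∃-syntax; ∃₂; Σ-syntax; _×_; _,_; proj₁; proj₂; uncurry)
open import Data.Sum.Base using (_⊎_; inj₁; inj₂)
open import Data.Unit.Base using (⊤; tt)
open import Data.Vec.Functional using (Vector; insertAt; removeAt) renaming (_∷_ to _∷ᵛ_)
open import Data.Vec.Functional.Properties using (insertAt-lookup; insertAt-punchIn)
open import Function.Base using (_∘_; id)
open import Function.Bundles using (mk⇔)
open import Level using (Level; _⊔_)
open import Relation.Binary.Definitions using (tri<; tri≈; tri>)
open import Relation.Binary.PropositionalEquality.Core as ≡ using (_≡_; _≢_)
import Relation.Binary.PropositionalEquality.Properties as ≡
open import Relation.Binary.Structures using (IsStrictTotalOrder)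
open import Relation.Nullary.Decidable.Core using (Dec; yes; no; ⌊_⌋; does; ¬?; _×-dec_; decidable-stable)
open import Relation.Nullary.Negation.Core using (¬_; contradiction)
open import Relation.Unary using (Pred; Decidable)

-- Spectra do not pass through Schur complements or changes of basis, but inertia does, so the
-- graphs are compared through forms. The hypothesis hands over a list of eigenvalues of L(B),
-- whereas one for L(B_k) has to be produced. This is why the spectral theorem is proved in full,
-- with dimensions of eigenspaces, and not only Sylvester's law. Inertia is stored as a certificate:
-- a subspace on which the form is positive definite, together with equally many linear functionals
-- on whose common zeros the form takes no positive value. A count of dimensions makes such an index
-- unique, and a pair of linear maps, one in each direction, that match values up to a positive
-- factor transports it. This keeps determinants and normalised bases out of the argument. Null
-- vectors may occur on either side: only the numbers of positive and negative squares are compared,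
-- and the added squares |y|² and |z|² balance the different numbers of edges and vertices.

lookup-unique : ∀ {a} {A : Set a} {xs : List A} → Unique xs → ∀ i j → lookup xs i ≡ lookup xs j → i ≡ j
lookup-unique (x∉xs ∷ u) zero    zero    eq = ≡.refl
lookup-unique (x∉xs ∷ u) zero    (suc j) eq = contradiction eq (All.lookup x∉xs (∈-lookup j))
lookup-unique (x∉xs ∷ u) (suc i) zero    eq = contradiction (≡.sym eq) (All.lookup x∉xs (∈-lookup i))
lookup-unique (x∉xs ∷ u) (suc i) (suc j) eq = ≡.cong suc (lookup-unique u i j eq)

length-filter-map : ∀ {a b p} {A : Set a} {B : Set b} {P : Pred B p} (P? : Decidable P) (f : A → B) xs →
                    length (filter P? (List.map f xs)) ≡ length (filter (P? ∘ f) xs)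
length-filter-map P? f []       = ≡.refl
length-filter-map P? f (x ∷ xs) with does (P? (f x))
... | true  = ≡.cong suc (length-filter-map P? f xs)
... | false = length-filter-map P? f xs

combine-monoʳ-< : ∀ {m n} (i : Fin m) {x y : Fin n} → x <ᶠ y → combine i x <ᶠ combine i y
combine-monoʳ-< {n = n} i {x} {y} x<y = ≡.subst₂ ℕ._<_ (≡.sym (toℕ-combine i x)) (≡.sym (toℕ-combine i y))
  (ℕ.+-monoʳ-< (n ℕ.* toℕ i) x<y)

combine-cancelʳ-< : ∀ {m n} (i : Fin m) {x y : Fin n} → combine i x <ᶠ combine i y → x <ᶠ y
combine-cancelʳ-< {n = n} i {x} {y} lt = ℕ.+-cancelˡ-< (n ℕ.* toℕ i) _ _
  (≡.subst₂ ℕ._<_ (toℕ-combine i x) (toℕ-combine i y) lt)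

-- Edge lists of a graph and of the chain

module _ {n : ℕ} (G : Graph n) where
  open Graph G

  private
    edge? = λ ((x , y) : Fin n × Fin n) → (x <?ᶠ y) ×-dec (x ~? y)

  edges-unique : Unique (edges G)
  edges-unique = Unique.filter⁺ edge? (Unique.cartesianProduct⁺ (Unique.allFin⁺ n) (Unique.allFin⁺ n))

  ∈-edges⁺ : ∀ {x y} → x <ᶠ y → x ~ y → (x , y) ∈ edges G
  ∈-edges⁺ x<y x~y = ∈-filter⁺ edge? (∈-cartesianProduct⁺ (∈-allFin _) (∈-allFin _)) (x<y , x~y)

  ∈-edges⁻ : ∀ {e} → e ∈ edges G → proj₁ e <ᶠ proj₂ e × proj₁ e ~ proj₂ e
  ∈-edges⁻ e∈ = proj₂ (∈-filter⁻ edge? {xs = cartesianProduct (allFin n) (allFin n)} e∈)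

length-cartesianProductWith : ∀ {a b c} {A : Set a} {B : Set b} {C : Set c} (f : A → B → C) xs ys →
                              length (cartesianProductWith f xs ys) ≡ length xs ℕ.* length ys
length-cartesianProductWith f []       ys = ≡.refl
length-cartesianProductWith f (x ∷ xs) ys = ≡.trans (length-++ (List.map (f x) ys))
  (≡.cong₂ ℕ._+_ (length-map (f x) ys) (length-cartesianProductWith f xs ys))

module _ {n : ℕ} (B : Graph n) (v : Fin n) (k : ℕ) where
  open Graph B

  copyEdge : Fin (suc k) → Fin n × Fin n → Fin (suc k ℕ.* n) × Fin (suc k ℕ.* n)
  copyEdge i (x , y) = combine i x , combine i y

  linkEdge : Fin k → Fin (suc k ℕ.* n) × Fin (suc k ℕ.* n)
  linkEdge j = combine (inject₁ j) v , combine (suc j) v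

  -- The edges of the chain grouped by copy, with the links last, so that sums over them split.
  -- `edges` lists them in lexicographic order instead, hence the permutation proved below.
  chainEdges : List (Fin (suc k ℕ.* n) × Fin (suc k ℕ.* n))
  chainEdges = cartesianProductWith copyEdge (allFin (suc k)) (edges B) ++ List.map linkEdge (allFin k)

  private
    inject₁≢suc : ∀ {j : Fin k} → inject₁ j ≢ suc j
    inject₁≢suc {j} eq = ℕ.1+n≢n (≡.trans (≡.cong toℕ (≡.sym eq)) (toℕ-inject₁ j))

    copyEdge-injective : ∀ {i j e f} → copyEdge i e ≡ copyEdge j f → i ≡ j × e ≡ f
    copyEdge-injective {i} {j} {x , y} {x′ , y′} eq
      with ≡.refl , ≡.refl ← combine-injective i x j x′ (≡.cong proj₁ eq)
      with ≡.refl , ≡.refl ← combine-injective i y j y′ (≡.cong proj₂ eq) = ≡.refl , ≡.refl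

    linkEdge-injective : ∀ {i j} → linkEdge i ≡ linkEdge j → i ≡ j
    linkEdge-injective {i} {j} eq = sucᶠ-injective (proj₁ (combine-injective (suc i) v (suc j) v (≡.cong proj₂ eq)))

    -- Both ends of a copied edge lie in one copy, those of a link in two different copies.
    copy≢link : ∀ i e j → copyEdge i e ≢ linkEdge j
    copy≢link i (x , y) j eq = inject₁≢suc (≡.trans
      (≡.sym (proj₁ (combine-injective i x (inject₁ j) v (≡.cong proj₁ eq))))
      (proj₁ (combine-injective i y (suc j) v (≡.cong proj₂ eq))))

  chainEdges-unique : Unique chainEdges
  chainEdges-unique = Unique.++⁺
    (Unique.cartesianProductWith⁺ copyEdge copyEdge-injective (Unique.allFin⁺ (suc k)) (edges-unique B))
    (Unique.map⁺ linkEdge-injective (Unique.allFin⁺ k))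
    λ (p , q) → disjoint p q
    where
    disjoint : ∀ {e} → e ∈ cartesianProductWith copyEdge (allFin (suc k)) (edges B) →
               ¬ (e ∈ List.map linkEdge (allFin k))
    disjoint p q
      with i , f , _ , _ , ≡.refl ← ∈-cartesianProductWith⁻ copyEdge (allFin (suc k)) (edges B) p
      with j , _ , eq ← ∈-map⁻ linkEdge q = copy≢link i f j eq

  chain-adj⁺ : ∀ i x j y → ChainAdj B v (i , x) (j , y) → Graph._~_ (chain B v (suc k)) (combine i x) (combine j y)
  chain-adj⁺ i x j y = ≡.subst₂ (ChainAdj B v) (≡.sym (remQuot-combine i x)) (≡.sym (remQuot-combine j y))

  chainEdges⊆edges : ∀ {e} → e ∈ chainEdges → e ∈ edges (chain B v (suc k))
  chainEdges⊆edges e∈ with ∈-++⁻ (cartesianProductWith copyEdge (allFin (suc k)) (edges B)) e∈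
  ... | inj₁ p with i , (x , y) , _ , f∈ , ≡.refl ← ∈-cartesianProductWith⁻ copyEdge (allFin (suc k)) (edges B) p
               with x<y , x~y ← ∈-edges⁻ B f∈
    = ∈-edges⁺ (chain B v (suc k)) (combine-monoʳ-< i x<y) (chain-adj⁺ i x i y (inj₁ (≡.refl , x~y)))
  ... | inj₂ q with j , _ , ≡.refl ← ∈-map⁻ linkEdge q
    = ∈-edges⁺ (chain B v (suc k)) (combine-monoˡ-< v v (ℕ.≤-reflexive (≡.cong suc (toℕ-inject₁ j))))
        (chain-adj⁺ (inject₁ j) v (suc j) v (inj₂ (inj₁ (≡.cong suc (≡.sym (toℕ-inject₁ j))) , ≡.refl , ≡.refl)))

  adjacent⇒chainEdge : ∀ i x j y → combine i x <ᶠ combine j y → ChainAdj B v (i , x) (j , y) →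
                       (combine i x , combine j y) ∈ chainEdges
  adjacent⇒chainEdge i x .i y lt (inj₁ (≡.refl , x~y)) = ∈-++⁺ˡ
    (∈-cartesianProductWith⁺ copyEdge (∈-allFin i) (∈-edges⁺ B (combine-cancelʳ-< i lt) x~y))
  -- The equation between positions forces `i` to be `inject₁ j`, so this is link `j`.
  adjacent⇒chainEdge i .v (suc j) .v lt (inj₂ (inj₁ eq , ≡.refl , ≡.refl))
    with ≡.refl ← toℕ-injective {i = inject₁ j} {i} (≡.trans (toℕ-inject₁ j) (ℕ.suc-injective eq))
    = ∈-++⁺ʳ (cartesianProductWith copyEdge (allFin (suc k)) (edges B)) (∈-map⁺ linkEdge (∈-allFin j))
  -- A link read from the higher copy to the lower one contradicts the order `lt` of its ends.
  adjacent⇒chainEdge i .v j .v lt (inj₂ (inj₂ eq , ≡.refl , ≡.refl)) = contradiction lt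
    (ℕ.<-asym (combine-monoˡ-< {i = j} {j = i} v v (ℕ.≤-reflexive (≡.sym eq))))

  edges⊆chainEdges : ∀ {e} → e ∈ edges (chain B v (suc k)) → e ∈ chainEdges
  edges⊆chainEdges {a , b} e∈ with a<b , a~b ← ∈-edges⁻ (chain B v (suc k)) e∈ =
    ≡.subst₂ (λ a b → (a , b) ∈ chainEdges) a≡ b≡ (adjacent⇒chainEdge _ _ _ _
      (≡.subst₂ _<ᶠ_ (≡.sym a≡) (≡.sym b≡) a<b) a~b)
    where
    a≡ = combine-remQuot {suc k} n a
    b≡ = combine-remQuot {suc k} n b

  -- Two lists without repetitions and with the same members agree up to order.
  edges-chain-↭ : edges (chain B v (suc k)) ↭ chainEdges
  edges-chain-↭ = ∼bag⇒↭ (unique∧set⇒bag (edges-unique (chain B v (suc k))) chainEdges-unique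
    (mk⇔ edges⊆chainEdges chainEdges⊆edges))

  edgeCount-chain : edgeCount (chain B v (suc k)) ≡ suc k ℕ.* edgeCount B ℕ.+ k
  edgeCount-chain = ≡.trans (↭-length edges-chain-↭) (≡.trans
    (length-++ (cartesianProductWith copyEdge (allFin (suc k)) (edges B)))
    (≡.cong₂ ℕ._+_
      (≡.trans (length-cartesianProductWith copyEdge (allFin (suc k)) (edges B))
               (≡.cong (ℕ._* edgeCount B) (length-tabulate {n = suc k} id)))
      (≡.trans (length-map linkEdge (allFin k)) (length-tabulate {n = k} id))))

module LineGraphSignature {c ℓ₁ ℓ₂ : Level} (R : RealClosedField c ℓ₁ ℓ₂) where

  open RealClosedField R hiding (zero)
  open import Algebra.Properties.Ring ring using (-‿distribˡ-*; -‿distribʳ-*)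
  open import Algebra.Properties.AbelianGroup +-abelianGroup
    using () renaming (⁻¹-∙-comm to -‿+-comm; ε⁻¹≈ε to -0≈0; ⁻¹-involutive to -‿involutive; x∙y⁻¹≈ε⇒x≈y to x-y≈0⇒x≈y; x≈y⇒x∙y⁻¹≈ε to x≈y⇒x-y≈0)
  open import Algebra.Properties.Semiring.Mult.TCOptimised semiring
    using () renaming (_×_ to _×′_; ×-homo-+ to ×′-homo-+; ×1-homo-* to ×′1-homo-*; 1+× to 1+×′)
  open import Algebra.Properties.Semiring.Sum semiring
    using (sum; sum-cong-≋; ∑-distrib-+; ∑-comm; *-distribˡ-sum; *-distribʳ-sum; sum-replicate-zero; sum-remove)
  open import Relation.Binary.Reasoning.Setoid setoid

  -- The ring solver needs coefficients that compute, so they are taken in ℤ rather than in R.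

  fromℤ : ℤ → Carrier
  fromℤ (+ n)    = n ×′ 1#
  fromℤ -[1+ n ] = - (suc n ×′ 1#)

  fromℤ-⊖ : ∀ m n → fromℤ (m ℤ.⊖ n) ≈ m ×′ 1# - n ×′ 1#
  fromℤ-⊖ m       zero    = sym (trans (+-congˡ -0≈0) (+-identityʳ _))
  fromℤ-⊖ zero    (suc n) = sym (+-identityˡ _)
  fromℤ-⊖ (suc m) (suc n) = begin
    fromℤ (suc m ℤ.⊖ suc n)             ≡⟨ ≡.cong fromℤ (ℤ.[1+m]⊖[1+n]≡m⊖n m n) ⟩
    fromℤ (m ℤ.⊖ n)                     ≈⟨ fromℤ-⊖ m n ⟩
    m ×′ 1# - n ×′ 1#                   ≈⟨ +-congʳ (+-identityˡ _) ⟨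
    0# + m ×′ 1# - n ×′ 1#              ≈⟨ +-congʳ (+-congʳ (-‿inverseʳ 1#)) ⟨
    1# + - 1# + m ×′ 1# - n ×′ 1#       ≈⟨ +-congʳ (+-assoc _ _ _) ⟩
    1# + (- 1# + m ×′ 1#) - n ×′ 1#     ≈⟨ +-congʳ (+-congˡ (+-comm _ _)) ⟩
    1# + (m ×′ 1# + - 1#) - n ×′ 1#     ≈⟨ +-congʳ (+-assoc _ _ _) ⟨
    1# + m ×′ 1# + - 1# - n ×′ 1#       ≈⟨ +-assoc _ _ _ ⟩
    1# + m ×′ 1# + (- 1# - n ×′ 1#)     ≈⟨ +-cong (sym (1+×′ m 1#)) (-‿+-comm _ _) ⟩
    suc m ×′ 1# - (1# + n ×′ 1#)        ≈⟨ +-congˡ (-‿cong (1+×′ n 1#)) ⟨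
    suc m ×′ 1# - suc n ×′ 1#           ∎

  fromℤ-+ : ∀ i j → fromℤ (i ℤ.+ j) ≈ fromℤ i + fromℤ j
  fromℤ-+ (+ m)    (+ n)    = ×′-homo-+ 1# m n
  fromℤ-+ (+ m)    -[1+ n ] = fromℤ-⊖ m (suc n)
  fromℤ-+ -[1+ m ] (+ n)    = trans (fromℤ-⊖ n (suc m)) (+-comm _ _)
  fromℤ-+ -[1+ m ] -[1+ n ] = begin
    - (suc (suc (m ℕ.+ n)) ×′ 1#)          ≡⟨ ≡.cong (λ l → - (suc l ×′ 1#)) (ℕ.+-suc m n) ⟨
    - ((suc m ℕ.+ suc n) ×′ 1#)            ≈⟨ -‿cong (×′-homo-+ 1# (suc m) (suc n)) ⟩
    - (suc m ×′ 1# + suc n ×′ 1#)          ≈⟨ -‿+-comm _ _ ⟨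
    - (suc m ×′ 1#) + - (suc n ×′ 1#)      ∎

  fromℤ-neg : ∀ i → fromℤ (ℤ.- i) ≈ - fromℤ i
  fromℤ-neg (+ zero)  = sym -0≈0
  fromℤ-neg (+ suc n) = refl
  fromℤ-neg -[1+ n ]  = sym (-‿involutive _)

  fromℤ-* : ∀ i j → fromℤ (i ℤ.* j) ≈ fromℤ i * fromℤ j
  fromℤ-* (+ m) (+ n) = trans (reflexive (≡.cong fromℤ (ℤ.+◃n≡+n (m ℕ.* n)))) (×′1-homo-* m n)
  fromℤ-* (+ m) -[1+ n ] = begin
    fromℤ (+ m ℤ.* -[1+ n ])              ≡⟨ ≡.cong fromℤ (ℤ.-◃n≡-n (m ℕ.* suc n)) ⟩
    fromℤ (ℤ.- (+ (m ℕ.* suc n)))         ≈⟨ fromℤ-neg (+ (m ℕ.* suc n)) ⟩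
    - ((m ℕ.* suc n) ×′ 1#)               ≈⟨ -‿cong (×′1-homo-* m (suc n)) ⟩
    - (m ×′ 1# * suc n ×′ 1#)             ≈⟨ -‿distribʳ-* _ _ ⟩
    m ×′ 1# * - (suc n ×′ 1#)             ∎
  fromℤ-* -[1+ m ] (+ n) = begin
    fromℤ (-[1+ m ] ℤ.* + n)              ≡⟨ ≡.cong fromℤ (ℤ.-◃n≡-n (suc m ℕ.* n)) ⟩
    fromℤ (ℤ.- (+ (suc m ℕ.* n)))         ≈⟨ fromℤ-neg (+ (suc m ℕ.* n)) ⟩
    - ((suc m ℕ.* n) ×′ 1#)               ≈⟨ -‿cong (×′1-homo-* (suc m) n) ⟩
    - (suc m ×′ 1# * n ×′ 1#)             ≈⟨ -‿distribˡ-* _ _ ⟩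
    - (suc m ×′ 1#) * n ×′ 1#             ∎
  fromℤ-* -[1+ m ] -[1+ n ] = begin
    fromℤ (-[1+ m ] ℤ.* -[1+ n ])                 ≡⟨ ≡.cong fromℤ (ℤ.+◃n≡+n (suc m ℕ.* suc n)) ⟩
    (suc m ℕ.* suc n) ×′ 1#                       ≈⟨ ×′1-homo-* (suc m) (suc n) ⟩
    suc m ×′ 1# * suc n ×′ 1#                     ≈⟨ -‿involutive _ ⟨
    - - (suc m ×′ 1# * suc n ×′ 1#)               ≈⟨ -‿cong (-‿distribˡ-* _ _) ⟩
    - (- (suc m ×′ 1#) * suc n ×′ 1#)             ≈⟨ -‿distribʳ-* _ _ ⟩
    - (suc m ×′ 1#) * - (suc n ×′ 1#)             ∎

  ℤ-rawRing : RawRing _ _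
  ℤ-rawRing = record
    { Carrier = ℤ ; _≈_ = _≡_ ; _+_ = ℤ._+_ ; _*_ = ℤ._*_ ; -_ = ℤ.-_ ; 0# = + 0 ; 1# = + 1 }

  -- With the optimised multiples, `1 ×′ 1#` computes to `1#` and `2 ×′ 1#` to `1# + 1#`. So
  -- `1-homo` is `refl`, and `con (+ 2)` in the solver calls below stands for `2#` on the nose.
  fromℤ-morphism : ℤ-rawRing -Raw-AlmostCommutative⟶ fromCommutativeRing commutativeRing
  fromℤ-morphism = record
    { ⟦_⟧ = fromℤ ; +-homo = fromℤ-+ ; *-homo = fromℤ-* ; -‿homo = fromℤ-neg
    ; 0-homo = refl ; 1-homo = refl }

  fromℤ-≟ : ∀ i j → Maybe (fromℤ i ≈ fromℤ j)
  fromℤ-≟ i j with i ℤ.≟ j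
  ... | yes i≡j = just (reflexive (≡.cong fromℤ i≡j))
  ... | no  _   = nothing

  open import Algebra.Solver.Ring ℤ-rawRing (fromCommutativeRing commutativeRing) fromℤ-morphism fromℤ-≟
    using (solve; con; _:=_; _:+_; _:*_; _:-_; :-_)

  open Spectral R using
    (Matrix; _≈ᵛ_; _*ᵛ_; scalar; Eigenspace; linComb; HasDimension; IsSpectrum;
     adjacency; signlessLaplacian; 2#; _hasSignature_; _-ᴹ_)
  open IsStrictTotalOrder isStrictTotalOrder using (<-respʳ-≈; <-respˡ-≈; irrefl) renaming (trans to <-trans)

  -- Order arithmetic

  NonNeg : Carrier → Set _
  NonNeg x = 0# < x ⊎ x ≈ 0#

  <⇒0<- : ∀ {x y} → x < y → 0# < y - x
  <⇒0<- {x} x<y = <-respˡ-≈ (-‿inverseʳ x) (+-monoˡ-< (- x) x<y)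

  0<-⇒< : ∀ {x y} → 0# < y - x → x < y
  0<-⇒< {x} {y} 0<y-x = <-respˡ-≈ (+-identityˡ x)
    (<-respʳ-≈ (solve 2 (λ x y → y :- x :+ x := y) refl x y) (+-monoˡ-< x 0<y-x))

  <0⇒0<- : ∀ {x} → x < 0# → 0# < - x
  <0⇒0<- x<0 = <-respʳ-≈ (+-identityˡ _) (<⇒0<- x<0)

  0<-⇒<0 : ∀ {x} → 0# < - x → x < 0#
  0<-⇒<0 0<-x = 0<-⇒< (<-respʳ-≈ (sym (+-identityˡ _)) 0<-x)

  0<⇒-<0 : ∀ {x} → 0# < x → - x < 0#
  0<⇒-<0 0<x = 0<-⇒<0 (<-respʳ-≈ (sym (-‿involutive _)) 0<x)

  <⇒≉ : ∀ {x y} → x < y → ¬ (x ≈ y)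
  <⇒≉ x<y x≈y = irrefl x≈y x<y

  >⇒≉ : ∀ {x y} → y < x → ¬ (x ≈ y)
  >⇒≉ y<x x≈y = irrefl (sym x≈y) y<x

  <-asym : ∀ {x y} → x < y → ¬ (y < x)
  <-asym x<y y<x = irrefl refl (<-trans x<y y<x)

  ≮0⇒NonNeg : ∀ {x} → ¬ (x < 0#) → NonNeg x
  ≮0⇒NonNeg {x} x≮0 with compare x 0#
  ... | tri< x<0 _ _ = contradiction x<0 x≮0
  ... | tri≈ _ x≈0 _ = inj₂ x≈0
  ... | tri> _ _ 0<x = inj₁ 0<x

  ≯0⇒NonNeg- : ∀ {x} → ¬ (0# < x) → NonNeg (- x)
  ≯0⇒NonNeg- x≯0 = ≮0⇒NonNeg (λ -x<0 → x≯0 (<-respʳ-≈ (-‿involutive _) (<0⇒0<- -x<0)))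

  NonNeg⇒≮0 : ∀ {x} → NonNeg x → ¬ (x < 0#)
  NonNeg⇒≮0 (inj₁ 0<x) x<0 = <-asym 0<x x<0
  NonNeg⇒≮0 (inj₂ x≈0) x<0 = <⇒≉ x<0 x≈0

  NonNeg-cong : ∀ {x y} → x ≈ y → NonNeg x → NonNeg y
  NonNeg-cong x≈y (inj₁ 0<x) = inj₁ (<-respʳ-≈ x≈y 0<x)
  NonNeg-cong x≈y (inj₂ x≈0) = inj₂ (trans (sym x≈y) x≈0)

  +-pos-NonNeg : ∀ {x y} → 0# < x → NonNeg y → 0# < x + y
  +-pos-NonNeg {x} {y} 0<x (inj₁ 0<y) = <-trans 0<y (<-respˡ-≈ (+-identityˡ y) (+-monoˡ-< y 0<x))
  +-pos-NonNeg {x} {y} 0<x (inj₂ y≈0) = <-respʳ-≈ (sym (trans (+-congˡ y≈0) (+-identityʳ x))) 0<x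

  +-NonNeg-pos : ∀ {x y} → NonNeg x → 0# < y → 0# < x + y
  +-NonNeg-pos 0≤x 0<y = <-respʳ-≈ (+-comm _ _) (+-pos-NonNeg 0<y 0≤x)

  +-NonNeg : ∀ {x y} → NonNeg x → NonNeg y → NonNeg (x + y)
  +-NonNeg (inj₁ 0<x) 0≤y = inj₁ (+-pos-NonNeg 0<x 0≤y)
  +-NonNeg (inj₂ x≈0) 0≤y = NonNeg-cong (sym (trans (+-congʳ x≈0) (+-identityˡ _))) 0≤y

  *-NonNeg : ∀ {x y} → NonNeg x → NonNeg y → NonNeg (x * y)
  *-NonNeg (inj₁ 0<x) (inj₁ 0<y) = inj₁ (*-pos 0<x 0<y)
  *-NonNeg (inj₁ 0<x) (inj₂ y≈0) = inj₂ (trans (*-congˡ y≈0) (zeroʳ _))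
  *-NonNeg (inj₂ x≈0) _          = inj₂ (trans (*-congʳ x≈0) (zeroˡ _))

  square-pos : ∀ {x} → ¬ (x ≈ 0#) → 0# < x * x
  square-pos {x} x≉0 with compare x 0#
  ... | tri< x<0 _ _ = <-respʳ-≈ (solve 1 (λ x → (:- x) :* (:- x) := x :* x) refl x)
                                 (*-pos (<0⇒0<- x<0) (<0⇒0<- x<0))
  ... | tri≈ _ x≈0 _ = contradiction x≈0 x≉0
  ... | tri> _ _ 0<x = *-pos 0<x 0<x

  square-NonNeg : ∀ x → NonNeg (x * x)
  square-NonNeg x with x ≟ 0#
  ... | yes x≈0 = inj₂ (trans (*-congʳ x≈0) (zeroˡ x))
  ... | no  x≉0 = inj₁ (square-pos x≉0)

  1≉0 : ¬ (1# ≈ 0#)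
  1≉0 = >⇒≉ 0<1

  ≉0-cancelˡ : ∀ {x y} → ¬ (x ≈ 0#) → x * y ≈ 0# → y ≈ 0#
  ≉0-cancelˡ {x} {y} x≉0 xy≈0 with inverse x x≉0
  ... | z , xz≈1 = begin
    y             ≈⟨ *-identityˡ y ⟨
    1# * y        ≈⟨ *-congʳ xz≈1 ⟨
    x * z * y     ≈⟨ solve 3 (λ x y z → x :* z :* y := z :* (x :* y)) refl x y z ⟩
    z * (x * y)   ≈⟨ *-congˡ xy≈0 ⟩
    z * 0#        ≈⟨ zeroʳ z ⟩
    0#            ∎

  *-≉0 : ∀ {x y} → ¬ (x ≈ 0#) → ¬ (y ≈ 0#) → ¬ (x * y ≈ 0#)
  *-≉0 x≉0 y≉0 xy≈0 = y≉0 (≉0-cancelˡ x≉0 xy≈0)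

  pos-cancelˡ : ∀ {x y} → 0# < x → 0# < x * y → 0# < y
  pos-cancelˡ {x} {y} 0<x 0<xy with compare y 0#
  ... | tri< y<0 _ _ = contradiction
    (<-respʳ-≈ (sym (-‿distribʳ-* x y)) (*-pos 0<x (<0⇒0<- y<0))) (<-asym (0<⇒-<0 0<xy))
  ... | tri≈ _ y≈0 _ = contradiction (trans (*-congˡ y≈0) (zeroʳ x)) (>⇒≉ 0<xy)
  ... | tri> _ _ 0<y = 0<y

  inverse-pos : ∀ {x y} → 0# < x → x * y ≈ 1# → 0# < y
  inverse-pos 0<x xy≈1 = pos-cancelˡ 0<x (<-respʳ-≈ (sym xy≈1) 0<1)

  -- Finite sums

  sum-0 : ∀ {n} {f : Vector Carrier n} → (∀ i → f i ≈ 0#) → sum f ≈ 0#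
  sum-0 {n} f≈0 = trans (sum-cong-≋ f≈0) (sum-replicate-zero n)

  sum-neg : ∀ {n} (f : Vector Carrier n) → sum (λ i → - f i) ≈ - sum f
  sum-neg {zero}  f = sym -0≈0
  sum-neg {suc n} f = trans (+-congˡ (sum-neg (f ∘ suc))) (-‿+-comm _ _)

  ∑-distrib-- : ∀ {n} (f g : Vector Carrier n) → sum (λ i → f i - g i) ≈ sum f - sum g
  ∑-distrib-- f g = trans (∑-distrib-+ f (λ i → - g i)) (+-congˡ (sum-neg g))

  sum-single : ∀ {n} {f : Vector Carrier n} i → (∀ j → j ≢ i → f j ≈ 0#) → sum f ≈ f i
  sum-single {suc n} {f} i f≈0 = begin
    sum f                     ≈⟨ sum-remove f ⟩
    f i + sum (removeAt f i)  ≈⟨ +-congˡ (sum-0 (λ j → f≈0 (punchIn i j) (punchInᵢ≢i i j))) ⟩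
    f i + 0#                  ≈⟨ +-identityʳ _ ⟩
    f i                       ∎

  sum-NonNeg : ∀ {n} {f : Vector Carrier n} → (∀ i → NonNeg (f i)) → NonNeg (sum f)
  sum-NonNeg {zero}  0≤f = inj₂ refl
  sum-NonNeg {suc n} 0≤f = +-NonNeg (0≤f zero) (sum-NonNeg (0≤f ∘ suc))

  sum-pos : ∀ {n} {f : Vector Carrier n} → (∀ i → NonNeg (f i)) → ∀ i → 0# < f i → 0# < sum f
  sum-pos 0≤f zero    0<fi = +-pos-NonNeg 0<fi (sum-NonNeg (0≤f ∘ suc))
  sum-pos 0≤f (suc i) 0<fi = +-NonNeg-pos (0≤f zero) (sum-pos (0≤f ∘ suc) i 0<fi)

  scalar-≡ : ∀ {n} {x} {i j : Fin n} → i ≡ j → scalar x i j ≈ x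
  scalar-≡ {i = i} {j} i≡j with i ≟ᶠ j
  ... | yes _   = refl
  ... | no  i≢j = contradiction i≡j i≢j

  scalar-≢ : ∀ {n} {x} {i j : Fin n} → i ≢ j → scalar x i j ≈ 0#
  scalar-≢ {i = i} {j} i≢j with i ≟ᶠ j
  ... | yes i≡j = contradiction i≡j i≢j
  ... | no  _   = refl

  scalar-sym : ∀ {n x} (i j : Fin n) → scalar x i j ≈ scalar x j i
  scalar-sym i j with i ≟ᶠ j
  ... | yes i≡j = sym (scalar-≡ (≡.sym i≡j))
  ... | no  i≢j = sym (scalar-≢ (i≢j ∘ ≡.sym))

  scalar-*ᵛ : ∀ {n} x (w : Vector Carrier n) i → (scalar x *ᵛ w) i ≈ x * w i
  scalar-*ᵛ x w i = trans
    (sum-single i (λ j j≢i → trans (*-congʳ (scalar-≢ (j≢i ∘ ≡.sym))) (zeroˡ _)))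
    (*-congʳ (scalar-≡ ≡.refl))

  -- Homogeneous linear systems

  -- Gaussian elimination without division. All dimension counts rest on it: `index-≤`,
  -- `orthogonal-complement`, `orthogonal-complete` and `dimension-≤`.
  kernel : ∀ {p q} → p ℕ.< q → (A : Fin p → Fin q → Carrier) →
           Σ[ a ∈ Vector Carrier q ] (∃[ j ] ¬ (a j ≈ 0#)) × (∀ i → sum (λ j → A i j * a j) ≈ 0#)
  kernel {zero} {suc q} _ A = (λ _ → 1#) , (zero , 1≉0) , λ ()
  kernel {suc p} {suc q} (s≤s p<q) A with any? (λ j → ¬? (A zero j ≟ 0#))
  ... | no A₀≈0 with kernel {p} {suc q} (ℕ.m<n⇒m<1+n p<q) (A ∘ suc)
  ...   | a , a≉0 , Aa≈0 = a , a≉0 , λ where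
    zero    → sum-0 (λ j → trans (*-congʳ (decidable-stable (A zero j ≟ 0#) (λ ≉0 → A₀≈0 (j , ≉0)))) (zeroˡ (a j)))
    (suc i) → Aa≈0 i
  kernel {suc p} {suc q} (s≤s p<q) A | yes (j₀ , A₀≉0)
    -- Cross-multiplication with the pivot row clears column `j₀` from the remaining rows.
    with kernel p<q (λ i j → A zero j₀ * A (suc i) (punchIn j₀ j) - A (suc i) j₀ * A zero (punchIn j₀ j))
  ... | a , (j , aj≉0) , A′a≈0 = b , (punchIn j₀ j , bj≉0) , Ab≈0
    where
    t = A zero j₀
    row : Fin (suc p) → Carrier
    row i = sum (λ j → A i (punchIn j₀ j) * a j)
    -- Solving the pivot row for coordinate `j₀` would divide by `t`; the whole solution is
    -- multiplied by `t` instead.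
    b = insertAt (λ j → t * a j) j₀ (- row zero)
    bj≉0 : ¬ (b (punchIn j₀ j) ≈ 0#)
    bj≉0 bj≈0 = *-≉0 A₀≉0 aj≉0 (trans (reflexive (≡.sym (insertAt-punchIn _ j₀ _ j))) bj≈0)
    expand : ∀ i → sum (λ j → A i j * b j) ≈ A i j₀ * (- row zero) + t * row i
    expand i = begin
      sum (λ j → A i j * b j)
        ≈⟨ sum-remove (λ j → A i j * b j) ⟩
      A i j₀ * b j₀ + sum (λ j → A i (punchIn j₀ j) * b (punchIn j₀ j))
        ≈⟨ +-cong (*-congˡ (reflexive (insertAt-lookup _ j₀ _))) (sum-cong-≋ {q} (λ j →
             trans (*-congˡ (reflexive (insertAt-punchIn _ j₀ _ j)))
                   (solve 3 (λ x y z → x :* (y :* z) := y :* (x :* z)) refl _ _ _))) ⟩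
      A i j₀ * (- row zero) + sum (λ j → t * (A i (punchIn j₀ j) * a j))
        ≈⟨ +-congˡ (*-distribˡ-sum {q} t _) ⟨
      A i j₀ * (- row zero) + t * row i ∎
    Ab≈0 : ∀ i → sum (λ j → A i j * b j) ≈ 0#
    Ab≈0 zero = trans (expand zero) (solve 2 (λ x y → x :* (:- y) :+ x :* y := con (+ 0)) refl _ _)
    Ab≈0 (suc i) = begin
      sum (λ j → A (suc i) j * b j)                          ≈⟨ expand (suc i) ⟩
      A (suc i) j₀ * (- row zero) + t * row (suc i)
        ≈⟨ solve 4 (λ x y t z → x :* (:- y) :+ t :* z := t :* z :- x :* y) refl _ _ _ _ ⟩
      t * row (suc i) - A (suc i) j₀ * row zero
        ≈⟨ +-cong (*-distribˡ-sum {q} t _) (-‿cong (*-distribˡ-sum {q} (A (suc i) j₀) _)) ⟩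
      sum (λ j → t * (A (suc i) (punchIn j₀ j) * a j)) - sum (λ j → A (suc i) j₀ * (A zero (punchIn j₀ j) * a j))
        ≈⟨ ∑-distrib-- {q} _ _ ⟨
      sum (λ j → t * (A (suc i) (punchIn j₀ j) * a j) - A (suc i) j₀ * (A zero (punchIn j₀ j) * a j))
        ≈⟨ sum-cong-≋ {q} (λ j → solve 5 (λ t x y z a → t :* (x :* a) :- y :* (z :* a) := (t :* x :- y :* z) :* a)
                               refl _ _ _ _ _) ⟩
      sum (λ j → (t * A (suc i) (punchIn j₀ j) - A (suc i) j₀ * A zero (punchIn j₀ j)) * a j)
        ≈⟨ A′a≈0 i ⟩
      0# ∎

  -- Linear maps between function spaces

  infix 0 _⊸_
  infix 4 _≲_

  -- The index types are arbitrary, so that direct sums live on `⊎` and powers on `×`; these are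
  -- renumbered by `Fin` only when dimensions are counted.
  record _⊸_ (I J : Set) : Set (c ⊔ ℓ₁) where
    field
      map      : (I → Carrier) → (J → Carrier)
      map-cong : ∀ {x y} → (∀ i → x i ≈ y i) → ∀ j → map x j ≈ map y j
      map-+    : ∀ x y j → map (λ i → x i + y i) j ≈ map x j + map y j
      map-*    : ∀ a x j → map (λ i → a * x i) j ≈ a * map x j

    map-0 : ∀ {x} → (∀ i → x i ≈ 0#) → ∀ j → map x j ≈ 0#
    map-0 {x} x≈0 j = begin
      map x j               ≈⟨ map-cong (λ i → trans (x≈0 i) (sym (zeroˡ (x i)))) j ⟩
      map (λ i → 0# * x i) j ≈⟨ map-* 0# x j ⟩
      0# * map x j          ≈⟨ zeroˡ _ ⟩
      0#                    ∎

    map-sum : ∀ {n} (v : Fin n → I → Carrier) j →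
              map (λ i → sum (λ k → v k i)) j ≈ sum (λ k → map (v k) j)
    map-sum {zero}  v j = map-0 (λ _ → refl) j
    map-sum {suc n} v j = trans (map-+ _ _ j) (+-congˡ (map-sum (v ∘ suc) j))

  open _⊸_

  module _ {I J : Set} where

    infixl 6 _+ᴸ_ _-ᴸ_
    infixr 7 _•_

    reindex : (J → I) → I ⊸ J
    reindex f = record
      { map = _∘ f ; map-cong = λ x≈y j → x≈y (f j) ; map-+ = λ _ _ _ → refl ; map-* = λ _ _ _ → refl }

    _+ᴸ_ : I ⊸ J → I ⊸ J → I ⊸ J
    f +ᴸ g = record
      { map      = λ x j → map f x j + map g x j
      ; map-cong = λ x≈y j → +-cong (map-cong f x≈y j) (map-cong g x≈y j)
      ; map-+    = λ x y j → trans (+-cong (map-+ f x y j) (map-+ g x y j))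
                     (solve 4 (λ a b c d → (a :+ b) :+ (c :+ d) := (a :+ c) :+ (b :+ d)) refl _ _ _ _)
      ; map-*    = λ a x j → trans (+-cong (map-* f a x j) (map-* g a x j)) (sym (distribˡ a _ _))
      }

    _•_ : Carrier → I ⊸ J → I ⊸ J
    b • f = record
      { map      = λ x j → b * map f x j
      ; map-cong = λ x≈y j → *-congˡ (map-cong f x≈y j)
      ; map-+    = λ x y j → trans (*-congˡ (map-+ f x y j)) (distribˡ b _ _)
      ; map-*    = λ a x j → trans (*-congˡ (map-* f a x j))
                     (solve 3 (λ b a x → b :* (a :* x) := a :* (b :* x)) refl _ _ _)
      }

    _-ᴸ_ : I ⊸ J → I ⊸ J → I ⊸ J
    f -ᴸ g = record
      { map      = λ x j → map f x j - map g x j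
      ; map-cong = λ x≈y j → +-cong (map-cong f x≈y j) (-‿cong (map-cong g x≈y j))
      ; map-+    = λ x y j → trans (+-cong (map-+ f x y j) (-‿cong (map-+ g x y j)))
                     (solve 4 (λ a b c d → (a :+ b) :- (c :+ d) := (a :- c) :+ (b :- d)) refl _ _ _ _)
      ; map-*    = λ a x j → trans (+-cong (map-* f a x j) (-‿cong (map-* g a x j)))
                     (solve 3 (λ a y z → a :* y :- a :* z := a :* (y :- z)) refl _ _ _)
      }

    0ᴸ : I ⊸ J
    0ᴸ = record
      { map      = λ _ _ → 0#
      ; map-cong = λ _ _ → refl
      ; map-+    = λ _ _ _ → sym (+-identityˡ 0#)
      ; map-*    = λ a _ _ → sym (zeroʳ a)
      }

  idᴸ : ∀ {I} → I ⊸ I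
  idᴸ = reindex id

  module _ {I J K : Set} where

    infixr 9 _∘ᴸ_

    _∘ᴸ_ : J ⊸ K → I ⊸ J → I ⊸ K
    f ∘ᴸ g = record
      { map      = map f ∘ map g
      ; map-cong = λ x≈y → map-cong f (map-cong g x≈y)
      ; map-+    = λ x y k → trans (map-cong f (map-+ g x y) k) (map-+ f _ _ k)
      ; map-*    = λ a x k → trans (map-cong f (map-* g a x) k) (map-* f a _ k)
      }

    ⟨_,_⟩ᴸ : I ⊸ J → I ⊸ K → I ⊸ J ⊎ K
    ⟨ f , g ⟩ᴸ = record
      { map      = λ { x (inj₁ j) → map f x j ; x (inj₂ k) → map g x k }
      ; map-cong = λ { x≈y (inj₁ j) → map-cong f x≈y j ; x≈y (inj₂ k) → map-cong g x≈y k }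
      ; map-+    = λ { x y (inj₁ j) → map-+ f x y j ; x y (inj₂ k) → map-+ g x y k }
      ; map-*    = λ { a x (inj₁ j) → map-* f a x j ; a x (inj₂ k) → map-* g a x k }
      }

  π₁ : ∀ {I J} → I ⊎ J ⊸ I
  π₁ = reindex inj₁

  π₂ : ∀ {I J} → I ⊎ J ⊸ J
  π₂ = reindex inj₂

  copiesᴸ : ∀ {I J K : Set} → I ⊸ J → K × I ⊸ K × J
  copiesᴸ f = record
    { map      = λ { x (k , j) → map f (λ i → x (k , i)) j }
    ; map-cong = λ { x≈y (k , j) → map-cong f (λ i → x≈y (k , i)) j }
    ; map-+    = λ { x y (k , j) → map-+ f _ _ j }
    ; map-*    = λ { a x (k , j) → map-* f a _ j }
    }

  scaledReindex : ∀ {I J : Set} → (J → Carrier) → (J → I) → I ⊸ J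
  scaledReindex ρ f = record
    { map      = λ x j → ρ j * x (f j)
    ; map-cong = λ x≈y j → *-congˡ (x≈y (f j))
    ; map-+    = λ x y j → distribˡ _ _ _
    ; map-*    = λ a x j → solve 3 (λ r a x → r :* (a :* x) := a :* (r :* x)) refl _ _ _
    }

  matrixᴸ : ∀ {I} {n} → (I → Fin n → Carrier) → Fin n ⊸ I
  matrixᴸ {n = n} A = record
    { map      = λ x i → sum (λ j → A i j * x j)
    ; map-cong = λ x≈y i → sum-cong-≋ {n} (λ j → *-congˡ (x≈y j))
    ; map-+    = λ x y i → trans (sum-cong-≋ {n} (λ j → distribˡ (A i j) (x j) (y j))) (∑-distrib-+ {n} _ _)
    ; map-*    = λ a x i → trans
        (sum-cong-≋ {n} (λ j → solve 3 (λ r a x → r :* (a :* x) := a :* (r :* x)) refl (A i j) a (x j)))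
        (sym (*-distribˡ-sum {n} a _))
    }

  -- `scalar 1# j` is the j-th unit vector, so the system handed to `kernel` is the matrix of `f`.
  linear-kernel : ∀ {p q} → p ℕ.< q → (f : Fin q ⊸ Fin p) →
                  Σ[ a ∈ Vector Carrier q ] (∃[ j ] ¬ (a j ≈ 0#)) × (∀ i → map f a i ≈ 0#)
  linear-kernel {p} {q} p<q f with kernel p<q (λ i j → map f (scalar 1# j) i)
  ... | a , a≉0 , Aa≈0 = a , a≉0 , λ i → begin
    map f a i
      ≈⟨ map-cong f (λ k → trans (sym (*-identityˡ _)) (trans (sym (scalar-*ᵛ 1# a k))
           (sum-cong-≋ {q} (λ j → trans (*-comm _ _) (*-congˡ (scalar-sym k j)))))) i ⟩
    map f (λ k → sum (λ j → a j * scalar 1# j k)) i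
      ≈⟨ map-sum f (λ j k → a j * scalar 1# j k) i ⟩
    sum (λ j → map f (λ k → a j * scalar 1# j k) i)
      ≈⟨ sum-cong-≋ {q} (λ j → trans (map-* f (a j) _ i) (*-comm _ _)) ⟩
    sum (λ j → map f (scalar 1# j) i * a j)
      ≈⟨ Aa≈0 i ⟩
    0# ∎

  -- Inertia of forms

  -- Only values are kept, without polarisation: the index is defined through values alone, and
  -- sums, copies and negatives of forms are then formed directly.
  record Form (I : Set) : Set (c ⊔ ℓ₁) where
    field
      val      : (I → Carrier) → Carrier
      val-cong : ∀ {x y} → (∀ i → x i ≈ y i) → val x ≈ val y
      val-0    : val (λ _ → 0#) ≈ 0#

  open Form

  infix  8 -ᶠ_
  infixr 6 _⊕_

  -ᶠ_ : ∀ {I} → Form I → Form I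
  -ᶠ q = record
    { val      = λ x → - val q x
    ; val-cong = λ x≈y → -‿cong (val-cong q x≈y)
    ; val-0    = trans (-‿cong (val-0 q)) -0≈0
    }

  _⊕_ : ∀ {I J} → Form I → Form J → Form (I ⊎ J)
  q ⊕ r = record
    { val      = λ x → val q (x ∘ inj₁) + val r (x ∘ inj₂)
    ; val-cong = λ x≈y → +-cong (val-cong q (x≈y ∘ inj₁)) (val-cong r (x≈y ∘ inj₂))
    ; val-0    = trans (+-cong (val-0 q) (val-0 r)) (+-identityˡ 0#)
    }

  copies : ∀ {I} k → Form I → Form (Fin k × I)
  copies k q = record
    { val      = λ x → sum (λ i → val q (λ j → x (i , j)))
    ; val-cong = λ x≈y → sum-cong-≋ {k} (λ i → val-cong q (λ j → x≈y (i , j)))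
    ; val-0    = sum-0 {k} (λ _ → val-0 q)
    }

  -- q is positive definite on the image of section, whose dimension ∣ P ∣ is
  -- also the codimension of the space f = 0, on which q is nonpositive.
  record HasIndex {I} (q : Form I) (P : Set) : Set (c ⊔ ℓ₁ ⊔ ℓ₂) where
    field
      section     : P ⊸ I
      definite    : ∀ a → ¬ (0# < val q (map section a)) → ∀ i → a i ≈ 0#
      functionals : I ⊸ P
      nonpositive : ∀ x → (∀ i → map functionals x i ≈ 0#) → ¬ (0# < val q x)

  open HasIndex

  section-NonNeg : ∀ {I P} {q : Form I} (h : HasIndex q P) → ∀ a → NonNeg (val q (map (section h) a))
  section-NonNeg {q = q} h a with 0# <? val q (map (section h) a)
  ... | yes 0<qa = inj₁ 0<qa
  ... | no  0≮qa = inj₂ (trans (val-cong q (map-0 (section h) (definite h a 0≮qa))) (val-0 q))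

  -- Sylvester's law of inertia. If `n` exceeded `m`, some nonzero vector of the second definite
  -- space would be killed by the `m` functionals of the first certificate, and the form would be
  -- both positive and nonpositive on it.
  index-≤ : ∀ {I} {q : Form I} {m n} → HasIndex q (Fin m) → HasIndex q (Fin n) → n ℕ.≤ m
  index-≤ {q = q} {m} {n} h h′ with n ℕ.≤? m
  ... | yes n≤m = n≤m
  ... | no  n≰m with linear-kernel (ℕ.≰⇒> n≰m) (functionals h ∘ᴸ section h′)
  ...   | a , (j , aj≉0) , fsa≈0 = contradiction (definite h′ a (nonpositive h _ fsa≈0) j) aj≉0

  index-unique : ∀ {I} {q : Form I} {m n} → HasIndex q (Fin m) → HasIndex q (Fin n) → m ≡ n
  index-unique h h′ = ℕ.≤-antisym (index-≤ h′ h) (index-≤ h h′)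

  index-reindex : ∀ {I P P′} {q : Form I} (f : P → P′) (g : P′ → P) → (∀ i → f (g i) ≡ i) →
                  (∀ i → g (f i) ≡ i) → HasIndex q P → HasIndex q P′
  index-reindex {q = q} f g fg gf h = record
    { section     = section h ∘ᴸ reindex f
    ; definite    = λ a a≯0 i → trans (reflexive (≡.cong a (≡.sym (fg i)))) (definite h (a ∘ f) a≯0 (g i))
    ; functionals = reindex g ∘ᴸ functionals h
    ; nonpositive = λ x fx≈0 → nonpositive h x
        (λ i → trans (reflexive (≡.cong (map (functionals h) x) (≡.sym (gf i)))) (fx≈0 (f i)))
    }

  -- One such map in each direction replaces an invertible change of variables: the map out of `q`
  -- carries the definite section, the map back pulls the functionals over. The factor `scale`
  -- leaves room for clearing denominators.
  record _≲_ {I J} (q : Form I) (r : Form J) : Set (c ⊔ ℓ₁ ⊔ ℓ₂) where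
    field
      φ       : I ⊸ J
      scale   : Carrier
      0<scale : 0# < scale
      similar : ∀ x → val r (map φ x) ≈ scale * val q x

  open _≲_

  index-≲ : ∀ {I J P} {q : Form I} {r : Form J} → q ≲ r → r ≲ q → HasIndex q P → HasIndex r P
  index-≲ q≲r r≲q h = record
    { section     = φ q≲r ∘ᴸ section h
    ; definite    = λ a a≯0 → definite h a
        (λ 0<qa → a≯0 (<-respʳ-≈ (sym (similar q≲r _)) (*-pos (0<scale q≲r) 0<qa)))
    ; functionals = functionals h ∘ᴸ φ r≲q
    ; nonpositive = λ x fx≈0 0<rx → nonpositive h (map (φ r≲q) x) fx≈0
        (<-respʳ-≈ (sym (similar r≲q x)) (*-pos (0<scale r≲q) 0<rx))
    }

  ≲-neg : ∀ {I J} {q : Form I} {r : Form J} → q ≲ r → -ᶠ q ≲ -ᶠ r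
  ≲-neg q≲r = record
    { φ = φ q≲r ; scale = scale q≲r ; 0<scale = 0<scale q≲r
    ; similar = λ x → trans (-‿cong (similar q≲r x)) (-‿distribʳ-* _ _) }

  ≲-pointwise : ∀ {I} {q r : Form I} → (∀ x → val r x ≈ val q x) → q ≲ r
  ≲-pointwise r≈q = record
    { φ = idᴸ ; scale = 1# ; 0<scale = 0<1 ; similar = λ x → trans (r≈q x) (sym (*-identityˡ _)) }

  index-⊕ : ∀ {I J P P′} {q : Form I} {r : Form J} → HasIndex q P → HasIndex r P′ → HasIndex (q ⊕ r) (P ⊎ P′)
  index-⊕ {q = q} {r} h h′ = record
    { section     = ⟨ section h ∘ᴸ π₁ , section h′ ∘ᴸ π₂ ⟩ᴸ
    ; definite    = λ where
        a a≯0 (inj₁ i) → definite h _ (λ 0<qa → a≯0 (+-pos-NonNeg 0<qa (section-NonNeg h′ _))) i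
        a a≯0 (inj₂ i) → definite h′ _ (λ 0<ra → a≯0 (+-NonNeg-pos (section-NonNeg h _) 0<ra)) i
    ; functionals = ⟨ functionals h ∘ᴸ π₁ , functionals h′ ∘ᴸ π₂ ⟩ᴸ
    ; nonpositive = λ x fx≈0 0<qx → NonNeg⇒≮0
        (+-NonNeg (≯0⇒NonNeg- (nonpositive h _ (fx≈0 ∘ inj₁))) (≯0⇒NonNeg- (nonpositive h′ _ (fx≈0 ∘ inj₂))))
        (<-respˡ-≈ (sym (-‿+-comm _ _)) (0<⇒-<0 0<qx))
    }

  index-copies : ∀ {I P} {q : Form I} k → HasIndex q P → HasIndex (copies k q) (Fin k × P)
  index-copies {q = q} k h = record
    { section     = copiesᴸ (section h)
    ; definite    = λ { a a≯0 (i , j) → definite h _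
        (λ 0<qa → a≯0 (sum-pos {k} (λ i → section-NonNeg h _) i 0<qa)) j }
    ; functionals = copiesᴸ (functionals h)
    ; nonpositive = λ x fx≈0 0<qx → NonNeg⇒≮0
        (sum-NonNeg {k} (λ i → ≯0⇒NonNeg- (nonpositive h (λ j → x (i , j)) (λ j → fx≈0 (i , j)))))
        (<-respˡ-≈ (sym (sum-neg {k} _)) (0<⇒-<0 0<qx))
    }

  HasInertia : ∀ {I} → Form I → ℕ → ℕ → Set _
  HasInertia q p r = HasIndex q (Fin p) × HasIndex (-ᶠ q) (Fin r)

  inertia-unique : ∀ {I} {q : Form I} {p p′ r r′} → HasInertia q p r → HasInertia q p′ r′ → p ≡ p′ × r ≡ r′
  inertia-unique (h , k) (h′ , k′) = index-unique h h′ , index-unique k k′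

  inertia-≲ : ∀ {I J} {q : Form I} {r : Form J} {m n} → q ≲ r → r ≲ q → HasInertia q m n → HasInertia r m n
  inertia-≲ q≲r r≲q (h , k) = index-≲ q≲r r≲q h , index-≲ (≲-neg q≲r) (≲-neg r≲q) k

  inertia-neg : ∀ {I} {q : Form I} {m n} → HasInertia q m n → HasInertia (-ᶠ q) n m
  inertia-neg (h , k) =
    k , index-≲ (≲-pointwise (λ x → -‿involutive _)) (≲-pointwise (λ x → sym (-‿involutive _))) h

  inertia-⊕ : ∀ {I J} {q : Form I} {r : Form J} {m n m′ n′} →
              HasInertia q m n → HasInertia r m′ n′ → HasInertia (q ⊕ r) (m ℕ.+ m′) (n ℕ.+ n′)
  inertia-⊕ {m = m} {n} {m′} {n′} (h , k) (h′ , k′) =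
      index-reindex (join m m′) (splitAt m) (join-splitAt m m′) (splitAt-join m m′) (index-⊕ h h′)
    , index-≲ (≲-pointwise (λ x → sym (-‿+-comm _ _))) (≲-pointwise (λ x → -‿+-comm _ _))
        (index-reindex (join n n′) (splitAt n) (join-splitAt n n′) (splitAt-join n n′) (index-⊕ k k′))

  inertia-copies : ∀ {I} {q : Form I} {m n} k → HasInertia q m n → HasInertia (copies k q) (k ℕ.* m) (k ℕ.* n)
  inertia-copies {m = m} {n} k (h , h′) =
      index-reindex (uncurry combine) (remQuot m) (combine-remQuot {k} m) (uncurry remQuot-combine) (index-copies k h)
    , index-≲ (≲-pointwise (λ x → sym (sum-neg {k} _))) (≲-pointwise (λ x → sum-neg {k} _))
        (index-reindex (uncurry combine) (remQuot n) (combine-remQuot {k} n) (uncurry remQuot-combine) (index-copies k h′))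

  inertia-definite : ∀ {n} {q : Form (Fin n)} → (∀ x i → ¬ (x i ≈ 0#) → 0# < val q x) → HasInertia q n 0
  inertia-definite {n} {q} q>0 = record
    { section     = idᴸ
    ; definite    = λ x x≯0 i → decidable-stable (x i ≟ 0#) (λ xi≉0 → x≯0 (q>0 x i xi≉0))
    ; functionals = idᴸ
    ; nonpositive = λ x x≈0 0<qx → >⇒≉ 0<qx (trans (val-cong q x≈0) (val-0 q))
    } , record
    { section     = 0ᴸ
    ; definite    = λ _ _ ()
    ; functionals = 0ᴸ
    ; nonpositive = λ x _ 0<-qx → q≮0 x (0<-⇒<0 0<-qx)
    }
    where
    q≮0 : ∀ x → ¬ (val q x < 0#)
    q≮0 x qx<0 with any? (λ i → ¬? (x i ≟ 0#))
    ... | yes (i , xi≉0) = <-asym (q>0 x i xi≉0) qx<0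
    ... | no  x≈0        = <⇒≉ qx<0 (trans
      (val-cong q (λ i → decidable-stable (x i ≟ 0#) (λ xi≉0 → x≈0 (i , xi≉0)))) (val-0 q))

  -- Polynomial functions and bounds

  IsPolynomial : (Carrier → Carrier) → Set _
  IsPolynomial f = ∃[ p ] ∀ x → evalPoly p x ≈ f x

  const-polynomial : ∀ a → IsPolynomial (λ _ → a)
  const-polynomial a = a ∷ [] , λ x → trans (+-congˡ (zeroʳ x)) (+-identityʳ a)

  x*-polynomial : ∀ {f} → IsPolynomial f → IsPolynomial (λ x → x * f x)
  x*-polynomial (p , p≈f) = 0# ∷ p , λ x → trans (+-identityˡ _) (*-congˡ (p≈f x))

  +-polynomial : ∀ {f g} → IsPolynomial f → IsPolynomial g → IsPolynomial (λ x → f x + g x)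
  +-polynomial (p , p≈f) (q , q≈g) = add p q , λ x → trans (eval-add p q x) (+-cong (p≈f x) (q≈g x))
    where
    add : List Carrier → List Carrier → List Carrier
    add []      q       = q
    add (a ∷ p) []      = a ∷ p
    add (a ∷ p) (b ∷ q) = a + b ∷ add p q
    eval-add : ∀ p q x → evalPoly (add p q) x ≈ evalPoly p x + evalPoly q x
    eval-add []      q       x = sym (+-identityˡ _)
    eval-add (a ∷ p) []      x = sym (+-identityʳ _)
    eval-add (a ∷ p) (b ∷ q) x = trans (+-congˡ (*-congˡ (eval-add p q x)))
      (solve 5 (λ a b x p q → a :+ b :+ x :* (p :+ q) := a :+ x :* p :+ (b :+ x :* q)) refl a b x _ _)

  scale-polynomial : ∀ a {f} → IsPolynomial f → IsPolynomial (λ x → a * f x)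
  scale-polynomial a (p , p≈f) = List.map (a *_) p , λ x → trans (eval-scale p x) (*-congˡ (p≈f x))
    where
    eval-scale : ∀ p x → evalPoly (List.map (a *_) p) x ≈ a * evalPoly p x
    eval-scale []      x = sym (zeroʳ a)
    eval-scale (b ∷ p) x = trans (+-congˡ (*-congˡ (eval-scale p x)))
      (solve 4 (λ a b x p → a :* b :+ x :* (a :* p) := a :* (b :+ x :* p)) refl a b x _)

  linear*-polynomial : ∀ a {f} → IsPolynomial f → IsPolynomial (λ x → (x - a) * f x)
  linear*-polynomial a {f} pf with +-polynomial (x*-polynomial pf) (scale-polynomial (- a) pf)
  ... | p , p≈ = p , λ x → trans (p≈ x)
    (solve 3 (λ x a f → x :* f :+ (:- a) :* f := (x :- a) :* f) refl x a (f x))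

  polynomial-cong : ∀ {f g} → (∀ x → f x ≈ g x) → IsPolynomial f → IsPolynomial g
  polynomial-cong f≈g (p , p≈f) = p , λ x → trans (p≈f x) (f≈g x)

  x<x+1 : ∀ x → x < x + 1#
  x<x+1 x = 0<-⇒< (<-respʳ-≈ (solve 1 (λ x → con (+ 1) := x :+ con (+ 1) :- x) refl x) 0<1)

  upperBound : ∀ {n} (f : Vector Carrier n) → ∃[ X ] ∀ i → f i < X
  upperBound {zero}  f = 0# , λ ()
  upperBound {suc n} f with upperBound (f ∘ suc)
  ... | X , f<X with compare (f zero) X
  ...   | tri< f₀<X _ _ = X , λ { zero → f₀<X ; (suc i) → f<X i }
  ...   | tri≈ _ f₀≈X _ = X + 1# , λ { zero → <-respˡ-≈ (sym f₀≈X) (x<x+1 X) ; (suc i) → <-trans (f<X i) (x<x+1 X) }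
  ...   | tri> _ _ X<f₀ = f zero + 1# , λ { zero → x<x+1 _ ; (suc i) → <-trans (f<X i) (<-trans X<f₀ (x<x+1 _)) }

  ≮-trans : ∀ {x y z} → ¬ (x < y) → ¬ (y < z) → ¬ (x < z)
  ≮-trans {x} {y} {z} x≮y y≮z x<z with compare x y
  ... | tri< x<y _ _ = x≮y x<y
  ... | tri≈ _ x≈y _ = y≮z (<-respˡ-≈ x≈y x<z)
  ... | tri> _ _ y<x = y≮z (<-trans y<x x<z)

  argmax : ∀ {n} (f : Vector Carrier (suc n)) → ∃[ i ] ∀ j → ¬ (f i < f j)
  argmax {zero}  f = zero , λ { zero → irrefl refl }
  argmax {suc n} f with argmax (f ∘ suc)
  ... | i , max with f zero <? f (suc i)
  ...   | yes f₀<fᵢ = suc i , λ { zero → <-asym f₀<fᵢ ; (suc j) → max j }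
  ...   | no  f₀≮fᵢ = zero , λ where
    zero    → irrefl refl
    (suc j) f₀<fⱼ → ≮-trans f₀≮fᵢ (max j) f₀<fⱼ

  -- The secular equation

  nodal : ∀ {d} → Vector Carrier d → Carrier → Carrier
  nodal {zero}  μ x = 1#
  nodal {suc d} μ x = (x - μ zero) * nodal (μ ∘ suc) x

  -- ∏ᵢ (x − μᵢ) · (s − Σᵢ δᵢ / (x − μᵢ)), cleared of denominators.
  secular : ∀ {d} → Vector Carrier d → Vector Carrier d → Carrier → Carrier → Carrier
  secular {zero}  μ δ s x = s
  secular {suc d} μ δ s x = (x - μ zero) * secular (μ ∘ suc) (δ ∘ suc) s x - δ zero * nodal (μ ∘ suc) x

  nodal-polynomial : ∀ {d} (μ : Vector Carrier d) → IsPolynomial (nodal μ)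
  nodal-polynomial {zero}  μ = const-polynomial 1#
  nodal-polynomial {suc d} μ = linear*-polynomial (μ zero) (nodal-polynomial (μ ∘ suc))

  secular-polynomial : ∀ {d} (μ δ : Vector Carrier d) {s} → IsPolynomial s → IsPolynomial (λ x → secular μ δ (s x) x)
  secular-polynomial {zero}  μ δ ps = ps
  secular-polynomial {suc d} μ δ ps = polynomial-cong (λ x → +-congˡ (sym (-‿distribˡ-* (δ zero) _)))
    (+-polynomial (linear*-polynomial (μ zero) (secular-polynomial (μ ∘ suc) (δ ∘ suc) ps))
                  (scale-polynomial (- δ zero) (nodal-polynomial (μ ∘ suc))))

  nodal-pos : ∀ {d} (μ : Vector Carrier d) {x} → (∀ i → μ i < x) → 0# < nodal μ x
  nodal-pos {zero}  μ μ<x = 0<1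
  nodal-pos {suc d} μ μ<x = *-pos (<⇒0<- (μ<x zero)) (nodal-pos (μ ∘ suc) (μ<x ∘ suc))

  nodal-root : ∀ {d} (μ : Vector Carrier d) i → nodal μ (μ i) ≈ 0#
  nodal-root μ zero    = trans (*-congʳ (-‿inverseʳ _)) (zeroˡ _)
  nodal-root μ (suc i) = trans (*-congˡ (nodal-root (μ ∘ suc) i)) (zeroʳ _)

  -- At `μ i` every term with the factor `x - μ i` vanishes. What remains is `- δ i` times the
  -- product of the differences `μ i - μ j` over the other `j`, all of which are positive.
  secular-neg : ∀ {d} (μ δ : Vector Carrier d) s i → (∀ j → j ≢ i → μ j < μ i) → 0# < δ i →
                secular μ δ s (μ i) < 0#
  secular-neg μ δ s zero μ<μᵢ 0<δᵢ = <-respˡ-≈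
    (solve 4 (λ x y z w → :- (z :* w) := (x :- x) :* y :- z :* w) refl (μ zero) _ (δ zero) _)
    (0<⇒-<0 (*-pos 0<δᵢ (nodal-pos (μ ∘ suc) (λ j → μ<μᵢ (suc j) λ ()))))
  secular-neg μ δ s (suc i) μ<μᵢ 0<δᵢ = <-respˡ-≈
    (begin
      - (a * - S)          ≈⟨ solve 3 (λ a s d → :- (a :* (:- s)) := a :* s :- d :* con (+ 0)) refl a S (δ zero) ⟩
      a * S - δ zero * 0#  ≈⟨ +-congˡ (-‿cong (*-congˡ (sym (nodal-root (μ ∘ suc) i)))) ⟩
      a * S - δ zero * nodal (μ ∘ suc) (μ (suc i)) ∎)
    (0<⇒-<0 (*-pos (<⇒0<- (μ<μᵢ zero λ ()))
      (<0⇒0<- (secular-neg (μ ∘ suc) (δ ∘ suc) s i (λ j j≢i → μ<μᵢ (suc j) (j≢i ∘ sucᶠ-injective)) 0<δᵢ))))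
    where
    a = μ (suc i) - μ zero
    S = secular (μ ∘ suc) (δ ∘ suc) s (μ (suc i))

  -- Each reciprocal of `x - μ i` is below 1, so Σ δᵢ / (x - μᵢ) is at most Σ δᵢ; the statement is
  -- this bound multiplied by `nodal μ x`.
  secular-≥ : ∀ {d} (μ δ : Vector Carrier d) s x → (∀ i → 0# < x - μ i - 1#) → (∀ i → NonNeg (δ i)) →
              NonNeg (secular μ δ s x - nodal μ x * (s - sum δ))
  secular-≥ {zero}  μ δ s x 1<x-μ 0≤δ = inj₂ (solve 1 (λ s → s :- con (+ 1) :* (s :- con (+ 0)) := con (+ 0)) refl s)
  secular-≥ {suc d} μ δ s x 1<x-μ 0≤δ = NonNeg-cong
    (solve 6 (λ a S N s D e → a :* (S :- N :* (s :- D)) :+ e :* (N :* (a :- con (+ 1)))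
                           := a :* S :- e :* N :- (a :* N) :* (s :- (e :+ D)))
           refl (x - μ zero) _ (nodal (μ ∘ suc) x) s (sum (δ ∘ suc)) (δ zero))
    (+-NonNeg (*-NonNeg (inj₁ (0<x-μ zero)) (secular-≥ (μ ∘ suc) (δ ∘ suc) s x (1<x-μ ∘ suc) (0≤δ ∘ suc)))
              (*-NonNeg (0≤δ zero) (*-NonNeg (inj₁ (nodal-pos (μ ∘ suc) (λ i → 0<-⇒< (0<x-μ (suc i)))))
                                             (inj₁ (1<x-μ zero)))))
    where
    0<x-μ : ∀ i → 0# < x - μ i
    0<x-μ i = <-respʳ-≈ (solve 1 (λ y → y :- con (+ 1) :+ con (+ 1) := y) refl _)
                        (+-pos-NonNeg (1<x-μ i) (inj₁ 0<1))

  -- Undoes the clearing of denominators once reciprocals `r` are given, so that a zero of the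
  -- polynomial solves the rational equation.
  secular-factor : ∀ {d} (μ δ : Vector Carrier d) s x (r : Vector Carrier d) → (∀ i → (x - μ i) * r i ≈ 1#) →
                   secular μ δ s x ≈ nodal μ x * (s - sum (λ i → δ i * r i))
  secular-factor {zero}  μ δ s x r r-inv = solve 1 (λ s → s := con (+ 1) :* (s :- con (+ 0))) refl s
  secular-factor {suc d} μ δ s x r r-inv = begin
    a * secular (μ ∘ suc) (δ ∘ suc) s x - e * N
      ≈⟨ +-cong (*-congˡ (secular-factor (μ ∘ suc) (δ ∘ suc) s x (r ∘ suc) (r-inv ∘ suc)))
                (-‿cong (trans (sym (*-identityʳ _)) (*-congˡ (sym (r-inv zero))))) ⟩
    a * (N * (s - D)) - e * N * (a * r zero)
      ≈⟨ solve 6 (λ a N s D e r → a :* (N :* (s :- D)) :- e :* N :* (a :* r) := a :* N :* (s :- (e :* r :+ D)))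
               refl a N s D e (r zero) ⟩
    a * N * (s - (e * r zero + D)) ∎
    where
    a = x - μ zero
    e = δ zero
    N = nodal (μ ∘ suc) x
    D = sum (λ i → δ (suc i) * r (suc i))

  secular-eventually-pos : ∀ {d} (γ κ : Carrier) (μ δ : Vector Carrier d) → 0# < γ → (∀ j → NonNeg (δ j)) →
                           ∃[ X ] (∀ j → μ j < X) × 0# < secular μ δ (γ * X - κ) X
  secular-eventually-pos {d} γ κ μ δ 0<γ 0≤δ with inverse γ (>⇒≉ 0<γ)
  -- The first entry makes `γ * X - κ` exceed `sum δ`; the others put `X` more than 1 beyond every
  -- `μ j`, as `secular-≥` demands.
  ... | γ⁻¹ , γγ⁻¹≈1 with upperBound (γ⁻¹ * (κ + sum δ) ∷ᵛ λ j → μ j + 1#)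
  ...   | X , b<X = X , μ<X , <-respʳ-≈ (solve 2 (λ a b → a :- b :+ b := a) refl _ _)
      (+-NonNeg-pos (secular-≥ μ δ _ X 1<X-μ 0≤δ) (*-pos (nodal-pos μ μ<X) 0<s))
    where
    1<X-μ : ∀ j → 0# < X - μ j - 1#
    1<X-μ j = <-respʳ-≈ (solve 2 (λ X m → X :- (m :+ con (+ 1)) := X :- m :- con (+ 1)) refl X (μ j))
                        (<⇒0<- (b<X (suc j)))

    μ<X : ∀ j → μ j < X
    μ<X j = <-trans (x<x+1 (μ j)) (b<X (suc j))

    0<s : 0# < γ * X - κ - sum δ
    0<s = <-respʳ-≈
      (begin
        γ * (X - γ⁻¹ * (κ + sum δ))
          ≈⟨ solve 4 (λ g X h e → g :* (X :- h :* e) := g :* X :- g :* h :* e) refl γ X γ⁻¹ _ ⟩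
        γ * X - γ * γ⁻¹ * (κ + sum δ)
          ≈⟨ +-congˡ (-‿cong (*-congʳ γγ⁻¹≈1)) ⟩
        γ * X - 1# * (κ + sum δ)
          ≈⟨ solve 3 (λ y k D → y :- con (+ 1) :* (k :+ D) := y :- k :- D) refl _ κ (sum δ) ⟩
        γ * X - κ - sum δ ∎)
      (*-pos 0<γ (<⇒0<- (b<X zero)))

  -- The cleared function is negative at the rightmost pole `μ i` and positive far to the right. A
  -- zero in between lies beyond all poles, where the denominators can be restored.
  secular-root : ∀ {d} (γ κ : Carrier) (μ δ : Vector Carrier d) i → 0# < γ → (∀ j → j ≢ i → μ j < μ i) →
                 (∀ j → NonNeg (δ j)) → 0# < δ i →
                 ∃[ x ] (∀ j → μ j < x) × (∀ (r : Vector Carrier d) → (∀ j → (x - μ j) * r j ≈ 1#) →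
                                           γ * x - κ ≈ sum (λ j → δ j * r j))
  secular-root {d} γ κ μ δ i 0<γ μ<μᵢ 0≤δ 0<δᵢ = from-polynomial
    (secular-polynomial μ δ (+-polynomial
      (polynomial-cong (λ x → *-congˡ (*-identityʳ x)) (scale-polynomial γ (x*-polynomial (const-polynomial 1#))))
      (const-polynomial (- κ))))
    (secular-eventually-pos γ κ μ δ 0<γ 0≤δ)
    where
    Root = ∃[ x ] (∀ j → μ j < x) × (∀ (r : Vector Carrier d) → (∀ j → (x - μ j) * r j ≈ 1#) →
                                     γ * x - κ ≈ sum (λ j → δ j * r j))

    from-zero : ∀ x → μ i < x → secular μ δ (γ * x - κ) x ≈ 0# → Root
    from-zero x μᵢ<x Sx≈0 = x , μ<x , λ r r-inv →
      x-y≈0⇒x≈y _ _ (≉0-cancelˡ (>⇒≉ (nodal-pos μ μ<x)) (trans (sym (secular-factor μ δ _ x r r-inv)) Sx≈0))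
      where
      μ<x : ∀ j → μ j < x
      μ<x j with j ≟ᶠ i
      ... | yes ≡.refl = μᵢ<x
      ... | no  j≢i    = <-trans (μ<μᵢ j j≢i) μᵢ<x

    from-polynomial : IsPolynomial (λ x → secular μ δ (γ * x - κ) x) →
                      (∃[ X ] (∀ j → μ j < X) × 0# < secular μ δ (γ * X - κ) X) → Root
    from-polynomial (p , p≈S) (X , μ<X , 0<SX)
      with intermediateValue p (μ<X i)
             (<-respˡ-≈ (sym (p≈S (μ i))) (secular-neg μ δ (γ * μ i - κ) i μ<μᵢ 0<δᵢ))
             (<-respʳ-≈ (sym (p≈S X)) 0<SX)
    ... | x , μᵢ<x , _ , px≈0 = from-zero x μᵢ<x (trans (sym (p≈S x)) px≈0)

  -- Symmetric bilinear forms

  record SymmetricBilinear (n : ℕ) : Set (c ⊔ ℓ₁) where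
    field
      β      : Vector Carrier n → Vector Carrier n → Carrier
      β-cong : ∀ {x x′ y y′} → x ≈ᵛ x′ → y ≈ᵛ y′ → β x y ≈ β x′ y′
      β-sym  : ∀ x y → β x y ≈ β y x
      β-+    : ∀ x x′ y → β (λ i → x i + x′ i) y ≈ β x y + β x′ y
      β-*    : ∀ a x y → β (λ i → a * x i) y ≈ a * β x y

    against : Vector Carrier n → (Fin n ⊸ ⊤)
    against y = record
      { map      = λ x _ → β x y
      ; map-cong = λ x≈x′ _ → β-cong x≈x′ (λ _ → refl)
      ; map-+    = λ x x′ _ → β-+ x x′ y
      ; map-*    = λ a x _ → β-* a x y
      }

    β-0 : ∀ {x} y → (∀ i → x i ≈ 0#) → β x y ≈ 0#
    β-0 y x≈0 = map-0 (against y) x≈0 tt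

    β-+ʳ : ∀ x y y′ → β x (λ i → y i + y′ i) ≈ β x y + β x y′
    β-+ʳ x y y′ = trans (β-sym x _) (trans (β-+ y y′ x) (+-cong (β-sym y x) (β-sym y′ x)))

    β-*ʳ : ∀ a x y → β x (λ i → a * y i) ≈ a * β x y
    β-*ʳ a x y = trans (β-sym x _) (trans (β-* a y x) (*-congˡ (β-sym y x)))

    β-linComb : ∀ {d} a (b : Fin d → Vector Carrier n) y → β (linComb a b) y ≈ sum (λ j → a j * β (b j) y)
    β-linComb {d} a b y = trans (map-sum (against y) (λ j i → a j * b j i) tt)
                                (sum-cong-≋ {d} (λ j → β-* (a j) (b j) y))

    β-linComb-single : ∀ {d} a (b : Fin d → Vector Carrier n) k → (∀ j → j ≢ k → β (b j) (b k) ≈ 0#) →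
                       β (linComb a b) (b k) ≈ a k * β (b k) (b k)
    β-linComb-single {d} a b k β≈0 = trans (β-linComb a b (b k))
      (sum-single {d} k (λ j j≢k → trans (*-congˡ (β≈0 j j≢k)) (zeroʳ (a j))))

    quadratic : Form (Fin n)
    quadratic = record { val = λ x → β x x ; val-cong = λ x≈y → β-cong x≈y x≈y ; val-0 = β-0 _ (λ _ → refl) }

  open SymmetricBilinear

  dotᴮ : ∀ n → SymmetricBilinear n
  dotᴮ n = record
    { β      = λ x y → sum (λ i → x i * y i)
    ; β-cong = λ x≈x′ y≈y′ → sum-cong-≋ {n} (λ i → *-cong (x≈x′ i) (y≈y′ i))
    ; β-sym  = λ x y → sum-cong-≋ {n} (λ i → *-comm (x i) (y i))
    ; β-+    = λ x x′ y → trans (sum-cong-≋ {n} (λ i → distribʳ (y i) (x i) (x′ i))) (∑-distrib-+ {n} _ _)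
    ; β-*    = λ a x y → trans (sum-cong-≋ {n} (λ i → *-assoc a (x i) (y i))) (sym (*-distribˡ-sum {n} a _))
    }

  dot : ∀ {n} → Vector Carrier n → Vector Carrier n → Carrier
  dot {n} = β (dotᴮ n)

  *ᵛ-adjoint : ∀ {n} (M : Matrix n) → (∀ i j → M i j ≈ M j i) → ∀ x y → dot x (M *ᵛ y) ≈ dot y (M *ᵛ x)
  *ᵛ-adjoint {n} M M-sym x y = begin
    sum (λ i → x i * sum (λ j → M i j * y j))       ≈⟨ sum-cong-≋ {n} (λ i → *-distribˡ-sum {n} (x i) _) ⟩
    sum (λ i → sum (λ j → x i * (M i j * y j)))     ≈⟨ ∑-comm {n} {n} _ ⟩
    sum (λ j → sum (λ i → x i * (M i j * y j)))     ≈⟨ sum-cong-≋ {n} (λ j → sum-cong-≋ {n} (λ i →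
        trans (*-congˡ (*-congʳ (M-sym i j)))
              (solve 3 (λ x m y → x :* (m :* y) := y :* (m :* x)) refl (x i) (M j i) (y j)))) ⟩
    sum (λ j → sum (λ i → y j * (M j i * x i)))     ≈⟨ sum-cong-≋ {n} (λ j → *-distribˡ-sum {n} (y j) _) ⟨
    sum (λ j → y j * sum (λ i → M j i * x i))       ∎

  matrixᴮ : ∀ {n} (M : Matrix n) → (∀ i j → M i j ≈ M j i) → SymmetricBilinear n
  matrixᴮ {n} M M-sym = record
    { β      = λ x y → dot x (M *ᵛ y)
    ; β-cong = λ x≈x′ y≈y′ → β-cong (dotᴮ n) x≈x′ (map-cong (matrixᴸ M) y≈y′)
    ; β-sym  = *ᵛ-adjoint M M-sym
    ; β-+    = λ x x′ y → β-+ (dotᴮ n) x x′ (M *ᵛ y)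
    ; β-*    = λ a x y → β-* (dotᴮ n) a x (M *ᵛ y)
    }

  dot-NonNeg : ∀ {n} (x : Vector Carrier n) → NonNeg (dot x x)
  dot-NonNeg {n} x = sum-NonNeg {n} (λ i → square-NonNeg (x i))

  dot-pos : ∀ {n} (x : Vector Carrier n) i → ¬ (x i ≈ 0#) → 0# < dot x x
  dot-pos {n} x i xi≉0 = sum-pos {n} (λ i → square-NonNeg (x i)) i (square-pos xi≉0)

  -- The usual way below to see that a constructed vector is nonzero: one nonvanishing product
  -- suffices.
  dot≉0⇒pos : ∀ {n} (x y : Vector Carrier n) → ¬ (dot x y ≈ 0#) → 0# < dot x x
  dot≉0⇒pos {n} x y xy≉0 with any? (λ i → ¬? (x i ≟ 0#))
  ... | yes (i , xi≉0) = dot-pos x i xi≉0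
  ... | no  x≈0        = contradiction
    (β-0 (dotᴮ n) y (λ i → decidable-stable (x i ≟ 0#) (λ xi≉0 → x≈0 (i , xi≉0)))) xy≉0

  -- Simultaneous diagonalisation

  -- Subspaces are given by finitely many constraints: y ⟂ cs puts y in the orthogonal complement of cs.

  infix 4 _⟂_

  _⟂_ : ∀ {n} → Vector Carrier n → List (Vector Carrier n) → Set _
  y ⟂ cs = All (λ z → dot z y ≈ 0#) cs

  module _ {n : ℕ} where

    ⟂-linComb : ∀ {cs : List (Vector Carrier n)} {d} a {b : Fin d → Vector Carrier n} →
                (∀ j → b j ⟂ cs) → linComb a b ⟂ cs
    ⟂-linComb {[]}     a b⟂cs = []
    ⟂-linComb {z ∷ cs} {d} a {b} b⟂cs =
      trans (β-sym (dotᴮ n) z _) (trans (β-linComb (dotᴮ n) a b z) (sum-0 {d} (λ j →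
        trans (*-congˡ (trans (β-sym (dotᴮ n) (b j) z) (All.head (b⟂cs j)))) (zeroʳ (a j)))))
      ∷ ⟂-linComb a (All.tail ∘ b⟂cs)

    ⟂-+ : ∀ {cs : List (Vector Carrier n)} {x y} → x ⟂ cs → y ⟂ cs → (λ i → x i + y i) ⟂ cs
    ⟂-+ []       []       = []
    ⟂-+ (p ∷ ps) (q ∷ qs) = trans (β-+ʳ (dotᴮ n) _ _ _) (trans (+-cong p q) (+-identityˡ 0#)) ∷ ⟂-+ ps qs

    -- The vectors are not normalised, which would take square roots; their squared norms are
    -- inverted where necessary.
    record Orthogonal (cs : List (Vector Carrier n)) {d : ℕ} (b : Fin d → Vector Carrier n) : Set (c ⊔ ℓ₁ ⊔ ℓ₂) where
      field
        norm-pos : ∀ i → 0# < dot (b i) (b i)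
        pairwise : ∀ i j → i ≢ j → dot (b i) (b j) ≈ 0#
        within   : ∀ i → b i ⟂ cs

    open Orthogonal public

    orthogonal-∷ : ∀ {cs e d} {b : Fin d → Vector Carrier n} → 0# < dot e e → e ⟂ cs →
                   Orthogonal (e ∷ cs) b → Orthogonal cs (e ∷ᵛ b)
    orthogonal-∷ {e = e} 0<ee e⟂cs o = record
      { norm-pos = λ { zero → 0<ee ; (suc i) → norm-pos o i }
      ; pairwise = λ where
          zero    zero    i≢j → contradiction ≡.refl i≢j
          zero    (suc j) i≢j → All.head (within o j)
          (suc i) zero    i≢j → trans (β-sym (dotᴮ n) _ e) (All.head (within o i))
          (suc i) (suc j) i≢j → pairwise o i j (i≢j ∘ ≡.cong suc)
      ; within   = λ { zero → e⟂cs ; (suc i) → All.tail (within o i) }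
      }

    orthogonal-tail : ∀ {cs d} {u : Fin (suc d) → Vector Carrier n} → Orthogonal cs u → Orthogonal (u zero ∷ cs) (u ∘ suc)
    orthogonal-tail o = record
      { norm-pos = norm-pos o ∘ suc
      ; pairwise = λ i j i≢j → pairwise o (suc i) (suc j) (i≢j ∘ sucᶠ-injective)
      ; within   = λ i → pairwise o zero (suc i) (λ ()) ∷ within o (suc i)
      }

    orthogonal-cons-constraint : ∀ {cs k d} {b : Fin d → Vector Carrier n} → (∀ i → dot k (b i) ≈ 0#) →
                                 Orthogonal cs b → Orthogonal (k ∷ cs) b
    orthogonal-cons-constraint k⟂b o = record
      { norm-pos = norm-pos o ; pairwise = pairwise o ; within = λ i → k⟂b i ∷ within o i }

    linComb-pos : ∀ {cs d a} {b : Fin d → Vector Carrier n} → Orthogonal cs b → ∀ j → ¬ (a j ≈ 0#) →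
                  0# < dot (linComb a b) (linComb a b)
    linComb-pos {a = a} {b} o j aj≉0 = dot≉0⇒pos (linComb a b) (b j)
      (λ ab≈0 → *-≉0 aj≉0 (>⇒≉ (norm-pos o j))
        (trans (sym (β-linComb-single (dotᴮ n) a b j (λ i → pairwise o i j))) ab≈0))

    -- In place of Gram-Schmidt, the vectors are found one at a time: a combination of the `d + 1`
    -- vectors `w` has to be orthogonal to `e` and to the vectors found so far, which is at most `d`
    -- conditions.
    orthogonal-complement : ∀ {cs d} {w : Fin (suc d) → Vector Carrier n} → Orthogonal cs w → ∀ e j → j ℕ.≤ d →
                            Σ[ f ∈ (Fin j → Vector Carrier n) ] Orthogonal (e ∷ cs) f
    orthogonal-complement o e zero    j≤d = (λ ()) , record
      { norm-pos = λ () ; pairwise = λ () ; within = λ () }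
    orthogonal-complement {cs} {d} {w} o e (suc j) j<d with orthogonal-complement o e j (ℕ.<⇒≤ j<d)
    ... | f , of with kernel (s≤s j<d) (λ i k → dot (w k) ((e ∷ᵛ f) i))
    ...   | a , (k , ak≉0) , Aa≈0 = linComb a w ∷ᵛ f , orthogonal-∷ (linComb-pos {a = a} o k ak≉0)
              (trans (β-sym (dotᴮ n) e _) (annihilated zero) ∷ ⟂-linComb a (within o))
              (record { norm-pos = norm-pos of ; pairwise = pairwise of
                      ; within = λ i → annihilated (suc i) ∷ within of i })
      where
      annihilated : ∀ i → dot (linComb a w) ((e ∷ᵛ f) i) ≈ 0#
      annihilated i = trans (β-linComb (dotᴮ n) a w ((e ∷ᵛ f) i))
        (trans (sum-cong-≋ {suc d} (λ k → *-comm (a k) (dot (w k) ((e ∷ᵛ f) i)))) (Aa≈0 i))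

    module _ (H : SymmetricBilinear n) (T : Vector Carrier n → Vector Carrier n)
             (h≈dotT : ∀ x y → β H x y ≈ dot (T x) y) where

      private
        h : Vector Carrier n → Vector Carrier n → Carrier
        h = β H

      Diagonal : ∀ {d} → (Fin d → Vector Carrier n) → Set _
      Diagonal b = ∀ i j → i ≢ j → h (b i) (b j) ≈ 0#

      -- he≈xe only tests against w: e is an eigenvector of the compression of H to the span of w.
      record CompressionEigenvector (cs : List (Vector Carrier n)) {d} (w : Fin d → Vector Carrier n) : Set (c ⊔ ℓ₁ ⊔ ℓ₂) where
        constructor eigen
        field
          e         : Vector Carrier n
          x         : Carrier
          0<ee      : 0# < dot e e
          e⟂cs      : e ⟂ cs
          he≈xe     : ∀ i → h e (w i) ≈ x * dot e (w i)

      -- Eigenvectors of a diagonal form bordered by one row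

      module _ {cs u d} {b : Fin d → Vector Carrier n} (0<uu : 0# < dot u u) (u⟂cs : u ⟂ cs)
               (ob : Orthogonal (u ∷ cs) b) (db : Diagonal b)
               (γ⁻¹ : Fin d → Carrier) (γγ⁻¹≈1 : ∀ i → dot (b i) (b i) * γ⁻¹ i ≈ 1#) where

        private
          μ : Fin d → Carrier
          μ i = h (b i) (b i) * γ⁻¹ i

          h≈μdot : ∀ i j → h (b i) (b j) ≈ μ i * dot (b i) (b j)
          h≈μdot i j with i ≟ᶠ j
          ... | no  i≢j    = trans (db i j i≢j) (sym (trans (*-congˡ (pairwise ob i j i≢j)) (zeroʳ _)))
          ... | yes ≡.refl = sym (trans (solve 3 (λ h g k → h :* k :* g := h :* (g :* k)) refl _ _ _)
                                        (trans (*-congˡ (γγ⁻¹≈1 i)) (*-identityʳ _)))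

          b⟂u : ∀ i → dot (b i) u ≈ 0#
          b⟂u i = trans (β-sym (dotᴮ n) (b i) u) (All.head (within ob i))

          b⟂cs : ∀ i → b i ⟂ cs
          b⟂cs i = All.tail (within ob i)

        -- The border entry `h (b i) u` is all that could keep `b i` from being an eigenvector.
        eigenvector-uncoupled : ∀ i → h (b i) u ≈ 0# → CompressionEigenvector cs (u ∷ᵛ b)
        eigenvector-uncoupled i hbu≈0 = eigen (b i) (μ i) (norm-pos ob i) (b⟂cs i) λ where
          zero    → trans hbu≈0 (sym (trans (*-congˡ (b⟂u i)) (zeroʳ (μ i))))
          (suc j) → h≈μdot i j

        -- All combinations of `b i` and `b j` share the value `μ i`; the one with crossed border
        -- entries as coefficients is uncoupled from `u`. It is nonzero because its component along
        -- `b j` has coefficient `- h (b i) u`.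
        eigenvector-multiple : ∀ i j → j ≢ i → μ j ≈ μ i → ¬ (h (b i) u ≈ 0#) → CompressionEigenvector cs (u ∷ᵛ b)
        eigenvector-multiple i j j≢i μj≈μi hbu≉0 = eigen e (μ i)
          (dot≉0⇒pos e (b j) (λ ebj≈0 → *-≉0 hbu≉0 (>⇒≉ (norm-pos ob j)) (begin
            s * dot (b j) (b j)
              ≈⟨ solve 3 (λ t s g → s :* g := :- (t :* con (+ 0) :+ (:- s) :* g)) refl t s (dot (b j) (b j)) ⟩
            - (t * 0# + - s * dot (b j) (b j))
              ≈⟨ -‿cong (+-congʳ (*-congˡ (pairwise ob i j (j≢i ∘ ≡.sym)))) ⟨
            - (t * dot (b i) (b j) + - s * dot (b j) (b j))
              ≈⟨ -‿cong (expand (dotᴮ n) (b j)) ⟨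
            - dot e (b j)
              ≈⟨ -‿cong ebj≈0 ⟩
            - 0#
              ≈⟨ -0≈0 ⟩
            0# ∎)))
          (⟂-+ (⟂-scale t (b⟂cs i)) (⟂-scale (- s) (b⟂cs j)))
          λ where
            zero → begin
              h e u                           ≈⟨ expand H u ⟩
              t * s + - s * t                 ≈⟨ solve 3 (λ t s m → t :* s :+ (:- s) :* t := m :* (t :* con (+ 0) :+ (:- s) :* con (+ 0))) refl t s (μ i) ⟩
              μ i * (t * 0# + - s * 0#)       ≈⟨ *-congˡ (+-cong (*-congˡ (b⟂u i)) (*-congˡ (b⟂u j))) ⟨
              μ i * (t * dot (b i) u + - s * dot (b j) u)  ≈⟨ *-congˡ (expand (dotᴮ n) u) ⟨
              μ i * dot e u                   ∎
            (suc k) → begin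
              h e (b k)
                ≈⟨ expand H (b k) ⟩
              t * h (b i) (b k) + - s * h (b j) (b k)
                ≈⟨ +-cong (*-congˡ (h≈μdot i k)) (*-congˡ (trans (h≈μdot j k) (*-congʳ μj≈μi))) ⟩
              t * (μ i * dot (b i) (b k)) + - s * (μ i * dot (b j) (b k))
                ≈⟨ solve 5 (λ t s m x y → t :* (m :* x) :+ (:- s) :* (m :* y) := m :* (t :* x :+ (:- s) :* y)) refl t s (μ i) _ _ ⟩
              μ i * (t * dot (b i) (b k) + - s * dot (b j) (b k))
                ≈⟨ *-congˡ (expand (dotᴮ n) (b k)) ⟨
              μ i * dot e (b k) ∎
          where
          s = h (b i) u
          t = h (b j) u
          e : Vector Carrier n
          e l = t * b i l + - s * b j l
          expand : ∀ (B : SymmetricBilinear n) y → β B e y ≈ t * β B (b i) y + - s * β B (b j) y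
          expand B y = trans (β-+ B _ _ y) (+-cong (β-* B t _ y) (β-* B (- s) _ y))
          ⟂-scale : ∀ {cs : List (Vector Carrier n)} a {y} → y ⟂ cs → (λ l → a * y l) ⟂ cs
          ⟂-scale a = All.map (λ zy≈0 → trans (β-*ʳ (dotᴮ n) a _ _) (trans (*-congˡ zy≈0) (zeroʳ a)))

        -- With the coefficient of `u` set to 1, the row of `b i` forces the coefficient `ξ i`, that
        -- is h(bᵢ, u) / (γᵢ (x - μᵢ)) with γᵢ the squared norm of bᵢ. The row of `u` then becomes
        -- the secular equation `balanced`.
        eigenvector-secular : ∀ x (r : Fin d → Carrier) → (∀ i → (x - μ i) * r i ≈ 1#) →
                              dot u u * x - h u u ≈ sum (λ i → h (b i) u * h (b i) u * γ⁻¹ i * r i) →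
                              CompressionEigenvector cs (u ∷ᵛ b)
        eigenvector-secular x r r-inv balanced = eigen e x
          (dot≉0⇒pos e u (λ eu≈0 → >⇒≉ 0<uu (trans (sym eu≈uu) eu≈0)))
          (⟂-+ u⟂cs (⟂-linComb ξ b⟂cs))
          λ where
            zero → begin
              h e u                                       ≈⟨ expand H u ⟩
              h u u + sum (λ i → ξ i * h (b i) u)         ≈⟨ +-congˡ (sum-cong-≋ {d} (λ i →
                solve 3 (λ t g r → t :* g :* r :* t := t :* t :* g :* r) refl (h (b i) u) (γ⁻¹ i) (r i))) ⟩
              h u u + sum (λ i → h (b i) u * h (b i) u * γ⁻¹ i * r i)  ≈⟨ +-congˡ balanced ⟨
              h u u + (dot u u * x - h u u)               ≈⟨ solve 3 (λ h g x → h :+ (g :* x :- h) := x :* g) refl (h u u) (dot u u) x ⟩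
              x * dot u u                                 ≈⟨ *-congˡ eu≈uu ⟨
              x * dot e u                                 ∎
            (suc k) → begin
              h e (b k)
                ≈⟨ expand′ H k (λ j → db j k) ⟩
              h u (b k) + ξ k * h (b k) (b k)
                ≈⟨ +-cong (trans (β-sym H u (b k)) (trans (sym (*-identityʳ _)) (sym (trans
                     (*-congˡ (*-cong (r-inv k) (γγ⁻¹≈1 k))) (*-congˡ (*-identityˡ 1#)))))) (*-congˡ (h≈μdot k k)) ⟩
              t k * ((x - μ k) * r k * (g k * γ⁻¹ k)) + t k * γ⁻¹ k * r k * (μ k * g k)
                ≈⟨ solve 6 (λ t x m r g k → t :* ((x :- m) :* r :* (g :* k)) :+ t :* k :* r :* (m :* g)
                                       := x :* (con (+ 0) :+ t :* k :* r :* g)) refl (t k) x (μ k) (r k) (g k) (γ⁻¹ k) ⟩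
              x * (0# + ξ k * g k)
                ≈⟨ *-congˡ (+-congʳ (All.head (within ob k))) ⟨
              x * (dot u (b k) + ξ k * g k)
                ≈⟨ *-congˡ (expand′ (dotᴮ n) k (λ j → pairwise ob j k)) ⟨
              x * dot e (b k) ∎
          where
          t g ξ : Fin d → Carrier
          t i = h (b i) u
          g i = dot (b i) (b i)
          ξ i = t i * γ⁻¹ i * r i
          e : Vector Carrier n
          e l = u l + linComb ξ b l
          expand : ∀ (B : SymmetricBilinear n) y → β B e y ≈ β B u y + sum (λ i → ξ i * β B (b i) y)
          expand B y = trans (β-+ B _ _ y) (+-congˡ (β-linComb B ξ b y))
          expand′ : ∀ (B : SymmetricBilinear n) k → (∀ j → j ≢ k → β B (b j) (b k) ≈ 0#) →
                    β B e (b k) ≈ β B u (b k) + ξ k * β B (b k) (b k)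
          expand′ B k β≈0 = trans (β-+ B _ _ (b k)) (+-congˡ (β-linComb-single B ξ b k β≈0))
          eu≈uu : dot e u ≈ dot u u
          eu≈uu = trans (expand (dotᴮ n) u) (trans
            (+-congˡ (sum-0 {d} (λ i → trans (*-congˡ (b⟂u i)) (zeroʳ (ξ i))))) (+-identityʳ _))

        eigenvector-separated : ∀ i → ¬ (h (b i) u ≈ 0#) → (∀ j → j ≢ i → μ j < μ i) → CompressionEigenvector cs (u ∷ᵛ b)
        eigenvector-separated i hbu≉0 μ<μᵢ = from-root
          (secular-root (dot u u) (h u u) μ (λ i → h (b i) u * h (b i) u * γ⁻¹ i) i 0<uu μ<μᵢ
            (λ j → *-NonNeg (square-NonNeg _) (inj₁ (inverse-pos (norm-pos ob j) (γγ⁻¹≈1 j))))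
            (*-pos (square-pos hbu≉0) (inverse-pos (norm-pos ob i) (γγ⁻¹≈1 i))))
          where
          from-root : (∃[ x ] (∀ j → μ j < x) × (∀ (r : Vector Carrier d) → (∀ j → (x - μ j) * r j ≈ 1#) →
                        dot u u * x - h u u ≈ sum (λ j → h (b j) u * h (b j) u * γ⁻¹ j * r j))) →
                      CompressionEigenvector cs (u ∷ᵛ b)
          from-root (x , μ<x , balanced) = eigenvector-secular x r r-inv (balanced r r-inv)
            where
            r : Vector Carrier d
            r j = proj₁ (inverse (x - μ j) (>⇒≉ (<⇒0<- (μ<x j))))
            r-inv : ∀ j → (x - μ j) * r j ≈ 1#
            r-inv j = proj₂ (inverse (x - μ j) (>⇒≉ (<⇒0<- (μ<x j))))

        -- At a largest diagonal value three cases remain: no coupling to `u`, a repeated value, or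
        -- a coupled strict maximum. Only in the last is the sign change of the secular polynomial
        -- at `μ i` assured.
        eigenvector-top : ∀ i → (∀ j → ¬ (μ i < μ j)) → CompressionEigenvector cs (u ∷ᵛ b)
        eigenvector-top i max with h (b i) u ≟ 0# | any? (λ j → ¬? (j ≟ᶠ i) ×-dec (μ j ≟ μ i))
        ... | yes hbu≈0 | _                      = eigenvector-uncoupled i hbu≈0
        ... | no  hbu≉0 | yes (j , j≢i , μj≈μi)  = eigenvector-multiple i j j≢i μj≈μi hbu≉0
        ... | no  hbu≉0 | no  simple             = eigenvector-separated i hbu≉0 below
          where
          below : ∀ j → j ≢ i → μ j < μ i
          below j j≢i with compare (μ j) (μ i)
          ... | tri< μj<μi _ _ = μj<μi
          ... | tri≈ _ μj≈μi _ = contradiction (j , j≢i , μj≈μi) simple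
          ... | tri> _ _ μi<μj = contradiction μi<μj (max j)

      eigenvector : ∀ {cs u d} {b : Fin d → Vector Carrier n} → 0# < dot u u → u ⟂ cs →
                    Orthogonal (u ∷ cs) b → Diagonal b → CompressionEigenvector cs (u ∷ᵛ b)
      -- In dimension one `u` itself serves, with its Rayleigh quotient as eigenvalue.
      eigenvector {u = u} {zero} {b} 0<uu u⟂cs ob db with inverse (dot u u) (>⇒≉ 0<uu)
      ... | γ⁻¹ , γγ⁻¹≈1 = eigen u (h u u * γ⁻¹) 0<uu u⟂cs λ where
        zero → sym (trans (solve 3 (λ h k g → h :* k :* g := h :* (g :* k)) refl _ _ _)
                          (trans (*-congˡ γγ⁻¹≈1) (*-identityʳ _)))
      eigenvector {d = suc d} {b} 0<uu u⟂cs ob db = eigenvector-top 0<uu u⟂cs ob db γ⁻¹ γγ⁻¹≈1 (proj₁ top) (proj₂ top)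
        where
        γ⁻¹ : Fin (suc d) → Carrier
        γ⁻¹ i = proj₁ (inverse (dot (b i) (b i)) (>⇒≉ (norm-pos ob i)))
        γγ⁻¹≈1 : ∀ i → dot (b i) (b i) * γ⁻¹ i ≈ 1#
        γγ⁻¹≈1 i = proj₂ (inverse (dot (b i) (b i)) (>⇒≉ (norm-pos ob i)))
        top = argmax (λ i → h (b i) (b i) * γ⁻¹ i)

      -- First on the complement of u₀, then, having bordered the result by u₀ to find an eigenvector e, on the complement
      -- of e. The extra constraint k = T e − x e makes the second basis H-orthogonal to e.
      diagonalise : ∀ {cs d} {u : Fin d → Vector Carrier n} → Orthogonal cs u →
                    Σ[ b ∈ (Fin d → Vector Carrier n) ] Orthogonal cs b × Diagonal b
      diagonalise {d = zero}  {u} ou = u , ou , λ ()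
      diagonalise {cs} {suc d} {u} ou with diagonalise (orthogonal-tail ou)
      ... | b , ob , db = from-eigenvector (eigenvector (norm-pos ou zero) (within ou zero) ob db)
        where
        ow : Orthogonal cs (u zero ∷ᵛ b)
        ow = orthogonal-∷ (norm-pos ou zero) (within ou zero) ob

        from-eigenvector : CompressionEigenvector cs (u zero ∷ᵛ b) →
                           Σ[ b ∈ (Fin (suc d) → Vector Carrier n) ] Orthogonal cs b × Diagonal b
        from-eigenvector (eigen e x 0<ee e⟂cs he≈xe) =
          -- That `e` is an eigenvector of the compression means exactly that `k` is orthogonal to
          -- `w`, so imposing `k` costs no dimension. It has to be imposed because the recursive
          -- call promises only the constraints, not that its vectors stay in the span of `w`.
          from-complement (orthogonal-complement (orthogonal-cons-constraint k⟂w ow) e d ℕ.≤-refl)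
          where
          k : Vector Carrier n
          k l = T e l + - x * e l

          expand : ∀ y → dot k y ≈ h e y + - x * dot e y
          expand y = trans (β-+ (dotᴮ n) _ _ y) (+-cong (sym (h≈dotT e y)) (β-* (dotᴮ n) (- x) e y))

          k⟂w : ∀ i → dot k ((u zero ∷ᵛ b) i) ≈ 0#
          k⟂w i = trans (expand _) (trans (+-congʳ (he≈xe i))
            (solve 2 (λ x y → x :* y :+ (:- x) :* y := con (+ 0)) refl x _))

          h≈0 : ∀ {y} → dot k y ≈ 0# → dot e y ≈ 0# → h e y ≈ 0#
          h≈0 {y} ky≈0 ey≈0 = begin
            h e y                                       ≈⟨ solve 3 (λ h x z → h := h :+ (:- x) :* z :+ x :* z) refl (h e y) x (dot e y) ⟩
            h e y + - x * dot e y + x * dot e y         ≈⟨ +-cong (trans (sym (expand y)) ky≈0) (trans (*-congˡ ey≈0) (zeroʳ x)) ⟩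
            0# + 0#                                     ≈⟨ +-identityˡ 0# ⟩
            0#                                          ∎

          from-complement : Σ[ f ∈ (Fin d → Vector Carrier n) ] Orthogonal (e ∷ k ∷ cs) f →
                            Σ[ b ∈ (Fin (suc d) → Vector Carrier n) ] Orthogonal cs b × Diagonal b
          from-complement (f , of) with diagonalise of
          ... | b′ , ob′ , db′ = e ∷ᵛ b′ , orthogonal-∷ 0<ee e⟂cs drop-k , diagonal
            where
            drop-k : Orthogonal (e ∷ cs) b′
            drop-k = record
              { norm-pos = norm-pos ob′ ; pairwise = pairwise ob′
              ; within   = λ i → All.head (within ob′ i) ∷ All.tail (All.tail (within ob′ i)) }
            he≈0 : ∀ j → h e (b′ j) ≈ 0#
            he≈0 j = h≈0 (All.head (All.tail (within ob′ j))) (All.head (within ob′ j))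
            diagonal : Diagonal (e ∷ᵛ b′)
            diagonal zero    zero    i≢j = contradiction ≡.refl i≢j
            diagonal zero    (suc j) i≢j = he≈0 j
            diagonal (suc i) zero    i≢j = trans (β-sym H _ e) (he≈0 i)
            diagonal (suc i) (suc j) i≢j = db′ i j (i≢j ∘ ≡.cong suc)

  -- Eigenbases

  -- If `x` were nonzero, it would extend `b` to `n + 1` orthogonal vectors, yet `n + 1` vectors in
  -- dimension `n` are linearly dependent.
  orthogonal-complete : ∀ {n} {b : Fin n → Vector Carrier n} → Orthogonal [] b →
                        ∀ x → (∀ i → dot x (b i) ≈ 0#) → ∀ l → x l ≈ 0#
  orthogonal-complete {n} {b} ob x x⟂b l = decidable-stable (x l ≟ 0#) λ xl≉0 → dependent (dot-pos x l xl≉0)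
    where
    dependent : ¬ (0# < dot x x)
    dependent 0<xx with kernel (ℕ.n<1+n n) (λ i k → (x ∷ᵛ b) k i)
    ... | a , (k , ak≉0) , Aa≈0 = >⇒≉
      (linComb-pos {a = a} (orthogonal-∷ 0<xx [] (orthogonal-cons-constraint x⟂b ob)) k ak≉0)
      (β-0 (dotᴮ n) _ (λ i → trans (sum-cong-≋ {suc n} (λ j → *-comm (a j) ((x ∷ᵛ b) j i))) (Aa≈0 i)))

  record Eigenbasis {n : ℕ} (M : Matrix n) : Set (c ⊔ ℓ₁ ⊔ ℓ₂) where
    field
      b          : Fin n → Vector Carrier n
      μ          : Fin n → Carrier
      orthogonal : Orthogonal [] b
      eigenspace : ∀ i → Eigenspace M (μ i) (b i)

  -- Starts from the unit vectors. In the resulting orthogonal basis, M bᵢ - μᵢ bᵢ with the Rayleigh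
  -- quotient μᵢ is orthogonal to every basis vector, hence zero.
  spectral-theorem : ∀ {n} (M : Matrix n) → (∀ i j → M i j ≈ M j i) → Eigenbasis M
  spectral-theorem {n} M M-sym = from-diagonal (diagonalise H (M *ᵛ_)
      (λ x y → trans (*ᵛ-adjoint M M-sym x y) (β-sym (dotᴮ n) y _)) standard)
    where
    H = matrixᴮ M M-sym

    standard : Orthogonal [] (scalar {n} 1#)
    standard = record
      { norm-pos = λ i → dot-pos (scalar 1# i) i (λ ≈0 → 1≉0 (trans (sym (scalar-≡ {i = i} ≡.refl)) ≈0))
      ; pairwise = λ i j i≢j → trans (scalar-*ᵛ′ i j) (scalar-≢ (i≢j ∘ ≡.sym))
      ; within   = λ i → []
      }
      where
      scalar-*ᵛ′ : ∀ i j → dot (scalar 1# i) (scalar 1# j) ≈ scalar 1# j i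
      scalar-*ᵛ′ i j = trans (scalar-*ᵛ 1# (scalar 1# j) i) (*-identityˡ _)

    from-diagonal : Σ[ b ∈ (Fin n → Vector Carrier n) ] Orthogonal [] b × (∀ i j → i ≢ j → β H (b i) (b j) ≈ 0#) →
                    Eigenbasis M
    from-diagonal (b , ob , db) = record
      { b = b ; μ = μ ; orthogonal = ob
      ; eigenspace = λ i l → x-y≈0⇒x≈y _ _ (orthogonal-complete ob (residual i) (residual⟂b i) l)
      }
      where
      μ : Fin n → Carrier
      μ i = β H (b i) (b i) * proj₁ (inverse (dot (b i) (b i)) (>⇒≉ (norm-pos ob i)))

      residual : ∀ i → Vector Carrier n
      residual i l = (M *ᵛ b i) l - μ i * b i l

      residual⟂b : ∀ i j → dot (residual i) (b j) ≈ 0#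
      residual⟂b i j = begin
        dot (residual i) (b j)
          ≈⟨ β-cong (dotᴮ n) {y = b j} (λ l → +-congˡ (-‿distribˡ-* (μ i) (b i l))) (λ _ → refl) ⟩
        dot (λ l → (M *ᵛ b i) l + - μ i * b i l) (b j)
          ≈⟨ trans (β-+ (dotᴮ n) _ _ (b j)) (+-cong (trans (β-sym (dotᴮ n) _ (b j)) (β-sym H (b j) (b i)))
                                                    (β-* (dotᴮ n) (- μ i) (b i) (b j))) ⟩
        β H (b i) (b j) + - μ i * dot (b i) (b j)
          ≈⟨ vanish (i ≟ᶠ j) ⟩
        0# ∎
        where
        vanish : Dec (i ≡ j) → β H (b i) (b j) + - μ i * dot (b i) (b j) ≈ 0#
        vanish (no i≢j) = trans (+-cong (db i j i≢j) (trans (*-congˡ (pairwise ob i j i≢j)) (zeroʳ _))) (+-identityˡ 0#)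
        vanish (yes ≡.refl) = trans
          (solve 3 (λ h k g → h :+ (:- (h :* k)) :* g := h :- h :* (g :* k)) refl (β H (b i) (b i)) _ _)
          (trans (+-congˡ (-‿cong (trans (*-congˡ (proj₂ (inverse (dot (b i) (b i)) (>⇒≉ (norm-pos ob i))))) (*-identityʳ _))))
                 (-‿inverseʳ _))

  -- Connects the filtered lengths in `IsSpectrum` and in the signature with families indexed by
  -- `Fin m`.
  record Enumeration {n} {p} (P : Pred (Fin n) p) (m : ℕ) : Set p where
    field
      ι           : Fin m → Fin n
      ι-injective : ∀ i j → ι i ≡ ι j → i ≡ j
      ι-within    : ∀ i → P (ι i)
      ι-covers    : ∀ {k} → P k → ∃[ i ] ι i ≡ k

  open Enumeration

  enumerate : ∀ {n p} {P : Pred (Fin n) p} (P? : Decidable P) → Enumeration P (length (filter P? (allFin n)))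
  enumerate {n} {P = P} P? = record
    { ι           = lookup (filter P? (allFin n))
    ; ι-injective = lookup-unique (Unique.filter⁺ P? (Unique.allFin⁺ n))
    ; ι-within    = λ i → All.lookup (all-filter P? (allFin n)) (∈-lookup i)
    ; ι-covers    = λ {k} Pk → Any.index (k∈ Pk) , ≡.sym (lookup-index (k∈ Pk))
    }
    where
    k∈ : ∀ {k} → P k → k ∈ filter P? (allFin n)
    k∈ {k} Pk = ∈-filter⁺ P? (∈-allFin k) Pk

  β-diagonal : ∀ {n d} (H : SymmetricBilinear n) a (b : Fin d → Vector Carrier n) →
               (∀ i j → i ≢ j → β H (b i) (b j) ≈ 0#) →
               β H (linComb a b) (linComb a b) ≈ sum (λ i → a i * (a i * β H (b i) (b i)))
  β-diagonal {d = d} H a b β≈0 = trans (β-linComb H a b _) (sum-cong-≋ {d} (λ i →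
    *-congˡ (trans (β-sym H (b i) _) (β-linComb-single H a b i (λ j → β≈0 j i)))))

  module _ {n : ℕ} {b : Fin n → Vector Carrier n} (ob : Orthogonal [] b) where

    private
      norm⁻¹ : ∀ i → ∃[ y ] dot (b i) (b i) * y ≈ 1#
      norm⁻¹ i = inverse (dot (b i) (b i)) (>⇒≉ (norm-pos ob i))

    coefficient : Vector Carrier n → Fin n → Carrier
    coefficient x i = dot x (b i) * proj₁ (norm⁻¹ i)

    coefficient-norm : ∀ x i → coefficient x i * dot (b i) (b i) ≈ dot x (b i)
    coefficient-norm x i = trans (solve 3 (λ w k g → w :* k :* g := w :* (g :* k)) refl _ _ _)
      (trans (*-congˡ (proj₂ (norm⁻¹ i))) (*-identityʳ _))

    -- The difference of the two sides is orthogonal to the selected basis vectors by the choice of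
    -- coefficients and to the others by hypothesis, hence zero by completeness.
    expand-selected : ∀ {p} {P : Pred (Fin n) p} (P? : Decidable P) {m} (E : Enumeration P m) x →
                      (∀ i → ¬ P i → dot x (b i) ≈ 0#) →
                      x ≈ᵛ linComb (coefficient x ∘ ι E) (b ∘ ι E)
    expand-selected {P = P} P? {m} E x x⟂ l = x-y≈0⇒x≈y _ _ (trans
      (solve 2 (λ x y → x :- y := x :+ (:- con (+ 1)) :* y) refl (x l) _)
      (orthogonal-complete ob (λ l → x l + - 1# * proj l) (λ i → residual i (P? i)) l))
      where
      proj : Vector Carrier n
      proj = linComb (coefficient x ∘ ι E) (b ∘ ι E)

      expand : ∀ i → dot (λ l → x l + - 1# * proj l) (b i) ≈ dot x (b i) + - 1# * dot proj (b i)
      expand i = trans (β-+ (dotᴮ n) _ _ (b i)) (+-congˡ (β-* (dotᴮ n) (- 1#) _ (b i)))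

      residual : ∀ i → Dec (P i) → dot (λ l → x l + - 1# * proj l) (b i) ≈ 0#
      residual i (yes Pi) with ι-covers E Pi
      ... | k , ≡.refl = trans (expand (ι E k)) (trans
        (+-congˡ (*-congˡ (trans
          (β-linComb-single (dotᴮ n) (coefficient x ∘ ι E) (b ∘ ι E) k
            (λ j j≢k → pairwise ob _ _ (λ eq → j≢k (ι-injective E _ _ eq))))
          (coefficient-norm x (ι E k)))))
        (solve 1 (λ x → x :+ (:- con (+ 1)) :* x := con (+ 0)) refl _))
      residual i (no ¬Pi) = trans (expand i) (trans
        (+-cong (x⟂ i ¬Pi) (*-congˡ (trans (β-linComb (dotᴮ n) (coefficient x ∘ ι E) (b ∘ ι E) (b i))
          (sum-0 {m} (λ k → trans (*-congˡ (pairwise ob (ι E k) i (λ eq → ¬Pi (≡.subst P eq (ι-within E k)))))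
                                  (zeroʳ (coefficient x (ι E k))))))))
        (solve 0 (con (+ 0) :+ (:- con (+ 1)) :* con (+ 0) := con (+ 0)) refl))

    expand-all : ∀ x → x ≈ᵛ linComb (coefficient x) b
    expand-all x = expand-selected {P = λ _ → ⊤} (λ _ → yes tt)
      (record { ι = id ; ι-injective = λ _ _ → id ; ι-within = λ _ → tt ; ι-covers = λ {k} _ → k , ≡.refl })
      x (λ i ¬⊤ → contradiction tt ¬⊤)

    -- The selected vectors span the definite space, and the inner products with them are the
    -- functionals. Where these vanish, only the diagonal terms outside `P` survive.
    index-diagonal : ∀ (H : SymmetricBilinear n) → (∀ i j → i ≢ j → β H (b i) (b j) ≈ 0#) →
                     ∀ {p} {P : Pred (Fin n) p} (P? : Decidable P) {m} → Enumeration P m →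
                     (∀ i → P i → 0# < β H (b i) (b i)) → (∀ i → ¬ P i → ¬ (0# < β H (b i) (b i))) →
                     HasIndex (quadratic H) (Fin m)
    index-diagonal H db {P = P} P? {m} E pos nonpos = record
      { section     = matrixᴸ (λ l k → b (ι E k) l)
      ; definite    = λ a a≯0 k → decidable-stable (a k ≟ 0#) (λ ak≉0 → a≯0 (<-respʳ-≈ (sym (value a))
          (sum-pos {m} (λ i → NonNeg-cong (*-assoc _ _ _) (*-NonNeg (square-NonNeg (a i)) (inj₁ (pos _ (ι-within E i)))))
            k (<-respʳ-≈ (*-assoc _ _ _) (*-pos (square-pos ak≉0) (pos _ (ι-within E k)))))))
      ; functionals = matrixᴸ (λ k → b (ι E k))
      ; nonpositive = λ x fx≈0 0<qx → NonNeg⇒≮0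
          (sum-NonNeg {n} (λ i → term x fx≈0 i (P? i)))
          (<-respˡ-≈ (trans (-‿cong (trans (β-cong H (expand-all x) (expand-all x)) (β-diagonal H (coefficient x) b db)))
                            (sym (sum-neg {n} _)))
                     (0<⇒-<0 0<qx))
      }
      where
      value : ∀ a → β H (λ l → sum (λ k → b (ι E k) l * a k)) (λ l → sum (λ k → b (ι E k) l * a k))
                  ≈ sum (λ k → a k * (a k * β H (b (ι E k)) (b (ι E k))))
      value a = trans (β-cong H commuted commuted) (β-diagonal H a (b ∘ ι E)
        (λ i j i≢j → db _ _ (λ eq → i≢j (ι-injective E _ _ eq))))
        where
        commuted : (λ l → sum (λ k → b (ι E k) l * a k)) ≈ᵛ linComb a (b ∘ ι E)
        commuted l = sum-cong-≋ {m} (λ k → *-comm _ _)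

      term : ∀ x → (∀ k → sum (λ l → b (ι E k) l * x l) ≈ 0#) → ∀ i → Dec (P i) →
             NonNeg (- (coefficient x i * (coefficient x i * β H (b i) (b i))))
      term x fx≈0 i (no ¬Pi) = NonNeg-cong
        (solve 2 (λ c h → c :* c :* (:- h) := :- (c :* (c :* h))) refl (coefficient x i) _)
        (*-NonNeg (square-NonNeg _) (≯0⇒NonNeg- (nonpos i ¬Pi)))
      term x fx≈0 i (yes Pi) with ι-covers E Pi
      ... | k , ≡.refl = inj₂ (trans (-‿cong (trans (*-congʳ (trans (*-congʳ
          (trans (β-sym (dotᴮ n) x _) (fx≈0 k))) (zeroˡ _))) (zeroˡ _))) -0≈0)

  -ᴮ_ : ∀ {n} → SymmetricBilinear n → SymmetricBilinear n
  -ᴮ H = record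
    { β      = λ x y → - β H x y
    ; β-cong = λ x≈x′ y≈y′ → -‿cong (β-cong H x≈x′ y≈y′)
    ; β-sym  = λ x y → -‿cong (β-sym H x y)
    ; β-+    = λ x x′ y → trans (-‿cong (β-+ H x x′ y)) (sym (-‿+-comm _ _))
    ; β-*    = λ a x y → trans (-‿cong (β-* H a x y)) (-‿distribʳ-* a _)
    }

  module _ {n : ℕ} {M : Matrix n} (M-sym : ∀ i j → M i j ≈ M j i) (B : Eigenbasis M) where

    open Eigenbasis B

    eigenvalues : List Carrier
    eigenvalues = List.map μ (allFin n)

    private
      H = matrixᴮ M M-sym

      H-eigen : ∀ x i → β H x (b i) ≈ μ i * dot x (b i)
      H-eigen x i = trans (β-cong (dotᴮ n) {x = x} (λ _ → refl) (eigenspace i)) (β-*ʳ (dotᴮ n) (μ i) x (b i))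

      H-diagonal : ∀ i j → i ≢ j → β H (b i) (b j) ≈ 0#
      H-diagonal i j i≢j = trans (H-eigen (b i) j) (trans (*-congˡ (pairwise orthogonal i j i≢j)) (zeroʳ _))

      numbered : ∀ {p} {P : Pred Carrier p} (P? : Decidable P) → Enumeration (P ∘ μ) (length (filter P? eigenvalues))
      numbered P? = ≡.subst (Enumeration _) (≡.sym (length-filter-map P? μ (allFin n))) (enumerate (P? ∘ μ))

    -- The basis vectors with eigenvalue `x` span its eigenspace: for `w` in it, symmetry gives (x -
    -- μᵢ)⟨w, bᵢ⟩ = 0, so `w` is orthogonal to all the others.
    eigenbasis-spectrum : IsSpectrum M eigenvalues
    eigenbasis-spectrum x = b ∘ ι E
      , (λ j l → trans (eigenspace (ι E j) l) (*-congʳ (sym (ι-within E j))))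
      , (λ a ab≈0 j → decidable-stable (a j ≟ 0#) (λ aj≉0 → >⇒≉ (linComb-pos {a = a} (selected E) j aj≉0)
          (β-0 (dotᴮ n) _ ab≈0)))
      , (λ w w∈ → coefficient orthogonal w ∘ ι E ,
          expand-selected orthogonal (λ i → x ≟ μ i) E w (other w w∈))
      where
      E = numbered (x ≟_)
      selected : ∀ {m} (E : Enumeration (λ i → x ≈ μ i) m) → Orthogonal [] (b ∘ ι E)
      selected E = record
        { norm-pos = λ i → norm-pos orthogonal (ι E i)
        ; pairwise = λ i j i≢j → pairwise orthogonal _ _ (λ eq → i≢j (ι-injective E i j eq))
        ; within   = λ i → []
        }
      other : ∀ w → Eigenspace M x w → ∀ i → ¬ (x ≈ μ i) → dot w (b i) ≈ 0#
      other w w∈ i x≉μ = ≉0-cancelˡ (λ x-μ≈0 → x≉μ (x-y≈0⇒x≈y _ _ x-μ≈0)) (begin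
        (x - μ i) * dot w (b i)              ≈⟨ solve 3 (λ x m d → (x :- m) :* d := x :* d :- m :* d) refl x (μ i) _ ⟩
        x * dot w (b i) - μ i * dot w (b i)  ≈⟨ x≈y⇒x-y≈0 (begin
          x * dot w (b i)                      ≈⟨ *-congˡ (β-sym (dotᴮ n) w (b i)) ⟩
          x * dot (b i) w                      ≈⟨ β-*ʳ (dotᴮ n) x (b i) w ⟨
          dot (b i) (λ l → x * w l)            ≈⟨ β-cong (dotᴮ n) {x = b i} (λ _ → refl) w∈ ⟨
          β H (b i) w                          ≈⟨ β-sym H (b i) w ⟩
          β H w (b i)                          ≈⟨ H-eigen w i ⟩
          μ i * dot w (b i)                    ∎) ⟩
        0#                                   ∎)

    eigenbasis-inertia : HasInertia (quadratic (matrixᴮ M M-sym))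
                           (length (filter (0# <?_) eigenvalues)) (length (filter (_<? 0#) eigenvalues))
    eigenbasis-inertia =
        index-diagonal orthogonal H H-diagonal (λ i → 0# <? μ i) (numbered (0# <?_))
          (λ i 0<μ → <-respʳ-≈ (sym (H-eigen (b i) i)) (*-pos 0<μ (norm-pos orthogonal i)))
          (λ i 0≮μ 0<h → 0≮μ (pos-cancelˡ (norm-pos orthogonal i)
            (<-respʳ-≈ (trans (H-eigen (b i) i) (*-comm _ _)) 0<h)))
      -- `-ᶠ quadratic H` and `quadratic (-ᴮ H)` have the same values but differ in their proof
      -- fields.
      , index-≲ (≲-pointwise (λ _ → refl)) (≲-pointwise (λ _ → refl))
          (index-diagonal orthogonal (-ᴮ H) (λ i j i≢j → trans (-‿cong (H-diagonal i j i≢j)) -0≈0)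
            (λ i → μ i <? 0#) (numbered (_<? 0#))
            (λ i μ<0 → <-respʳ-≈ (trans (sym (-‿distribˡ-* _ _)) (-‿cong (sym (H-eigen (b i) i))))
                                 (*-pos (<0⇒0<- μ<0) (norm-pos orthogonal i)))
            (λ i μ≮0 0<h → μ≮0 (0<-⇒<0 (pos-cancelˡ (norm-pos orthogonal i)
              (<-respʳ-≈ (trans (-‿cong (trans (H-eigen (b i) i) (*-comm _ _))) (-‿distribʳ-* _ _)) 0<h)))))

  -- Uniqueness of dimension

  dimension-≤ : ∀ {n} {S : Vector Carrier n → Set ℓ₁} {d d′} → HasDimension S d → HasDimension S d′ → d′ ℕ.≤ d
  dimension-≤ {d = d} {d′} (b , _ , _ , spans) (b′ , b′∈S , independent , _) with d′ ℕ.≤? d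
  ... | yes d′≤d = d′≤d
  ... | no  d′≰d = contradiction (kernel (ℕ.≰⇒> d′≰d) (λ i j → A j i)) dependent
    where
    A : Fin d′ → Fin d → Carrier
    A j = proj₁ (spans (b′ j) (b′∈S j))

    dependent : ¬ (Σ[ a ∈ Vector Carrier d′ ] (∃[ j ] ¬ (a j ≈ 0#)) × (∀ i → sum (λ j → A j i * a j) ≈ 0#))
    dependent (a , (j , aj≉0) , Aa≈0) = aj≉0 (independent a (λ l → begin
      sum (λ j → a j * b′ j l)
        ≈⟨ sum-cong-≋ {d′} (λ j → trans (*-congˡ (proj₂ (spans (b′ j) (b′∈S j)) l)) (*-distribˡ-sum {d} (a j) _)) ⟩
      sum (λ j → sum (λ i → a j * (A j i * b i l)))
        ≈⟨ ∑-comm {d′} {d} _ ⟩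
      sum (λ i → sum (λ j → a j * (A j i * b i l)))
        ≈⟨ sum-cong-≋ {d} (λ i → trans
             (sum-cong-≋ {d′} (λ j → solve 3 (λ a m b → a :* (m :* b) := (m :* a) :* b) refl (a j) (A j i) (b i l)))
             (sym (*-distribʳ-sum {d′} (b i l) _))) ⟩
      sum (λ i → sum (λ j → A j i * a j) * b i l)
        ≈⟨ sum-0 {d} (λ i → trans (*-congʳ (Aa≈0 i)) (zeroˡ (b i l))) ⟩
      0# ∎) j)

  dimension-unique : ∀ {n} {S : Vector Carrier n → Set ℓ₁} {d d′} → HasDimension S d → HasDimension S d′ → d ≡ d′
  dimension-unique h h′ = ℕ.≤-antisym (dimension-≤ h′ h) (dimension-≤ h h′)

  -- Multiplicities

  count : ∀ {p} {P : Pred Carrier p} → Decidable P → List Carrier → ℕ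
  count P? xs = length (filter P? xs)

  module _ {p} {P : Pred Carrier p} (P? : Decidable P) where

    count-mid : ∀ y ys zs → count P? (ys ++ y ∷ zs) ≡ count P? (y ∷ ys ++ zs)
    count-mid y ys zs = ↭-length (filter-↭ P? (shift y ys zs))

    module _ (P-resp : ∀ {x y} → x ≈ y → P x → P y) where

      count-∷-cong : ∀ {x y xs ys} → x ≈ y → count P? xs ≡ count P? ys → count P? (x ∷ xs) ≡ count P? (y ∷ ys)
      count-∷-cong {x} {y} x≈y eq with P? x | P? y
      ... | yes _  | yes _  = ≡.cong suc eq
      ... | yes Px | no ¬Py = contradiction (P-resp x≈y Px) ¬Py
      ... | no ¬Px | yes Py = contradiction (P-resp (sym x≈y) Py) ¬Px
      ... | no _   | no _   = eq

      count-∷-cancel : ∀ {x y xs ys} → x ≈ y → count P? (x ∷ xs) ≡ count P? (y ∷ ys) → count P? xs ≡ count P? ys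
      count-∷-cancel {x} {y} x≈y eq with P? x | P? y
      ... | yes _  | yes _  = ℕ.suc-injective eq
      ... | yes Px | no ¬Py = contradiction (P-resp x≈y Px) ¬Py
      ... | no ¬Px | yes Py = contradiction (P-resp (sym x≈y) Py) ¬Px
      ... | no _   | no _   = eq

  SameCounts : List Carrier → List Carrier → Set c
  SameCounts xs ys = ∀ x → count (x ≟_) xs ≡ count (x ≟_) ys

  count-self-≢0 : ∀ x xs → count (x ≟_) (x ∷ xs) ≢ 0
  count-self-≢0 x xs eq with x ≟ x
  ... | yes _  = ℕ.1+n≢0 eq
  ... | no x≉x = x≉x refl

  locate : ∀ x ys → count (x ≟_) ys ≢ 0 → ∃[ y ] ∃₂ λ ys₁ ys₂ → x ≈ y × ys ≡ ys₁ ++ y ∷ ys₂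
  locate x []       ≢0 = contradiction ≡.refl ≢0
  locate x (y ∷ ys) ≢0 with x ≟ y
  ... | yes x≈y = y , [] , ys , x≈y , ≡.refl
  ... | no  _   with locate x ys ≢0
  ...   | z , ys₁ , ys₂ , x≈z , eq = z , y ∷ ys₁ , ys₂ , x≈z , ≡.cong (y ∷_) eq

  -- Multiplicities fix a list only up to order and `≈`, so an entry equal to the head is located in
  -- the other list and both are removed. This makes the signature independent of the list chosen.
  count-unique : ∀ {p} {P : Pred Carrier p} (P? : Decidable P) → (∀ {x y} → x ≈ y → P x → P y) →
                 ∀ xs ys → SameCounts xs ys → count P? xs ≡ count P? ys
  count-unique P? P-resp [] [] same = ≡.refl
  count-unique P? P-resp [] (y ∷ ys) same = contradiction (≡.sym (same y)) (count-self-≢0 y ys)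
  count-unique P? P-resp (x ∷ xs) ys same
    with locate x ys (λ eq → count-self-≢0 x xs (≡.trans (same x) eq))
  ... | y , ys₁ , ys₂ , x≈y , ≡.refl = ≡.trans
    (count-∷-cong P? P-resp x≈y (count-unique P? P-resp xs (ys₁ ++ ys₂) (λ z →
      count-∷-cancel (z ≟_) (λ x≈y z≈x → trans z≈x x≈y) x≈y (≡.trans (same z) (count-mid (z ≟_) y ys₁ ys₂)))))
    (≡.sym (count-mid P? y ys₁ ys₂))

  -- A given spectrum and the eigenvalues found by the spectral theorem have equal multiplicities,
  -- both being dimensions of the same eigenspaces; the inertia is known for the latter.
  spectrum-inertia : ∀ {n} {M : Matrix n} (M-sym : ∀ i j → M i j ≈ M j i) xs → IsSpectrum M xs →
                     HasInertia (quadratic (matrixᴮ M M-sym)) (count (0# <?_) xs) (count (_<? 0#) xs)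
  spectrum-inertia {M = M} M-sym xs spec = ≡.subst₂ (HasInertia _)
    (count-unique (0# <?_) (λ x≈y → <-respʳ-≈ x≈y) (eigenvalues M-sym E) xs same)
    (count-unique (_<? 0#) (λ x≈y → <-respˡ-≈ x≈y) (eigenvalues M-sym E) xs same)
    (eigenbasis-inertia M-sym E)
    where
    E = spectral-theorem M M-sym
    same : SameCounts (eigenvalues M-sym E) xs
    same x = dimension-unique (eigenbasis-spectrum M-sym E x) (spec x)

  -- Supplies an inertia for the forms of Q(B) - 2I and Q(B_k) - 2I, for which no spectrum is at
  -- hand. `M` is the Gram matrix of the unit vectors.
  bilinear-inertia : ∀ {n} (H : SymmetricBilinear n) → ∃₂ λ p r → HasInertia (quadratic H) p r
  bilinear-inertia {n} H = _ , _ , inertia-≲ (≲-pointwise value) (≲-pointwise (λ x → sym (value x)))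
                                     (eigenbasis-inertia M-sym (spectral-theorem M M-sym))
    where
    M : Matrix n
    M i j = β H (scalar 1# i) (scalar 1# j)
    M-sym : ∀ i j → M i j ≈ M j i
    M-sym i j = β-sym H _ _

    expand : ∀ x → x ≈ᵛ linComb x (scalar 1#)
    expand x l = trans (sym (trans (scalar-*ᵛ 1# x l) (*-identityˡ _)))
      (sum-cong-≋ {n} (λ j → trans (*-comm _ _) (*-congˡ (scalar-sym l j))))

    value : ∀ x → β H x x ≈ dot x (M *ᵛ x)
    value x = trans (β-cong H {y = x} (expand x) (λ _ → refl)) (trans (β-linComb H x (scalar 1#) x)
      (sum-cong-≋ {n} (λ i → *-congˡ (trans (β-sym H (scalar 1# i) x)
        (trans (β-cong H {y = scalar 1# i} (expand x) (λ _ → refl)) (trans (β-linComb H x (scalar 1#) (scalar 1# i))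
          (sum-cong-≋ {n} (λ j → trans (*-comm _ _) (*-congʳ (M-sym j i))))))))))

  -- Gram forms and Schur complements

  β-- : ∀ {n} (H : SymmetricBilinear n) x x′ y → β H (λ i → x i - x′ i) y ≈ β H x y - β H x′ y
  β-- H x x′ y = trans (β-cong H {y = y} (λ i → +-congˡ (-‿cong (sym (*-identityˡ _)))) (λ _ → refl))
    (trans (β-cong H {y = y} (λ i → +-congˡ (-‿distribˡ-* 1# (x′ i))) (λ _ → refl))
    (trans (β-+ H x _ y) (+-congˡ (trans (β-* H (- 1#) x′ y) (solve 1 (λ x → (:- con (+ 1)) :* x := :- x) refl _)))))

  β-square-+ : ∀ {n} (H : SymmetricBilinear n) x y →
               β H (λ i → x i + y i) (λ i → x i + y i) ≈ β H x x + 2# * β H x y + β H y y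
  β-square-+ H x y = trans (β-+ H x y _) (trans (+-cong (β-+ʳ H x x y) (β-+ʳ H y x y))
    (trans (+-congˡ (+-congʳ (β-sym H y x)))
      (solve 3 (λ a b c → (a :+ b) :+ (b :+ c) := a :+ con (+ 2) :* b :+ c) refl _ _ _)))

  β-square-- : ∀ {n} (H : SymmetricBilinear n) x y →
               β H (λ i → x i - y i) (λ i → x i - y i) ≈ β H x x - 2# * β H x y + β H y y
  β-square-- H x y = trans (β-- H x y _) (trans (+-cong (trans (β-sym H x _) (β-- H x y x)) (-‿cong (trans (β-sym H y _) (β-- H x y y))))
    (trans (+-congʳ (+-congˡ (-‿cong (β-sym H y x))))
      (solve 3 (λ a b c → (a :- b) :- (b :- c) := a :- con (+ 2) :* b :+ c) refl _ _ _)))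

  0<2 : 0# < 2#
  0<2 = +-pos-NonNeg 0<1 (inj₁ 0<1)

  norm : ∀ n → Form (Fin n)
  norm n = quadratic (dotᴮ n)

  norm-inertia : ∀ n → HasInertia (norm n) n 0
  norm-inertia n = inertia-definite (λ x i → dot-pos x i)

  -- The form of A(L(G)) for T = N, and of Q(G) − 2I for T = Nᵀ.
  gram : ∀ {m n} → (Fin n ⊸ Fin m) → SymmetricBilinear n
  gram {m} {n} T = record
    { β      = λ x y → dot (map T x) (map T y) - 2# * dot x y
    ; β-cong = λ x≈x′ y≈y′ → +-cong (β-cong (dotᴮ m) (map-cong T x≈x′) (map-cong T y≈y′))
                                    (-‿cong (*-congˡ (β-cong (dotᴮ n) x≈x′ y≈y′)))
    ; β-sym  = λ x y → +-cong (β-sym (dotᴮ m) _ _) (-‿cong (*-congˡ (β-sym (dotᴮ n) x y)))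
    ; β-+    = λ x x′ y → trans
        (+-cong (trans (β-cong (dotᴮ m) {y = map T y} (map-+ T x x′) (λ _ → refl)) (β-+ (dotᴮ m) _ _ _))
                (-‿cong (*-congˡ (β-+ (dotᴮ n) x x′ y))))
        (solve 5 (λ a b t c d → (a :+ b) :- t :* (c :+ d) := (a :- t :* c) :+ (b :- t :* d)) refl _ _ 2# _ _)
    ; β-*    = λ a x y → trans
        (+-cong (trans (β-cong (dotᴮ m) {y = map T y} (map-* T a x) (λ _ → refl)) (β-* (dotᴮ m) a _ _))
                (-‿cong (*-congˡ (β-* (dotᴮ n) a x y))))
        (solve 4 (λ a p t q → a :* p :- t :* (a :* q) := a :* (p :- t :* q)) refl a _ 2# _)
    }

  -- The two Schur complements of the symmetric block form
  -- |w|² + 2 ⟨T x , w⟩ + 2 |x|².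
  schur : ∀ {m n} (T : Fin n ⊸ Fin m) (S : Fin m ⊸ Fin n) → (∀ x w → dot (map T x) w ≈ dot x (map S w)) →
          norm n ⊕ -ᶠ quadratic (gram S) ≲ norm m ⊕ -ᶠ quadratic (gram T)
  schur {m} {n} T S adjoint = record
    -- Completing the square in x and in w gives the new variables y = 2x + S w and z = w + T x. The
    -- map is (y , w) ↦ (2z , 2x): doubling removes the half from x = (y - S w)/2 and turns the
    -- factor 1/2 between the two complements into 2.
    { φ       = ⟨ 2# • π₂ +ᴸ T ∘ᴸ (π₁ -ᴸ S ∘ᴸ π₂) , π₁ -ᴸ S ∘ᴸ π₂ ⟩ᴸ
    ; scale   = 2#
    ; 0<scale = 0<2
    ; similar = λ yw → completed-squares (yw ∘ inj₁) (yw ∘ inj₂)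
    }
    where
    completed-squares : ∀ y w → let s = map S w ; x = λ l → y l - s l ; t = map T x in
              dot (λ e → 2# * w e + t e) (λ e → 2# * w e + t e) - (dot t t - 2# * dot x x)
              ≈ 2# * (dot y y - (dot s s - 2# * dot w w))
    completed-squares y w = begin
      dot (λ e → 2# * w e + t e) (λ e → 2# * w e + t e) - (dot t t - 2# * dot x x)
        ≈⟨ +-cong (trans (β-square-+ (dotᴮ m) _ t) (+-congʳ (+-cong
             (trans (β-* (dotᴮ m) 2# w _) (*-congˡ (β-*ʳ (dotᴮ m) 2# w w)))
             (*-congˡ (trans (β-* (dotᴮ m) 2# w t) (*-congˡ wt≈))))))
           (-‿cong (+-congˡ (-‿cong (*-congˡ (β-square-- (dotᴮ n) y s))))) ⟩
      2# * (2# * ww) + 2# * (2# * (ys - ss)) + dot t t - (dot t t - 2# * (yy - 2# * ys + ss))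
        ≈⟨ solve 5 (λ ww ys ss tt yy →
             con (+ 2) :* (con (+ 2) :* ww) :+ con (+ 2) :* (con (+ 2) :* (ys :- ss)) :+ tt
               :- (tt :- con (+ 2) :* (yy :- con (+ 2) :* ys :+ ss))
             := con (+ 2) :* (yy :- (ss :- con (+ 2) :* ww))) refl ww ys ss (dot t t) yy ⟩
      2# * (yy - (ss - 2# * ww)) ∎
      where
      s = map S w
      x : Vector Carrier n
      x l = y l - s l
      t = map T x
      ww = dot w w
      ys = dot y s
      ss = dot s s
      yy = dot y y
      wt≈ : dot w t ≈ ys - ss
      wt≈ = trans (β-sym (dotᴮ m) w t) (trans (adjoint x w) (β-- (dotᴮ n) y s s))

  -- Incidence maps

  -- Stated for any family of pairs: it serves the edges of a graph and also the path on the copies.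
  module Incidence {m n : ℕ} (ε : Fin m → Fin n × Fin n) where

    incidence : Fin n → Fin m → Carrier
    incidence a e = scalar 1# a (proj₁ (ε e)) + scalar 1# a (proj₂ (ε e))

    N : Fin m ⊸ Fin n
    N = matrixᴸ incidence

    Nᵀ : Fin n ⊸ Fin m
    Nᵀ = reindex (proj₁ ∘ ε) +ᴸ reindex (proj₂ ∘ ε)

    sum-incidence : ∀ x e → sum (λ a → x a * incidence a e) ≈ map Nᵀ x e
    sum-incidence x e = trans (sum-cong-≋ {n} (λ a → distribˡ (x a) _ _))
      (trans (∑-distrib-+ {n} _ _) (+-cong (pick (proj₁ (ε e))) (pick (proj₂ (ε e)))))
      where
      pick : ∀ b → sum (λ a → x a * scalar 1# a b) ≈ x b
      pick b = trans (sum-cong-≋ {n} (λ a → trans (*-comm _ _) (*-congʳ (scalar-sym a b))))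
                     (trans (scalar-*ᵛ 1# x b) (*-identityˡ _))

    N-adjoint : ∀ x w → dot (map Nᵀ x) w ≈ dot x (map N w)
    N-adjoint x w = begin
      sum (λ e → map Nᵀ x e * w e)
        ≈⟨ sum-cong-≋ {m} (λ e → trans (*-congʳ (sym (sum-incidence x e))) (*-distribʳ-sum {n} (w e) _)) ⟩
      sum (λ e → sum (λ a → x a * incidence a e * w e))
        ≈⟨ ∑-comm {m} {n} _ ⟩
      sum (λ a → sum (λ e → x a * incidence a e * w e))
        ≈⟨ sum-cong-≋ {n} (λ a → trans (sum-cong-≋ {m} (λ e → *-assoc _ _ _)) (sym (*-distribˡ-sum {m} (x a) _))) ⟩
      sum (λ a → x a * sum (λ e → incidence a e * w e)) ∎

    ℓᴮ : SymmetricBilinear m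
    ℓᴮ = gram N

    κᴮ : SymmetricBilinear n
    κᴮ = gram Nᵀ

    -- `schur` with `N` and `Nᵀ` exchanged supplies the reverse map. Comparing positive indices
    -- gives the first equation, comparing negative ones the second.
    line-laplacian-inertia : ∀ {p r a b} → HasInertia (quadratic ℓᴮ) p r → HasInertia (quadratic κᴮ) a b →
                             n ℕ.+ r ≡ m ℕ.+ b × p ≡ a
    line-laplacian-inertia hℓ hκ = inertia-unique
      (inertia-≲ (schur Nᵀ N N-adjoint) (schur N Nᵀ (λ w x → trans (β-sym (dotᴮ n) (map N w) x)
          (trans (sym (N-adjoint x w)) (β-sym (dotᴮ m) (map Nᵀ x) w))))
        (inertia-⊕ (norm-inertia n) (inertia-neg hℓ)))
      (inertia-⊕ (norm-inertia m) (inertia-neg hκ))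

  -- Joining consecutive copies of a form κ at the coordinate v, which κ
  -- represents by the vector ρ: κ(x , ρ) = x v.
  module Joined {n : ℕ} (κ : SymmetricBilinear n) (v : Fin n) (ρ : Vector Carrier n)
                (κρ≈v : ∀ x → β κ x ρ ≈ x v) (0<ρv : 0# < ρ v) (k : ℕ)
                (joined : SymmetricBilinear (suc k ℕ.* n)) where

    open Incidence {k} {suc k} (λ j → inject₁ j , suc j) renaming (N to P; Nᵀ to Pᵀ; N-adjoint to P-adjoint)

    block : Vector Carrier (suc k ℕ.* n) → Fin (suc k) → Vector Carrier n
    block x i l = x (combine i l)

    links : (Fin (suc k ℕ.* n)) ⊸ Fin k
    links = Pᵀ ∘ᴸ reindex (λ i → combine i v)

    linked : Form (Fin k)
    linked = record
      { val      = λ z → dot z z + ρ v * dot (map P z) (map P z)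
      ; val-cong = λ z≈z′ → +-cong (β-cong (dotᴮ k) z≈z′ z≈z′)
                     (*-congˡ (β-cong (dotᴮ (suc k)) (map-cong P z≈z′) (map-cong P z≈z′)))
      ; val-0    = trans (+-cong (β-0 (dotᴮ k) _ (λ _ → refl))
                     (trans (*-congˡ (β-0 (dotᴮ (suc k)) (map P (λ _ → 0#)) (map-0 P (λ _ → refl)))) (zeroʳ (ρ v)))) (+-identityˡ 0#)
      }

    linked-inertia : HasInertia linked k 0
    linked-inertia = inertia-definite (λ z j zj≉0 → +-pos-NonNeg (dot-pos z j zj≉0)
      (*-NonNeg (inj₁ 0<ρv) (dot-NonNeg (map P z))))

    -- The multiple of `ρ` added to copy `i` is the sum of `z` over the links that meet this copy.
    shifted : Vector Carrier (suc k ℕ.* n) → Vector Carrier k → Fin (suc k) → Vector Carrier n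
    shifted x z i l = block x i l + ρ l * map P z i

    -- As κ(x, ρ) = x v, the cross terms add up to ⟨P z, y⟩ with y the values at `v`, which is ⟨z,
    -- links x⟩ by adjointness; and κ(ρ, ρ) = ρ v yields the last term.
    κ-shifted : ∀ x z → sum (λ i → - β κ (shifted x z i) (shifted x z i)) ≈
                sum (λ i → - β κ (block x i) (block x i)) - 2# * dot z (map links x) - ρ v * dot (map P z) (map P z)
    κ-shifted x z = begin
      sum (λ i → - β κ (shifted x z i) (shifted x z i))
        ≈⟨ sum-cong-≋ {suc k} (λ i → trans (-‿cong (block-shift i))
             (solve 4 (λ q t y r → :- (q :+ con (+ 2) :* (t :* y) :+ t :* (t :* r)) := :- q :- con (+ 2) :* (t :* y) :- r :* (t :* t))
                    refl (q i) (t i) (y i) (ρ v))) ⟩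
      sum (λ i → - q i - 2# * (t i * y i) - ρ v * (t i * t i))
        ≈⟨ ∑-distrib-- {suc k} (λ i → - q i - 2# * (t i * y i)) (λ i → ρ v * (t i * t i)) ⟩
      sum (λ i → - q i - 2# * (t i * y i)) - sum (λ i → ρ v * (t i * t i))
        ≈⟨ +-cong (∑-distrib-- {suc k} (λ i → - q i) (λ i → 2# * (t i * y i)))
                  (-‿cong (sym (*-distribˡ-sum {suc k} (ρ v) (λ i → t i * t i)))) ⟩
      sum (λ i → - q i) - sum (λ i → 2# * (t i * y i)) - ρ v * dot t t
        ≈⟨ +-congʳ (+-congˡ (-‿cong (trans (sym (*-distribˡ-sum {suc k} 2# (λ i → t i * y i))) (*-congˡ ty≈)))) ⟩
      sum (λ i → - q i) - 2# * dot z (map links x) - ρ v * dot t t ∎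
      where
      q t y : Fin (suc k) → Carrier
      q i = β κ (block x i) (block x i)
      t = map P z
      y i = x (combine i v)

      ty≈ : dot t y ≈ dot z (map Pᵀ y)
      ty≈ = trans (β-sym (dotᴮ (suc k)) t y) (trans (sym (P-adjoint y z)) (β-sym (dotᴮ k) (map Pᵀ y) z))

      tρ : Fin (suc k) → Vector Carrier n
      tρ i l = t i * ρ l

      block-shift : ∀ i → β κ (shifted x z i) (shifted x z i) ≈ q i + 2# * (t i * y i) + t i * (t i * ρ v)
      block-shift i = trans (β-cong κ (λ l → +-congˡ (*-comm _ _)) (λ l → +-congˡ (*-comm _ _)))
        (trans (β-square-+ κ (block x i) (tρ i)) (+-cong
          (+-congˡ (*-congˡ (trans (β-*ʳ κ (t i) (block x i) ρ) (*-congˡ (κρ≈v (block x i))))))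
          (trans (β-* κ (t i) ρ (tρ i)) (*-congˡ (trans (β-*ʳ κ (t i) ρ ρ) (*-congˡ (κρ≈v ρ)))))))

    module _ (joined≈ : ∀ x → β joined x x ≈ sum (λ i → β κ (block x i) (block x i)) + dot (map links x) (map links x)) where

      -- The terms with `ρ v` cancel. The cross term left by the shift completes |z|² to |z - u|² -
      -- |u|² for u = `links x`, and |u|² is exactly what the links contribute to `joined`.
      core : ∀ x z → let y = λ j → z j - map links x j in
             dot z z + ρ v * dot (map P z) (map P z) + sum (λ i → - β κ (shifted x z i) (shifted x z i))
             ≈ dot y y + - β joined x x
      core x z = begin
        zz + r + sum (λ i → - β κ (shifted x z i) (shifted x z i))
          ≈⟨ +-congˡ (trans (κ-shifted x z) (+-congʳ (+-congʳ (sum-neg {suc k} (λ i → β κ (block x i) (block x i)))))) ⟩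
        zz + r + (- Q - 2# * zu - r)
          ≈⟨ solve 5 (λ zz r Q zu uu → zz :+ r :+ (:- Q :- con (+ 2) :* zu :- r)
                                  := (zz :- con (+ 2) :* zu :+ uu) :+ (:- (Q :+ uu))) refl zz r Q zu uu ⟩
        (zz - 2# * zu + uu) + - (Q + uu)
          ≈⟨ +-cong (β-square-- (dotᴮ k) z u) (-‿cong (joined≈ x)) ⟨
        dot (λ j → z j - u j) (λ j → z j - u j) + - β joined x x ∎
        where
        u = map links x
        r = ρ v * dot (map P z) (map P z)
        zz = dot z z
        zu = dot z u
        uu = dot u u
        Q = sum (λ i → β κ (block x i) (block x i))

      join≲ : norm k ⊕ -ᶠ quadratic joined ≲ linked ⊕ copies (suc k) (-ᶠ quadratic κ)
      join≲ = record
        { φ       = ⟨ offset , reindex (uncurry combine) ∘ᴸ π₂ +ᴸ scaledReindex (ρ ∘ proj₂) proj₁ ∘ᴸ P ∘ᴸ offset ⟩ᴸ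
        ; scale   = 1#
        ; 0<scale = 0<1
        ; similar = λ yx → trans (core (yx ∘ inj₂) (map offset yx)) (trans
            (+-congʳ (β-cong (dotᴮ k) (cancel yx) (cancel yx))) (sym (*-identityˡ _)))
        }
        where
        offset : Fin k ⊎ Fin (suc k ℕ.* n) ⊸ Fin k
        offset = π₁ +ᴸ links ∘ᴸ π₂
        cancel : ∀ yx j → map offset yx j - map links (yx ∘ inj₂) j ≈ yx (inj₁ j)
        cancel yx j = solve 2 (λ y u → y :+ u :- u := y) refl _ _

      split≲ : linked ⊕ copies (suc k) (-ᶠ quadratic κ) ≲ norm k ⊕ -ᶠ quadratic joined
      split≲ = record
        { φ       = ⟨ π₁ -ᴸ links ∘ᴸ unshift , unshift ⟩ᴸ
        ; scale   = 1#
        ; 0<scale = 0<1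
        ; similar = λ zx → trans (sym (core (map unshift zx) (zx ∘ inj₁))) (trans
            (+-congˡ (sum-cong-≋ {suc k} (λ i → -‿cong (β-cong κ (reshift zx i) (reshift zx i)))))
            (sym (*-identityˡ _)))
        }
        where
        unshift : Fin k ⊎ (Fin (suc k) × Fin n) ⊸ Fin (suc k ℕ.* n)
        unshift = reindex (remQuot {suc k} n) ∘ᴸ (π₂ -ᴸ scaledReindex (ρ ∘ proj₂) proj₁ ∘ᴸ P ∘ᴸ π₁)
        reshift : ∀ zx i l → shifted (map unshift zx) (zx ∘ inj₁) i l ≈ zx (inj₂ (i , l))
        reshift zx i l = trans
          (+-congʳ (reflexive (≡.cong (map (π₂ -ᴸ scaledReindex (ρ ∘ proj₂) proj₁ ∘ᴸ P ∘ᴸ π₁) zx) (remQuot-combine i l))))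
          (solve 2 (λ x s → x :- s :+ s := x) refl _ _)

      -- Both sides carry `k` extra positive squares, from `norm k` and from `linked`; they cancel.
      joined-inertia : ∀ {a b a′ b′} → HasInertia (quadratic κ) a b → HasInertia (quadratic joined) a′ b′ →
                       a′ ≡ suc k ℕ.* a × b′ ≡ suc k ℕ.* b
      joined-inertia hκ hj = from-sum (inertia-unique
          (inertia-≲ join≲ split≲ (inertia-⊕ (norm-inertia k) (inertia-neg hj)))
          (inertia-⊕ linked-inertia (inertia-copies (suc k) (inertia-neg hκ))))
        where
        from-sum : ∀ {a b a′ b′} → k ℕ.+ b′ ≡ k ℕ.+ suc k ℕ.* b × a′ ≡ suc k ℕ.* a →
                   a′ ≡ suc k ℕ.* a × b′ ≡ suc k ℕ.* b
        from-sum (k+b′≡ , a′≡) = a′≡ , ℕ.+-cancelˡ-≡ k _ _ k+b′≡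

  open import Algebra.Definitions.RawMonoid +-rawMonoid using () renaming (_×_ to _·_)

  -- Sums over lists

  module _ {a} {A : Set a} where

    -- Indexed by positions rather than folded, so that an inner product over the positions of
    -- `edges G` is such a sum by definition.
    sumOver : (A → Carrier) → List A → Carrier
    sumOver F xs = sum (λ i → F (lookup xs i))

    sumOver-++ : ∀ F xs ys → sumOver F (xs ++ ys) ≈ sumOver F xs + sumOver F ys
    sumOver-++ F []       ys = sym (+-identityˡ _)
    sumOver-++ F (x ∷ xs) ys = trans (+-congˡ (sumOver-++ F xs ys)) (sym (+-assoc _ _ _))

    sumOver-tabulate : ∀ F {n} (f : Fin n → A) → sumOver F (tabulate f) ≈ sum (F ∘ f)
    sumOver-tabulate F {zero}  f = refl
    sumOver-tabulate F {suc n} f = +-congˡ (sumOver-tabulate F (f ∘ suc))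

    sumOver-filter : ∀ F {p} {P : Pred A p} (P? : Decidable P) xs →
                     sumOver F (filter P? xs) ≈ sumOver (λ x → if ⌊ P? x ⌋ then F x else 0#) xs
    sumOver-filter F P? []       = refl
    sumOver-filter F P? (x ∷ xs) with P? x
    ... | yes _ = +-congˡ (sumOver-filter F P? xs)
    ... | no  _ = trans (sumOver-filter F P? xs) (sym (+-identityˡ _))

    length-filter-· : ∀ {p} {P : Pred A p} (P? : Decidable P) xs →
                      length (filter P? xs) · 1# ≈ sumOver (λ x → if ⌊ P? x ⌋ then 1# else 0#) xs
    length-filter-· P? []       = refl
    length-filter-· P? (x ∷ xs) with P? x
    ... | yes _ = +-congˡ (length-filter-· P? xs)
    ... | no  _ = trans (length-filter-· P? xs) (sym (+-identityˡ _))

    sumOver-↭ : ∀ F {xs ys : List A} → xs ↭ ys → sumOver F xs ≈ sumOver F ys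
    sumOver-↭ F _↭_.refl          = refl
    sumOver-↭ F (prep x p)        = +-congˡ (sumOver-↭ F p)
    sumOver-↭ F (swap x y p)      = trans (+-congˡ (+-congˡ (sumOver-↭ F p)))
      (solve 3 (λ a b s → a :+ (b :+ s) := b :+ (a :+ s)) refl (F x) (F y) _)
    sumOver-↭ F (_↭_.trans p q)   = trans (sumOver-↭ F p) (sumOver-↭ F q)

  sumOver-map : ∀ {a b} {A : Set a} {B : Set b} (F : B → Carrier) (f : A → B) xs → sumOver F (List.map f xs) ≈ sumOver (F ∘ f) xs
  sumOver-map F f []       = refl
  sumOver-map F f (x ∷ xs) = +-congˡ (sumOver-map F f xs)

  sumOver-cartesianProductWith : ∀ {a b d} {A : Set a} {B : Set b} {D : Set d} (F : D → Carrier) (f : A → B → D) xs ys →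
    sumOver F (cartesianProductWith f xs ys) ≈ sumOver (λ x → sumOver (λ y → F (f x y)) ys) xs
  sumOver-cartesianProductWith F f []       ys = refl
  sumOver-cartesianProductWith F f (x ∷ xs) ys = trans (sumOver-++ F (List.map (f x) ys) _)
    (+-cong (sumOver-map F (f x) ys) (sumOver-cartesianProductWith F f xs ys))

  -- Graph matrices

  indicator : ∀ {p} {P : Set p} → Dec P → Carrier
  indicator P? = if ⌊ P? ⌋ then 1# else 0#

  indicator-yes : ∀ {p} {P : Set p} (P? : Dec P) → P → indicator P? ≈ 1#
  indicator-yes (yes _) _ = refl
  indicator-yes (no ¬P) P = contradiction P ¬P

  indicator-no : ∀ {p} {P : Set p} (P? : Dec P) → ¬ P → indicator P? ≈ 0#
  indicator-no (yes P) ¬P = contradiction P ¬P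
  indicator-no (no _)  _  = refl

  if-indicator : ∀ {p} {P : Set p} (P? : Dec P) x → (if ⌊ P? ⌋ then x else 0#) ≈ indicator P? * x
  if-indicator (yes _) x = sym (*-identityˡ x)
  if-indicator (no _)  x = sym (zeroˡ x)

  adjacency-sym : ∀ {n} (G : Graph n) i j → adjacency G i j ≈ adjacency G j i
  adjacency-sym G i j with Graph._~?_ G i j
  ... | yes i~j = sym (indicator-yes (Graph._~?_ G j i) (Graph.~-sym G i~j))
  ... | no  i≁j = sym (indicator-no (Graph._~?_ G j i) (i≁j ∘ Graph.~-sym G))

  module EdgeIncidence {n : ℕ} (G : Graph n) where
    open Graph G
    open Incidence (lookup (edges G)) public

    private
      forward : Fin n → Fin n → Carrier
      forward a b = indicator ((a <?ᶠ b) ×-dec (a ~? b))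

      keep : ∀ {a b} → a <ᶠ b → ∀ (a~?b : Dec (a ~ b)) → indicator a~?b ≈ indicator ((a <?ᶠ b) ×-dec a~?b)
      keep {a} {b} a<b (yes a~b) = sym (indicator-yes ((a <?ᶠ b) ×-dec yes a~b) (a<b , a~b))
      keep {a} {b} a<b (no a≁b)  = sym (indicator-no ((a <?ᶠ b) ×-dec no a≁b) (a≁b ∘ proj₂))

      adjacency-split : ∀ a b → adjacency G a b ≈ forward a b + forward b a
      adjacency-split a b with <-cmp a b
      ... | tri≈ _ ≡.refl _ = trans (indicator-no (a ~? a) (~-irrefl ≡.refl))
        (sym (trans (+-cong loopless loopless) (+-identityˡ 0#)))
        where loopless = indicator-no ((a <?ᶠ a) ×-dec (a ~? a)) (~-irrefl ≡.refl ∘ proj₂)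
      ... | tri< a<b _ b≮a = trans (keep a<b (a ~? b)) (sym (trans
        (+-congˡ (indicator-no ((b <?ᶠ a) ×-dec (b ~? a)) (b≮a ∘ proj₁))) (+-identityʳ _)))
      ... | tri> a≮b _ b<a = trans (trans (adjacency-sym G a b) (keep b<a (b ~? a))) (sym (trans
        (+-congʳ (indicator-no ((a <?ᶠ b) ×-dec (a ~? b)) (a≮b ∘ proj₁))) (+-identityˡ _)))

    -- Turns the sum over the edge list into a double sum over vertices, the shape in which the
    -- matrix Q(G) is given.
    dot-Nᵀ : ∀ x y → dot (map Nᵀ x) (map Nᵀ y) ≈ sum (λ a → sum (λ b → forward a b * ((x a + x b) * (y a + y b))))
    dot-Nᵀ x y = begin
      sumOver F (edges G)
        ≈⟨ sumOver-filter F _ (cartesianProduct (allFin n) (allFin n)) ⟩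
      sumOver F′ (cartesianProduct (allFin n) (allFin n))
        ≈⟨ sumOver-cartesianProductWith F′ _,_ (allFin n) (allFin n) ⟩
      sumOver (λ a → sumOver (λ b → F′ (a , b)) (allFin n)) (allFin n)
        ≈⟨ sumOver-tabulate (λ a → sumOver (λ b → F′ (a , b)) (allFin n)) {n} id ⟩
      sum (λ a → sumOver (λ b → F′ (a , b)) (allFin n))
        ≈⟨ sum-cong-≋ {n} (λ a → trans (sumOver-tabulate (λ b → F′ (a , b)) {n} id) (sum-cong-≋ {n} (λ b →
             if-indicator ((a <?ᶠ b) ×-dec (a ~? b)) (F (a , b))))) ⟩
      sum (λ a → sum (λ b → forward a b * F (a , b))) ∎
      where
      F F′ : Fin n × Fin n → Carrier
      F (a , b) = (x a + x b) * (y a + y b)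
      F′ (a , b) = if ⌊ (a <?ᶠ b) ×-dec (a ~? b) ⌋ then F (a , b) else 0#

    -- This is Q(G) = N Nᵀ. Pairing x with Q(G) y gives the sum of x_a (y_a + y_b) over ordered
    -- adjacent pairs, and the two orientations of an edge together give (x_a + x_b)(y_a + y_b).
    signlessLaplacian-κ : ∀ x y → dot x ((signlessLaplacian G -ᴹ scalar 2#) *ᵛ y) ≈ β κᴮ x y
    signlessLaplacian-κ x y = begin
      sum (λ a → x a * ((signlessLaplacian G -ᴹ scalar 2#) *ᵛ y) a)
        ≈⟨ sum-cong-≋ {n} (λ a → trans (*-congˡ (row a)) (solve 4 (λ x s t y → x :* (s :- t :* y) := x :* s :- t :* (x :* y))
             refl (x a) (sum (λ b → adjacency G a b * (y a + y b))) 2# (y a))) ⟩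
      sum (λ a → x a * sum (λ b → adjacency G a b * (y a + y b)) - 2# * (x a * y a))
        ≈⟨ ∑-distrib-- {n} _ _ ⟩
      sum (λ a → x a * sum (λ b → adjacency G a b * (y a + y b))) - sum (λ a → 2# * (x a * y a))
        ≈⟨ +-cong symmetrised (-‿cong (sym (*-distribˡ-sum {n} 2# _))) ⟩
      dot (map Nᵀ x) (map Nᵀ y) - 2# * dot x y ∎
      where
      A = adjacency G

      degree≈ : ∀ a → degree G a · 1# ≈ sum (λ b → A a b)
      degree≈ a = trans (length-filter-· (a ~?_) (allFin n)) (sumOver-tabulate (A a) {n} id)

      row : ∀ a → ((signlessLaplacian G -ᴹ scalar 2#) *ᵛ y) a ≈ sum (λ b → A a b * (y a + y b)) - 2# * y a
      row a = begin
        sum (λ b → (A a b + scalar (degree G a · 1#) a b - scalar 2# a b) * y b)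
          ≈⟨ sum-cong-≋ {n} (λ b → solve 4 (λ a d t y → (a :+ d :- t) :* y := a :* y :+ d :* y :- t :* y)
               refl (A a b) (scalar (degree G a · 1#) a b) (scalar 2# a b) (y b)) ⟩
        sum (λ b → A a b * y b + scalar (degree G a · 1#) a b * y b - scalar 2# a b * y b)
          ≈⟨ trans (∑-distrib-- {n} _ _) (+-congʳ (∑-distrib-+ {n} _ _)) ⟩
        sum (λ b → A a b * y b) + sum (λ b → scalar (degree G a · 1#) a b * y b) - sum (λ b → scalar 2# a b * y b)
          ≈⟨ +-cong (+-congˡ (trans (scalar-*ᵛ _ y a) (trans (*-congʳ (degree≈ a)) (*-distribʳ-sum {n} (y a) _))))
                    (-‿cong (scalar-*ᵛ 2# y a)) ⟩
        sum (λ b → A a b * y b) + sum (λ b → A a b * y a) - 2# * y a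
          ≈⟨ +-congʳ (trans (sym (∑-distrib-+ {n} _ _)) (sum-cong-≋ {n} (λ b → trans (sym (distribˡ _ _ _)) (*-congˡ (+-comm _ _))))) ⟩
        sum (λ b → A a b * (y a + y b)) - 2# * y a ∎

      symmetrised : sum (λ a → x a * sum (λ b → A a b * (y a + y b))) ≈ dot (map Nᵀ x) (map Nᵀ y)
      symmetrised = begin
        sum (λ a → x a * sum (λ b → A a b * (y a + y b)))
          ≈⟨ sum-cong-≋ {n} (λ a → trans (*-distribˡ-sum {n} (x a) _) (trans
               (sum-cong-≋ {n} (λ b → trans (*-congˡ (*-congʳ (adjacency-split a b)))
                 (solve 5 (λ x p q y z → x :* ((p :+ q) :* (y :+ z)) := p :* (x :* (y :+ z)) :+ q :* (x :* (z :+ y)))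
                        refl (x a) (forward a b) (forward b a) (y a) (y b))))
               (∑-distrib-+ {n} _ _))) ⟩
        sum (λ a → sum (λ b → forward a b * (x a * (y a + y b))) + sum (λ b → forward b a * (x a * (y b + y a))))
          ≈⟨ trans (∑-distrib-+ {n} _ _) (+-congˡ (∑-comm {n} {n} _)) ⟩
        sum (λ a → sum (λ b → forward a b * (x a * (y a + y b)))) + sum (λ b → sum (λ a → forward b a * (x a * (y b + y a))))
          ≈⟨ trans (sym (∑-distrib-+ {n} _ _)) (sum-cong-≋ {n} (λ a → trans (sym (∑-distrib-+ {n} _ _)) (sum-cong-≋ {n} (λ b →
               solve 5 (λ p x z y w → p :* (x :* (y :+ w)) :+ p :* (z :* (y :+ w)) := p :* ((x :+ z) :* (y :+ w)))
                     refl (forward a b) (x a) (x b) (y a) (y b))))) ⟩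
        sum (λ a → sum (λ b → forward a b * ((x a + x b) * (y a + y b))))
          ≈⟨ dot-Nᵀ x y ⟨
        dot (map Nᵀ x) (map Nᵀ y) ∎

    private
      ends : ∀ e → proj₁ (lookup (edges G) e) <ᶠ proj₂ (lookup (edges G) e)
      ends e = proj₁ (∈-edges⁻ G (∈-lookup e))

      -- Distinct edges share at most one end, an edge shares two with itself.
      share : ∀ (e f : Fin n × Fin n) → proj₁ e <ᶠ proj₂ e → proj₁ f <ᶠ proj₂ f → e ≢ f →
              indicator (shareEnd? e f) ≈
              scalar 1# (proj₁ e) (proj₁ f) + scalar 1# (proj₁ e) (proj₂ f)
              + (scalar 1# (proj₂ e) (proj₁ f) + scalar 1# (proj₂ e) (proj₂ f))
      share (a , b) (c , d) a<b c<d e≢f with a ≟ᶠ c | a ≟ᶠ d | b ≟ᶠ c | b ≟ᶠ d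
      ... | yes ≡.refl | yes ≡.refl | _          | _          = contradiction c<d (ℕ.<-irrefl ≡.refl)
      ... | yes ≡.refl | no _       | yes ≡.refl | _          = contradiction a<b (ℕ.<-irrefl ≡.refl)
      ... | yes ≡.refl | no _       | no _       | yes ≡.refl = contradiction ≡.refl e≢f
      ... | yes _      | no _       | no _       | no _       = solve 0 (con (+ 1) := con (+ 1) :+ con (+ 0) :+ (con (+ 0) :+ con (+ 0))) refl
      ... | no _       | yes ≡.refl | yes ≡.refl | _          = contradiction c<d (ℕ.<-asym a<b)
      ... | no _       | yes ≡.refl | no _       | yes ≡.refl = contradiction a<b (ℕ.<-irrefl ≡.refl)
      ... | no _       | yes _      | no _       | no _       = solve 0 (con (+ 1) := con (+ 0) :+ con (+ 1) :+ (con (+ 0) :+ con (+ 0))) refl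
      ... | no _       | no _       | yes ≡.refl | yes ≡.refl = contradiction c<d (ℕ.<-irrefl ≡.refl)
      ... | no _       | no _       | yes _      | no _       = solve 0 (con (+ 1) := con (+ 0) :+ con (+ 0) :+ (con (+ 1) :+ con (+ 0))) refl
      ... | no _       | no _       | no _       | yes _      = solve 0 (con (+ 1) := con (+ 0) :+ con (+ 0) :+ (con (+ 0) :+ con (+ 1))) refl
      ... | no _       | no _       | no _       | no _       = solve 0 (con (+ 0) := con (+ 0) :+ con (+ 0) :+ (con (+ 0) :+ con (+ 0))) refl

    -- This is A(L(G)) = Nᵀ N - 2I, entry by entry.
    lineGraph-entry : ∀ e f → adjacency (lineGraph G) e f ≈ map Nᵀ (λ a → incidence a f) e - scalar 2# e f
    lineGraph-entry e f = entry (e ≟ᶠ f)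
      where
      entry : Dec (e ≡ f) → adjacency (lineGraph G) e f ≈ map Nᵀ (λ a → incidence a f) e - scalar 2# e f
      entry (yes ≡.refl) = trans
        (indicator-no (Graph._~?_ (lineGraph G) e e) (λ (e≢e , _) → e≢e ≡.refl))
        (sym (trans (+-cong
          (+-cong (+-cong (scalar-≡ {i = proj₁ (lookup (edges G) e)} ≡.refl) (scalar-≢ a≢b))
                  (+-cong (scalar-≢ (a≢b ∘ ≡.sym)) (scalar-≡ {i = proj₂ (lookup (edges G) e)} ≡.refl)))
          (-‿cong (scalar-≡ {i = e} ≡.refl)))
          (solve 0 (con (+ 1) :+ con (+ 0) :+ (con (+ 0) :+ con (+ 1)) :- con (+ 2) := con (+ 0)) refl)))
        where
        a≢b : proj₁ (lookup (edges G) e) ≢ proj₂ (lookup (edges G) e)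
        a≢b eq = ℕ.<-irrefl (≡.cong toℕ eq) (ends e)
      entry (no e≢f) = trans distinct (trans
        (share (lookup (edges G) e) (lookup (edges G) f) (ends e) (ends f) (e≢f ∘ lookup-unique (edges-unique G) e f))
        (sym (trans (+-congˡ (trans (-‿cong (scalar-≢ e≢f)) -0≈0)) (+-identityʳ _))))
        where
        distinct : adjacency (lineGraph G) e f ≈ indicator (shareEnd? (lookup (edges G) e) (lookup (edges G) f))
        distinct with e ≟ᶠ f
        ... | yes e≡f = contradiction e≡f e≢f
        ... | no  _   with shareEnd? (lookup (edges G) e) (lookup (edges G) f)
        ...   | yes _ = refl
        ...   | no  _ = refl

    lineGraph-ℓ : ∀ w → dot w (adjacency (lineGraph G) *ᵛ w) ≈ β ℓᴮ w w
    lineGraph-ℓ w = begin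
      dot w (adjacency (lineGraph G) *ᵛ w)
        ≈⟨ β-cong (dotᴮ m) {x = w} (λ _ → refl) row ⟩
      dot w (λ e → map Nᵀ (map N w) e - 2# * w e)
        ≈⟨ trans (β-sym (dotᴮ m) w _) (β-- (dotᴮ m) _ _ w) ⟩
      dot (map Nᵀ (map N w)) w - dot (λ e → 2# * w e) w
        ≈⟨ +-cong (N-adjoint (map N w) w) (-‿cong (β-* (dotᴮ m) 2# w w)) ⟩
      dot (map N w) (map N w) - 2# * dot w w ∎
      where
      m = edgeCount G
      row : ∀ e → (adjacency (lineGraph G) *ᵛ w) e ≈ map Nᵀ (map N w) e - 2# * w e
      row e = begin
        sum (λ f → adjacency (lineGraph G) e f * w f)
          ≈⟨ sum-cong-≋ {m} (λ f → trans (*-congʳ (lineGraph-entry e f))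
               (solve 4 (λ p q t w → (p :+ q :- t) :* w := p :* w :+ q :* w :- t :* w) refl
                  (incidence (proj₁ (lookup (edges G) e)) f) (incidence (proj₂ (lookup (edges G) e)) f) (scalar 2# e f) (w f))) ⟩
        sum (λ f → incidence (proj₁ (lookup (edges G) e)) f * w f + incidence (proj₂ (lookup (edges G) e)) f * w f - scalar 2# e f * w f)
          ≈⟨ trans (∑-distrib-- {m} _ _) (+-cong (∑-distrib-+ {m} _ _) (-‿cong (scalar-*ᵛ 2# w e))) ⟩
        map Nᵀ (map N w) e - 2# * w e ∎

    lineGraph-inertia : ∀ xs → IsSpectrum (adjacency (lineGraph G)) xs →
                        HasInertia (quadratic ℓᴮ) (count (0# <?_) xs) (count (_<? 0#) xs)
    lineGraph-inertia xs spec = inertia-≲ (≲-pointwise (λ w → sym (lineGraph-ℓ w))) (≲-pointwise lineGraph-ℓ)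
      (spectrum-inertia (adjacency-sym (lineGraph G)) xs spec)

  -- The chain of copies

  sum-splitAt : ∀ m {n} (f : Vector Carrier (m ℕ.+ n)) → sum f ≈ sum (λ i → f (i ↑ˡ n)) + sum (λ j → f (m ↑ʳ j))
  sum-splitAt zero    f = sym (+-identityˡ _)
  sum-splitAt (suc m) f = trans (+-congˡ (sum-splitAt m (f ∘ suc))) (sym (+-assoc _ _ _))

  sum-combine : ∀ m n (f : Vector Carrier (m ℕ.* n)) → sum f ≈ sum (λ i → sum (λ j → f (combine {m} i j)))
  sum-combine zero    n f = refl
  sum-combine (suc m) n f = trans (sum-splitAt n f) (+-congˡ (sum-combine m n (λ j → f (n ↑ʳ j))))

  module Chain {n : ℕ} (B : Graph n) (v : Fin n) (ρ : Vector Carrier n)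
               (Qρ≈v : ∀ a → ((signlessLaplacian B -ᴹ scalar 2#) *ᵛ ρ) a ≈ scalar 1# a v)
               (0<ρv : 0# < ρ v) (k : ℕ) where

    private
      module B = EdgeIncidence B
      module C = EdgeIncidence (chain B v (suc k))

    κρ≈v : ∀ x → β B.κᴮ x ρ ≈ x v
    κρ≈v x = trans (sym (B.signlessLaplacian-κ x ρ)) (trans (β-cong (dotᴮ n) {x = x} (λ _ → refl) Qρ≈v)
      (trans (sum-cong-≋ {n} (λ a → trans (*-comm (x a) _) (*-congʳ (scalar-sym a v))))
        (trans (scalar-*ᵛ 1# x v) (*-identityˡ _))))

    open Joined B.κᴮ v ρ κρ≈v 0<ρv k C.κᴮ

    -- An edge inside a copy contributes to the Gram form of `B`, a link contributes the square of
    -- the sum of its two values at `v`. Every vertex lies in a copy, so the term -2|x|² is shared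
    -- out among the copies alone.
    chain-κ : ∀ x → β C.κᴮ x x ≈ sum (λ i → β B.κᴮ (block x i) (block x i)) + dot (map links x) (map links x)
    chain-κ x = begin
      sumOver F (edges (chain B v (suc k))) - 2# * dot x x
        ≈⟨ +-cong edge-sum (-‿cong (trans (*-congˡ (sum-combine (suc k) n (λ a → x a * x a))) (*-distribˡ-sum {suc k} 2# norms))) ⟩
      sum grams + dot u u - sum (λ i → 2# * norms i)
        ≈⟨ solve 3 (λ g u s → g :+ u :- s := g :- s :+ u) refl (sum grams) (dot u u) _ ⟩
      sum grams - sum (λ i → 2# * norms i) + dot u u
        ≈⟨ +-congʳ (∑-distrib-- {suc k} grams (λ i → 2# * norms i)) ⟨
      sum (λ i → grams i - 2# * norms i) + dot u u ∎
      where
      u = map links x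
      F : Fin (suc k ℕ.* n) × Fin (suc k ℕ.* n) → Carrier
      F (a , b) = (x a + x b) * (x a + x b)
      grams norms : Fin (suc k) → Carrier
      grams i = dot (map B.Nᵀ (block x i)) (map B.Nᵀ (block x i))
      norms i = dot (block x i) (block x i)

      edge-sum : sumOver F (edges (chain B v (suc k))) ≈ sum grams + dot u u
      edge-sum = begin
        sumOver F (edges (chain B v (suc k)))
          ≈⟨ sumOver-↭ F (edges-chain-↭ B v k) ⟩
        sumOver F (chainEdges B v k)
          ≈⟨ sumOver-++ F (cartesianProductWith (copyEdge B v k) (allFin (suc k)) (edges B)) _ ⟩
        sumOver F (cartesianProductWith (copyEdge B v k) (allFin (suc k)) (edges B)) + sumOver F (List.map (linkEdge B v k) (allFin k))
          ≈⟨ +-cong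
               (trans (sumOver-cartesianProductWith F (copyEdge B v k) (allFin (suc k)) (edges B))
                      (sumOver-tabulate (λ i → sumOver (λ e → F (copyEdge B v k i e)) (edges B)) {suc k} id))
               (trans (sumOver-map F (linkEdge B v k) (allFin k)) (sumOver-tabulate (λ j → F (linkEdge B v k j)) {k} id)) ⟩
        sum grams + dot u u ∎

    -- With K = k + 1 and m edges in `B`: n + r = m + b and K n + r′ = m′ + b′, where b′ = K b and
    -- m′ = K m + k. Substitution leaves r′ = K r + k.
    chain-inertia : ∀ {p r p′ r′} → HasInertia (quadratic B.ℓᴮ) p r → HasInertia (quadratic C.ℓᴮ) p′ r′ →
                    p′ ≡ suc k ℕ.* p × r′ ≡ suc k ℕ.* r ℕ.+ k
    chain-inertia {p} {r} {p′} {r′} hB hC = combined (bilinear-inertia B.κᴮ) (bilinear-inertia C.κᴮ)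
      where
      arithmetic : ∀ {a b a′ b′} → n ℕ.+ r ≡ edgeCount B ℕ.+ b × p ≡ a →
                   suc k ℕ.* n ℕ.+ r′ ≡ edgeCount (chain B v (suc k)) ℕ.+ b′ × p′ ≡ a′ →
                   a′ ≡ suc k ℕ.* a × b′ ≡ suc k ℕ.* b → p′ ≡ suc k ℕ.* p × r′ ≡ suc k ℕ.* r ℕ.+ k
      arithmetic {b = b} (n+r≡m+b , ≡.refl) (Kn+r′≡m′+b′ , ≡.refl) (a′≡Ka , ≡.refl) = a′≡Ka ,
        ℕ.+-cancelˡ-≡ (suc k ℕ.* n) _ _ (ℕ≡.begin
          suc k ℕ.* n ℕ.+ r′                              ℕ≡.≡⟨ Kn+r′≡m′+b′ ⟩
          edgeCount (chain B v (suc k)) ℕ.+ suc k ℕ.* b    ℕ≡.≡⟨ ≡.cong (ℕ._+ suc k ℕ.* b) (edgeCount-chain B v k) ⟩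
          suc k ℕ.* m ℕ.+ k ℕ.+ suc k ℕ.* b                ℕ≡.≡⟨ ℕsolve 4 (λ K m k b → K ⊛ m ⊞ k ⊞ K ⊛ b ⊜ K ⊛ (m ⊞ b) ⊞ k) ≡.refl (suc k) m k b ⟩
          suc k ℕ.* (m ℕ.+ b) ℕ.+ k                        ℕ≡.≡⟨ ≡.cong (λ s → suc k ℕ.* s ℕ.+ k) (≡.sym n+r≡m+b) ⟩
          suc k ℕ.* (n ℕ.+ r) ℕ.+ k                        ℕ≡.≡⟨ ℕsolve 4 (λ K n k r → K ⊛ (n ⊞ r) ⊞ k ⊜ K ⊛ n ⊞ (K ⊛ r ⊞ k)) ≡.refl (suc k) n k r ⟩
          suc k ℕ.* n ℕ.+ (suc k ℕ.* r ℕ.+ k)              ℕ≡.∎)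
        where
        m = edgeCount B
        module ℕ≡ = ≡.≡-Reasoning
        open ℕSolver.+-*-Solver renaming (solve to ℕsolve; _:+_ to _⊞_; _:*_ to _⊛_; _:=_ to _⊜_)

      combined : (∃₂ λ a b → HasInertia (quadratic B.κᴮ) a b) → (∃₂ λ a b → HasInertia (quadratic C.κᴮ) a b) →
                 p′ ≡ suc k ℕ.* p × r′ ≡ suc k ℕ.* r ℕ.+ k
      combined (a , b , hκ) (a′ , b′ , hκ′) = arithmetic
        (B.line-laplacian-inertia hB hκ) (C.line-laplacian-inertia hC hκ′) (joined-inertia chain-κ hκ hκ′)

    chain-signature : ∀ {σ} → lineGraph B hasSignature σ →
                      lineGraph (chain B v (suc k)) hasSignature (+ suc k ℤ.* σ ℤ.- (+ suc k ℤ.- + 1))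
    chain-signature {σ} (xs , spec , σ≡) = ys , spec′ , from-counts
        (chain-inertia (B.lineGraph-inertia xs spec) (C.lineGraph-inertia ys spec′)) σ≡
      where
      L-sym = adjacency-sym (lineGraph (chain B v (suc k)))
      E = spectral-theorem (adjacency (lineGraph (chain B v (suc k)))) L-sym
      ys = eigenvalues L-sym E
      spec′ = eigenbasis-spectrum L-sym E
      from-counts : ∀ {p r p′ r′} → p′ ≡ suc k ℕ.* p × r′ ≡ suc k ℕ.* r ℕ.+ k → σ ≡ + p ℤ.- + r →
                    + suc k ℤ.* σ ℤ.- (+ suc k ℤ.- + 1) ≡ + p′ ℤ.- + r′
      from-counts {p} {r} (≡.refl , ≡.refl) ≡.refl = ≡.trans
        (ℤsolve 3 (λ K p r → K ⊛ (p ⊟ r) ⊟ (K ⊟ const (+ 1)) ⊜ K ⊛ p ⊟ (K ⊛ r ⊞ (K ⊟ const (+ 1)))) ≡.refl (+ suc k) (+ p) (+ r))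
        -- `+ suc k ℤ.- + 1` computes to `+ k`, so the solver's right-hand side already has the
        -- required shape.
        (≡.cong₂ ℤ._-_ (≡.sym (ℤ.pos-* (suc k) p)) (≡.cong (ℤ._+ + k) (≡.sym (ℤ.pos-* (suc k) r))))
        where
        open ℤSolver.+-*-Solver renaming
          (solve to ℤsolve; _:+_ to _⊞_; _:*_ to _⊛_; _:-_ to _⊟_; _:=_ to _⊜_; con to const)

open import Data.Integer.Base using (_*_; _-_)
open import Data.Nat.Base using (_≤_; _∸_)

theorem5 : ∀ {c ℓ₁ ℓ₂} (R : RealClosedField c ℓ₁ ℓ₂) →
    let open Spectral R in
    ∀ {n : ℕ} (B : Graph n) (σ : ℤ) (v : Fin n) →
    n ≤ edgeCount B →
    lineGraph B hasSignature σ →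
    ¬ IsEigenvalue (signlessLaplacian B) 2# →
    (∃[ p ] (φ[ B , v ]≈ p × 0# < p)) →
    ∀ (k : ℕ) → 1 ≤ k →
    lineGraph (chain B v k) hasSignature (+ k * σ - (+ k - + 1))
theorem5 R B σ v _ sσ _ (p , (P , (QP≈1 , _) , Pvv≈p) , 0<p) (suc k) _ =
  -- Column `v` of the inverse plays the part of `ρ`, so `ρ v` is the value of φ at `v`. After
  -- matching on `suc k`, `k` is the number of links.
  LineGraphSignature.Chain.chain-signature R B v (λ a → P a v) (λ a → QP≈1 a v) 0<Pvv k sσ
  where
  0<Pvv = IsStrictTotalOrder.<-respʳ-≈ (RealClosedField.isStrictTotalOrder R) (RealClosedField.sym R Pvv≈p) 0<p
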